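{- For every $\lambda_\oplus$-term $M$, $\mathrm{NF}(T(M)) = T(\mathrm{BT}(M))$.
   Context: $\lambda_\oplus$-terms are given by $M,N,P,Q ::= x \mid \lambda x.M \mid MN \mid M\oplus N$, considered up to renaming of bound variables; $M[N/x]$ is capture-avoiding substitution; application associates to the left and binds tighter than abstraction, which binds tighter than $\oplus$; $\lambda\vec x$ denotes a possibly empty sequence of abstractions. The hereditary head reduction function $L$ on $\lambda_\oplus$-terms is defined by: $L(M\oplus N)=L(M)\oplus L(N)$; $L(\lambda\vec x.\lambda y.(M\oplus N))=\lambda\vec x.(\lambda y.M\oplus\lambda y.N)$; $L(\lambda\vec x.(M\oplus N)PQ_1\cdots Q_k)=\lambda\vec x.(MP\oplus NP)Q_1\cdots Q_k$; $L(\lambda\vec x.yQ_1\cdots Q_k)=\lambda\vec x.y\,L(Q_1)\cdots L(Q_k)$; $L(\lambda\vec x.(\lambda y.M)NQ_1\cdots Q_k)=\lambda\vec x.M[N/y]Q_1\cdots Q_k$ ($k\ge0$). Term approximants are given by the same grammar extended with a constant $\bot$. The order $\le$ on approximants is the least preorder with $\bot\le M$ for all $M$ and compatible with the constructors (if $M\le M'$ and $N\le N'$ then $\lambda x.M\le\lambda x.M'$, $MN\le M'N'$, $M\oplus N\le M'\oplus N'$). The set $\mathcal N$ of elementary Böhm trees is the least set of approximants containing $\bot$, containing $\lambda\vec x.xN_1\cdots N_n$ whenever $N_1,\dots,N_n\in\mathcal N$ ($n\ge0$, $\vec x$ possibly empty), and containing $N_1\oplus N_2$ whenever $N_1,N_2\in\mathcal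 N$. For a $\lambda_\oplus$-term: $\mathrm{eBT}(M\oplus N)=\mathrm{eBT}(M)\oplus\mathrm{eBT}(N)$, $\mathrm{eBT}(\lambda\vec x.xQ_1\cdots Q_k)=\lambda\vec x.x\,\mathrm{eBT}(Q_1)\cdots\mathrm{eBT}(Q_k)$, and $\mathrm{eBT}(M)=\bot$ in all other cases. The Böhm tree of $M$ is $\mathrm{BT}(M)=\{N\in\mathcal N\mid \exists n\in\mathbb N,\ N\le\mathrm{eBT}(L^n(M))\}$. Resource terms and resource monomials are defined by mutual induction: $s,t,u ::= x\mid\lambda x.s\mid\langle s\rangle\bar t\mid s\oplus\bullet\mid\bullet\oplus s$ and $\bar t ::= [t_1,\dots,t_n]$, where monomials are finite multisets of resource terms; all up to $\alpha$-equivalence. A resource expression is a resource term or monomial. We write $\bar t\cdot\bar u$ for multiset union. We consider finite formal sums of resource terms (resp. monomials) with coefficients in $\mathbb N$; $E_e$ is the coefficient of $e$ in $E$ and $\mathrm{supp}(E)=\{e\mid E_e\ne0\}$. All constructors are extended to finite sums by (multi)linearity. $n_x(e)$ is the number of free occurrences of $x$ in $e$. For $\bar u=[u_1,\dots,u_n]$, the symmetric multilinear substitution $\partial_x e\cdot\bar u$ is defined by induction on $e$: $\partial_x y\cdot\bar u$ is $y$ if $y\ne x$ and $n=0$, is $u_1$ if $y=x$ and $n=1$, and is $0$ otherwise; $\partial_x(\lambda y.s)\cdot\bar u=\lambda y.(\partial_x s\cdot\bar u)$ ($y$ fresh); $\partial_x(s\oplus\bullet)\cdot\bar u=(\partial_xs\cdot\bar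 u)\oplus\bullet$; $\partial_x(\bullet\oplus s)\cdot\bar u=\bullet\oplus(\partial_xs\cdot\bar u)$; $\partial_x(\langle s\rangle\bar t)\cdot\bar u=\sum_{(I_1,I_2)}\langle\partial_xs\cdot\bar u_{I_1}\rangle(\partial_x\bar t\cdot\bar u_{I_2})$; $\partial_x[t_1,\dots,t_k]\cdot\bar u=\sum_{(I_1,\dots,I_k)}[\partial_xt_1\cdot\bar u_{I_1},\dots,\partial_xt_k\cdot\bar u_{I_k}]$, the sums ranging over tuples of pairwise disjoint, possibly empty subsets of $\{1,\dots,n\}$ with union $\{1,\dots,n\}$, and $\bar u_I=[u_i\mid i\in I]$. The reduction $\to_\partial$ from resource expressions to finite sums is generated by the rules $\langle\lambda x.s\rangle\bar t\to_\partial\partial_xs\cdot\bar t$, $\langle s\oplus\bullet\rangle\bar t\to_\partial(\langle s\rangle\bar t)\oplus\bullet$, $\langle\bullet\oplus s\rangle\bar t\to_\partial\bullet\oplus\langle s\rangle\bar t$, $\lambda x.(s\oplus\bullet)\to_\partial(\lambda x.s)\oplus\bullet$, $\lambda x.(\bullet\oplus s)\to_\partial\bullet\oplus\lambda x.s$, closed under all syntactic contexts (constructors applied linearly to the reduct), and extended to finite sums by $e+F\to_\partial E'+F$ whenever $e\to_\partial E'$. It is confluent and strongly normalizing; $\mathrm{NF}(E)$ denotes the normal form of $E$. For a set $X$, $\mathbb V(X)$ is the set of functions $X\to\mathbb Q_{\ge0}$, written as possibly infinite linear combinations $A=\sum_{a\in X}A_a\,a$, with $\mathrm{supp}(A)=\{a\mid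 A_a\ne0\}$. Constructors are extended componentwise: $\lambda x.S=\sum_sS_s\,\lambda x.s$, $S\oplus\bullet=\sum_sS_s(s\oplus\bullet)$, $\bullet\oplus S=\sum_sS_s(\bullet\oplus s)$, $\langle S\rangle\bar T=\sum_{s,\bar t}S_s\bar T_{\bar t}\,\langle s\rangle\bar t$, $[S_1,\dots,S_n]=\sum_{(s_1,\dots,s_n)}(\prod_i(S_i)_{s_i})[s_1,\dots,s_n]$. Let $S^n=[S,\dots,S]$ ($n$ copies; $S^0=[]$) and $S^!=\sum_{n\ge0}\frac1{n!}S^n$. The Taylor expansion of approximants is $T(\bot)=0$, $T(x)=x$, $T(\lambda x.N)=\lambda x.T(N)$, $T(PQ)=\langle T(P)\rangle(T(Q))^!$, $T(P\oplus Q)=(T(P)\oplus\bullet)+(\bullet\oplus T(Q))$; $\mathcal T(M)=\mathrm{supp}(T(M))$. The multiplicity $m$ is defined by $m(x)=1$; $m(\lambda x.s)=m(s\oplus\bullet)=m(\bullet\oplus s)=m(s)$; $m(\langle s\rangle\bar t)=m(s)m(\bar t)$; $m([t_1]^{n_1}\cdot\ldots\cdot[t_k]^{n_k})=\prod_{i=1}^k n_i!\,m(t_i)^{n_i}$ for pairwise distinct $t_i$, where $[t]^n$ is the multiset containing $n$ copies of $t$. $\mathcal T(\mathrm{BT}(M))=\bigcup_{B\in\mathrm{BT}(M)}\mathcal T(B)$ and $T(\mathrm{BT}(M))=\sum_{s\in\mathcal T(\mathrm{BT}(M))}\frac1{m(s)}s$. Finally $\mathrm{NF}(T(M))$ is the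 combination whose coefficient on each resource term $u$ is $\sum_{s}T(M)_s\,\mathrm{NF}(s)_u$. -}

module Defs where

open import Data.Nat as ℕ using (ℕ; zero; suc; _≡ᵇ_; _<ᵇ_; _!)
open import Data.Bool using (Bool; true; false; if_then_else_; not; _∧_)
open import Data.List using (List; []; _∷_; _++_; map; concatMap; filterᵇ; length; foldr)
open import Data.List.Relation.Unary.All using (All)
open import Data.List.Relation.Unary.AllPairs using (AllPairs)
open import Data.Product using (_×_; _,_; ∃)
open import Data.Integer using (+_)
open import Data.Rational using (ℚ; 0ℚ; 1ℚ; _+_; _*_; _-_; _≤_; _<_; _/_)
open import Relation.Binary.PropositionalEquality using (_≡_)
open import Relation.Binary.Construct.Closure.ReflexiveTransitive using (Star)
open import Relation.Nullary using (¬_)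

infixl 6 _⊕_
data Term : Set where
  var : ℕ → Term
  lam : Term → Term
  app : Term → Term → Term
  _⊕_ : Term → Term → Term

shift : ℕ → Term → Term
shift c (var i) = if i <ᵇ c then var i else var (suc i)
shift c (lam M) = lam (shift (suc c) M)
shift c (app M N) = app (shift c M) (shift c N)
shift c (M ⊕ N) = shift c M ⊕ shift c N

subst : ℕ → Term → Term → Term
subst j N (var i) = if i ≡ᵇ j then N else (if i <ᵇ j then var i else var (ℕ.pred i))
subst j N (lam M) = lam (subst (suc j) (shift 0 N) M)
subst j N (app M P) = app (subst j N M) (subst j N P)
subst j N (M ⊕ P) = subst j N M ⊕ subst j N P

_[_/0] : Term → Term → Term
M [ N /0] = subst 0 N M

isVarHead : Term → Bool
isVarHead (var _) = true
isVarHead (app P _) = isVarHead P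
isVarHead (lam _) = false
isVarHead (_ ⊕ _) = false

mutual
  L : Term → Term
  L (M ⊕ N) = L M ⊕ L N
  L (lam (M ⊕ N)) = lam M ⊕ lam N
  L (lam (var i)) = lam (L (var i))
  L (lam (lam M)) = lam (L (lam M))
  L (lam (app M N)) = lam (L (app M N))
  L (var i) = var i
  L (app P Q) = Lapp P Q

  Lapp : Term → Term → Term
  Lapp (var i) Q = app (var i) (L Q)
  Lapp (lam M) Q = M [ Q /0]
  Lapp (M ⊕ N) Q = app M Q ⊕ app N Q
  Lapp (app P P') Q = if isVarHead P then app (Lapp P P') (L Q) else app (Lapp P P') Q

Lⁿ : ℕ → Term → Term
Lⁿ zero M = M
Lⁿ (suc n) M = L (Lⁿ n M)

data Approx : Set where
  ⊥ₐ : Approx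
  var : ℕ → Approx
  lam : Approx → Approx
  app : Approx → Approx → Approx
  _⊕_ : Approx → Approx → Approx

emb : Term → Approx
emb (var i) = var i
emb (lam M) = lam (emb M)
emb (app M N) = app (emb M) (emb N)
emb (M ⊕ N) = emb M ⊕ emb N

infix 4 _≤ₐ_
data _≤ₐ_ : Approx → Approx → Set where
  ≤-refl  : ∀ {M} → M ≤ₐ M
  ≤-trans : ∀ {M N P} → M ≤ₐ N → N ≤ₐ P → M ≤ₐ P
  ⊥≤      : ∀ {M} → ⊥ₐ ≤ₐ M
  lam≤    : ∀ {M M'} → M ≤ₐ M' → lam M ≤ₐ lam M'
  app≤    : ∀ {M M' N N'} → M ≤ₐ M' → N ≤ₐ N' → app M N ≤ₐ app M' N'
  ⊕≤      : ∀ {M M' N N'} → M ≤ₐ M' → N ≤ₐ N' → (M ⊕ N) ≤ₐ (M' ⊕ N')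

lams : ℕ → Approx → Approx
lams zero M = M
lams (suc k) M = lam (lams k M)

apps : Approx → List Approx → Approx
apps M [] = M
apps M (N ∷ Ns) = apps (app M N) Ns

data 𝒩 : Approx → Set where
  ⊥∈𝒩   : 𝒩 ⊥ₐ
  head∈𝒩 : (k x : ℕ) (Ns : List Approx) → All 𝒩 Ns → 𝒩 (lams k (apps (var x) Ns))
  ⊕∈𝒩   : ∀ {N₁ N₂} → 𝒩 N₁ → 𝒩 N₂ → 𝒩 (N₁ ⊕ N₂)

isHeadNF : Term → Bool
isHeadNF (lam M) = isHeadNF M
isHeadNF (var _) = true
isHeadNF (app P _) = isVarHead P
isHeadNF (_ ⊕ _) = false

eBT : Term → Approx
eBT (M ⊕ N) = eBT M ⊕ eBT N
eBT (var i) = var i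
eBT (lam M) = if isHeadNF M then lam (eBT M) else ⊥ₐ
eBT (app P Q) = if isVarHead P then app (eBT P) (eBT Q) else ⊥ₐ

_∈BT_ : Approx → Term → Set
N ∈BT M = 𝒩 N × ∃ λ n → N ≤ₐ eBT (Lⁿ n M)

-- Resource terms (de Bruijn); a monomial is a list taken up to
-- permutation, see _≈_ below.

data RTerm : Set where
  rvar : ℕ → RTerm
  rlam : RTerm → RTerm
  rapp : RTerm → List RTerm → RTerm
  _⊕• : RTerm → RTerm
  •⊕_ : RTerm → RTerm

-- structural lexicographic total order, used to canonicalise monomials
data Cmp : Set where
  LT EQ GT : Cmp

cmpℕ : ℕ → ℕ → Cmp
cmpℕ m n = if m <ᵇ n then LT else (if m ≡ᵇ n then EQ else GT)

tag : RTerm → ℕ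
tag (rvar _) = 0
tag (rlam _) = 1
tag (rapp _ _) = 2
tag (_ ⊕•) = 3
tag (•⊕ _) = 4

mutual
  cmp : RTerm → RTerm → Cmp
  cmp (rvar i) (rvar j) = cmpℕ i j
  cmp (rlam s) (rlam t) = cmp s t
  cmp (rapp s ss) (rapp t ts) with cmp s t
  ... | EQ = cmpL ss ts
  ... | c  = c
  cmp (s ⊕•) (t ⊕•) = cmp s t
  cmp (•⊕ s) (•⊕ t) = cmp s t
  cmp s t = cmpℕ (tag s) (tag t)

  cmpL : List RTerm → List RTerm → Cmp
  cmpL [] [] = EQ
  cmpL [] (_ ∷ _) = LT
  cmpL (_ ∷ _) [] = GT
  cmpL (s ∷ ss) (t ∷ ts) with cmp s t
  ... | EQ = cmpL ss ts
  ... | c  = c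

insert : RTerm → List RTerm → List RTerm
insert s [] = s ∷ []
insert s (t ∷ ts) with cmp s t
... | GT = t ∷ insert s ts
... | _  = s ∷ t ∷ ts

sort : List RTerm → List RTerm
sort = foldr insert []

mutual
  canon : RTerm → RTerm
  canon (rvar i) = rvar i
  canon (rlam s) = rlam (canon s)
  canon (rapp s ts) = rapp (canon s) (sort (canonL ts))
  canon (s ⊕•) = canon s ⊕•
  canon (•⊕ s) = •⊕ canon s

  canonL : List RTerm → List RTerm
  canonL [] = []
  canonL (t ∷ ts) = canon t ∷ canonL ts

-- equality of resource terms (α-equivalence is built in; monomials are
-- compared as multisets)
_==_ : RTerm → RTerm → Bool
s == t with cmp (canon s) (canon t)
... | EQ = true
... | _  = false

_≈_ : RTerm → RTerm → Set
s ≈ t = (s == t) ≡ true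

-- number of occurrences of u (up to ≈) in a list = coefficient in a finite sum
count : RTerm → List RTerm → ℕ
count u ts = length (filterᵇ (λ t → u == t) ts)

dedup : List RTerm → List RTerm
dedup [] = []
dedup (t ∷ ts) = t ∷ filterᵇ (λ t' → not (t == t')) (dedup ts)

removeOne : RTerm → List RTerm → List RTerm
removeOne u [] = []
removeOne u (t ∷ ts) = if u == t then ts else t ∷ removeOne u ts

mutual
  rshift : ℕ → RTerm → RTerm
  rshift c (rvar i) = if i <ᵇ c then rvar i else rvar (suc i)
  rshift c (rlam s) = rlam (rshift (suc c) s)
  rshift c (rapp s ts) = rapp (rshift c s) (rshiftL c ts)
  rshift c (s ⊕•) = rshift c s ⊕•
  rshift c (•⊕ s) = •⊕ rshift c s

  rshiftL : ℕ → List RTerm → List RTerm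
  rshiftL c [] = []
  rshiftL c (t ∷ ts) = rshift c t ∷ rshiftL c ts

splits2 : List RTerm → List (List RTerm × List RTerm)
splits2 [] = ([] , []) ∷ []
splits2 (x ∷ xs) = concatMap (λ { (l , r) → (x ∷ l , r) ∷ (l , x ∷ r) ∷ [] }) (splits2 xs)

-- ∂ⱼ e · ū as a finite sum (list) of resource terms; variable j is
-- substituted, variables above j are lowered (de Bruijn β-substitution)
mutual
  ∂ : ℕ → RTerm → List RTerm → List RTerm
  ∂ j (rvar i) us with i ≡ᵇ j | us
  ... | true  | u ∷ [] = u ∷ []
  ... | true  | _      = []
  ... | false | []     = (if i <ᵇ j then rvar i else rvar (ℕ.pred i)) ∷ []
  ... | false | _ ∷ _  = []
  ∂ j (rlam s) us = map rlam (∂ (suc j) s (rshiftL 0 us))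
  ∂ j (s ⊕•) us = map _⊕• (∂ j s us)
  ∂ j (•⊕ s) us = map •⊕_ (∂ j s us)
  ∂ j (rapp s ts) us =
    concatMap (λ { (u₁ , u₂) →
      concatMap (λ s' → map (λ ts' → rapp s' ts') (∂L j ts u₂)) (∂ j s u₁) })
      (splits2 us)

  ∂L : ℕ → List RTerm → List RTerm → List (List RTerm)
  ∂L j [] [] = [] ∷ []
  ∂L j [] (_ ∷ _) = []
  ∂L j (t ∷ ts) us =
    concatMap (λ { (u₁ , u₂) →
      concatMap (λ t' → map (λ ts' → t' ∷ ts') (∂L j ts u₂)) (∂ j t u₁) })
      (splits2 us)

infix 4 _→∂_ _⟶∂_
data _→∂_ : RTerm → List RTerm → Set where
  β     : ∀ s ts → rapp (rlam s) ts →∂ ∂ 0 s ts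
  app⊕• : ∀ s ts → rapp (s ⊕•) ts →∂ (rapp s ts ⊕•) ∷ []
  app•⊕ : ∀ s ts → rapp (•⊕ s) ts →∂ (•⊕ rapp s ts) ∷ []
  lam⊕• : ∀ s → rlam (s ⊕•) →∂ (rlam s ⊕•) ∷ []
  lam•⊕ : ∀ s → rlam (•⊕ s) →∂ (•⊕ rlam s) ∷ []
  ctx-lam : ∀ {s E} → s →∂ E → rlam s →∂ map rlam E
  ctx-⊕•  : ∀ {s E} → s →∂ E → (s ⊕•) →∂ map _⊕• E
  ctx-•⊕  : ∀ {s E} → s →∂ E → (•⊕ s) →∂ map •⊕_ E
  ctx-fun : ∀ {s E} ts → s →∂ E → rapp s ts →∂ map (λ s' → rapp s' ts) E
  ctx-arg : ∀ {t E} s ts₁ ts₂ → t →∂ E →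
            rapp s (ts₁ ++ t ∷ ts₂) →∂ map (λ t' → rapp s (ts₁ ++ t' ∷ ts₂)) E

-- reduction of finite sums (lists, coefficient = multiplicity)
data _⟶∂_ : List RTerm → List RTerm → Set where
  step : ∀ {s E} F₁ F₂ → s →∂ E → (F₁ ++ s ∷ F₂) ⟶∂ (F₁ ++ E ++ F₂)

Normal : List RTerm → Set
Normal E = ∀ E' → ¬ (E ⟶∂ E')

IsNF : (RTerm → List RTerm) → Set
IsNF nf = ∀ s → Star _⟶∂_ (s ∷ []) (nf s) × Normal (nf s)

inv : ℕ → ℚ
inv zero = 0ℚ
inv (suc k) = + 1 / suc k

fromℕ : ℕ → ℚ
fromℕ n = + n / 1

sumℚ : List ℚ → ℚ
sumℚ = foldr _+_ 0ℚ

-- coefficient of the multiset ts in [S,…,S] (n copies):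
-- sum over tuples (s₁,…,sₙ) with [s₁,…,sₙ] = ts of ∏ S_{sᵢ}
powCoef : ℕ → (RTerm → ℚ) → List RTerm → ℚ
powCoef zero S [] = 1ℚ
powCoef zero S (_ ∷ _) = 0ℚ
powCoef (suc n) S ts = sumℚ (map (λ u → S u * powCoef n S (removeOne u ts)) (dedup ts))

-- coefficient of the multiset ts in S^! = Σₙ (1/n!) Sⁿ
bangCoef : (RTerm → ℚ) → List RTerm → ℚ
bangCoef S ts = inv (length ts !) * powCoef (length ts) S ts

T : Approx → RTerm → ℚ
T ⊥ₐ s = 0ℚ
T (var i) (rvar j) = if i ≡ᵇ j then 1ℚ else 0ℚ
T (var i) _ = 0ℚ
T (lam N) (rlam s) = T N s
T (lam N) _ = 0ℚ
T (app P Q) (rapp s ts) = T P s * bangCoef (T Q) ts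
T (app P Q) _ = 0ℚ
T (P ⊕ Q) (s ⊕•) = T P s
T (P ⊕ Q) (•⊕ s) = T Q s
T (P ⊕ Q) _ = 0ℚ

-- multiplicity; for a monomial, m([t₁]^{n₁}⋯[tₖ]^{nₖ}) = ∏ nᵢ! m(tᵢ)^{nᵢ}
-- is computed as (∏ over all elements m(t)) · (∏ over distinct tᵢ of nᵢ!)
mutual
  mult : RTerm → ℕ
  mult (rvar _) = 1
  mult (rlam s) = mult s
  mult (s ⊕•) = mult s
  mult (•⊕ s) = mult s
  mult (rapp s ts) = mult s ℕ.* multL ts ℕ.* foldr ℕ._*_ 1 (map (λ t → count t ts !) (dedup ts))

  multL : List RTerm → ℕ
  multL [] = 1
  multL (t ∷ ts) = mult t ℕ.* multL ts

_∈𝒯BT_ : RTerm → Term → Set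
u ∈𝒯BT M = ∃ λ B → B ∈BT M × ¬ (T B u ≡ 0ℚ)

Distinct : List RTerm → Set
Distinct = AllPairs (λ a b → (a == b) ≡ false)

-- Σ_{s ∈ resource terms / ≈} f(s) = q   (f ≥ 0: q is the supremum of finite partial sums)
HasSum : (RTerm → ℚ) → ℚ → Set
HasSum f q =
  (∀ l → Distinct l → sumℚ (map f l) ≤ q) ×
  (∀ ε → 0ℚ < ε → ∃ λ l → Distinct l × (q - ε) < sumℚ (map f l))

NFfamily : (RTerm → List RTerm) → Term → RTerm → RTerm → ℚ
NFfamily nf M u s = T (emb M) s * fromℕ (count u (nf s))

{-# OPTIONS --safe #-}
-- Monomials are lists here. Let matches s t be the number of permutations of the monomials of s that turn s into t: it
-- is m(t) if s and t are equal as resource terms and 0 otherwise, whereas T(M) has the coefficient 1/m(s) on every s in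
-- 𝒯(M). Hence it suffices to find, for u in 𝒯(BT(M)), one s₀ in 𝒯(M) such that the sum of matches e u over e in NF(s)
-- is matches s s₀ for all s in 𝒯(M): only the class of s₀ contributes, and it contributes 1/m(s₀) · m(s₀)/m(u). For one
-- step of hereditary head reduction this identity is an expansion of permanents, since a list term of 𝒯(M[N/x]) comes
-- from exactly one list term of 𝒯((λx.M)N) when the substituted terms are listed in reading order; it then iterates,
-- because u is not affected by further steps. The normal form may be reached by any other reduction, so confluence is
-- needed as well, in additive form: for every functional ψ, the sum of ψ over NF(s) is preserved by reduction. This is
-- Newman's lemma, local confluence being the commutation of ∂ with itself and with reduction.
module Submission where

open import Defs
open import Data.Bool using (Bool; true; false; if_then_else_; not)
open import Data.List using (List; []; _∷_; _++_; map; concatMap; length; foldr; filterᵇ)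
import Data.List.Properties as List
open import Data.List.Relation.Unary.All as All using (All; []; _∷_)
import Data.List.Relation.Unary.All.Properties as All
open import Data.List.Relation.Unary.AllPairs using ([]; _∷_)
open import Data.Nat using (ℕ; zero; suc; _≤_; _<_; z≤n; s≤s; _≡ᵇ_; _<ᵇ_; _+_; _*_; _^_; _⊔_; _!)
open import Data.Nat.Induction using (<-wellFounded)
open import Data.Nat.Properties as ℕ using ()
open import Data.Product using (_×_; _,_; ∃; proj₁; proj₂)
open import Data.Product.Relation.Binary.Lex.Strict using (×-Lex; ×-wellFounded)
open import Data.Integer as ℤ using () renaming (+_ to pos)
import Data.Integer.Properties as ℤ
open import Data.Rational using (ℚ; 0ℚ; 1ℚ; fromℚᵘ) renaming (_+_ to _+ℚ_; _*_ to _*ℚ_; _-_ to _-ℚ_; _≤_ to _≤ℚ_; _<_ to _<ℚ_)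
import Data.Rational.Properties as ℚ
open import Data.Rational.Unnormalised as ℚᵘ using (ℚᵘ; mkℚᵘ; *≡*)
import Data.Rational.Unnormalised.Properties as ℚᵘ
open import Data.Sum using (_⊎_; inj₁; inj₂)
open import Function using (_∘_; id)
open import Induction.WellFounded using (WellFounded; Acc; acc)
open import Relation.Binary.Construct.Closure.ReflexiveTransitive using (Star; ε; _◅_)
import Relation.Binary.Construct.On as On
open import Relation.Binary.PropositionalEquality as ≡
  using (_≡_; _≢_; refl; sym; trans; cong; cong₂; module ≡-Reasoning)
open import Relation.Nullary using (¬_; Dec; yes; no; contradiction)
open import Relation.Binary.Definitions using (tri<; tri≈; tri>)
open import Relation.Nullary.Decidable using (decidable-stable)
open ≡-Reasoning

-- Finite sums are lists, and two reductions may list the same summands in different orders. Reducts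
-- are therefore compared only through `∑ E ψ`; since `∂` keeps the positions inside a monomial, ψ
-- may be any function of list terms, and permutations of monomials enter only through `matches`.
--
-- The plain count of `u` in NF(s) does not decompose along the syntax: with repeated elements in a
-- monomial, one multiset arises from several choices. Weighted by m(u), the count turns into
-- `matches`, a product of permanents, and these do split along applications and along divisions of
-- a list of arguments. All of this happens in ℕ; the weights meet the rational coefficients 1/m(s)
-- only at the very end.
--
-- Two numbers of steps have to be reconciled: `u` appears after some n that depends on `u` alone,
-- whereas a term s becomes normal after some m that depends on s. No single number of steps serves
-- all s, which is why the count of `u` must be shown to be stable after step n.

private variable
  A B C D : Set

-- Finite sums

infix 5 ∑
∑ : List A → (A → ℕ) → ℕ
∑ [] f = 0
∑ (x ∷ xs) f = f x + ∑ xs f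

syntax ∑ xs (λ x → e) = ∑[ x ← xs ] e

∑-cong : ∀ (xs : List A) {f g : A → ℕ} → (∀ x → f x ≡ g x) → ∑ xs f ≡ ∑ xs g
∑-cong [] eq = refl
∑-cong (x ∷ xs) eq = cong₂ _+_ (eq x) (∑-cong xs eq)

∑-congᴬ : ∀ {P : A → Set} {xs} {f g : A → ℕ} → All P xs → (∀ x → P x → f x ≡ g x) → ∑ xs f ≡ ∑ xs g
∑-congᴬ [] eq = refl
∑-congᴬ (p ∷ ps) eq = cong₂ _+_ (eq _ p) (∑-congᴬ ps eq)

∑-zero : ∀ (xs : List A) → ∑[ _ ← xs ] 0 ≡ 0
∑-zero [] = refl
∑-zero (x ∷ xs) = ∑-zero xs

+-interchange : ∀ a b c d → (a + b) + (c + d) ≡ (a + c) + (b + d)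
+-interchange a b c d = begin
  (a + b) + (c + d) ≡⟨ ℕ.+-assoc a b _ ⟩
  a + (b + (c + d)) ≡⟨ cong (a +_) (trans (sym (ℕ.+-assoc b c d)) (trans (cong (_+ d) (ℕ.+-comm b c)) (ℕ.+-assoc c b d))) ⟩
  a + (c + (b + d)) ≡⟨ sym (ℕ.+-assoc a c _) ⟩
  (a + c) + (b + d) ∎

*-interchange : ∀ a b c d → (a * b) * (c * d) ≡ (a * c) * (b * d)
*-interchange a b c d = begin
  (a * b) * (c * d) ≡⟨ ℕ.*-assoc a b _ ⟩
  a * (b * (c * d)) ≡⟨ cong (a *_) (trans (sym (ℕ.*-assoc b c d)) (trans (cong (_* d) (ℕ.*-comm b c)) (ℕ.*-assoc c b d))) ⟩
  a * (c * (b * d)) ≡⟨ sym (ℕ.*-assoc a c _) ⟩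
  (a * c) * (b * d) ∎

∑-+ : ∀ (xs : List A) (f g : A → ℕ) → ∑[ x ← xs ] (f x + g x) ≡ ∑ xs f + ∑ xs g
∑-+ [] f g = refl
∑-+ (x ∷ xs) f g = trans (cong (_ +_) (∑-+ xs f g)) (+-interchange (f x) (g x) _ _)

∑-*ˡ : ∀ (xs : List A) c (f : A → ℕ) → ∑[ x ← xs ] (c * f x) ≡ c * ∑ xs f
∑-*ˡ [] c f = sym (ℕ.*-zeroʳ c)
∑-*ˡ (x ∷ xs) c f = trans (cong (_ +_) (∑-*ˡ xs c f)) (sym (ℕ.*-distribˡ-+ c (f x) _))

∑-*ʳ : ∀ (xs : List A) (f : A → ℕ) c → ∑[ x ← xs ] (f x * c) ≡ ∑ xs f * c
∑-*ʳ [] f c = refl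
∑-*ʳ (x ∷ xs) f c = trans (cong (_ +_) (∑-*ʳ xs f c)) (sym (ℕ.*-distribʳ-+ c (f x) _))

∑-product : ∀ (xs : List A) (ys : List B) (f : A → ℕ) (g : B → ℕ) →
            ∑[ x ← xs ] ∑[ y ← ys ] (f x * g y) ≡ ∑ xs f * ∑ ys g
∑-product xs ys f g = trans (∑-cong xs λ x → ∑-*ˡ ys (f x) g) (∑-*ʳ xs f (∑ ys g))

∑-swap : ∀ (xs : List A) (ys : List B) (f : A → B → ℕ) →
         ∑[ x ← xs ] ∑[ y ← ys ] f x y ≡ ∑[ y ← ys ] ∑[ x ← xs ] f x y
∑-swap [] ys f = sym (∑-zero ys)
∑-swap (x ∷ xs) ys f = trans (cong (_ +_) (∑-swap xs ys f)) (sym (∑-+ ys (f x) _))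

∑-++ : ∀ (xs ys : List A) (f : A → ℕ) → ∑ (xs ++ ys) f ≡ ∑ xs f + ∑ ys f
∑-++ [] ys f = refl
∑-++ (x ∷ xs) ys f = trans (cong (f x +_) (∑-++ xs ys f)) (sym (ℕ.+-assoc (f x) _ _))

∑-map : ∀ (h : A → B) xs (f : B → ℕ) → ∑ (map h xs) f ≡ ∑ xs (f ∘ h)
∑-map h [] f = refl
∑-map h (x ∷ xs) f = cong (_ +_) (∑-map h xs f)

∑-concatMap : ∀ (h : A → List B) xs (f : B → ℕ) → ∑ (concatMap h xs) f ≡ ∑[ x ← xs ] ∑ (h x) f
∑-concatMap h [] f = refl
∑-concatMap h (x ∷ xs) f = trans (∑-++ (h x) _ f) (cong (_ +_) (∑-concatMap h xs f))

∑-singleton : ∀ (x : A) (f : A → ℕ) → ∑ (x ∷ []) f ≡ f x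
∑-singleton x f = ℕ.+-identityʳ (f x)

Split : Set
Split = List RTerm × List RTerm

∑-splits2-∷ : ∀ x xs (F : Split → ℕ) →
  ∑ (splits2 (x ∷ xs)) F ≡ ∑ (splits2 xs) λ (l , r) → F (x ∷ l , r) + F (l , x ∷ r)
∑-splits2-∷ x xs F = trans (∑-concatMap _ (splits2 xs) F)
  (∑-cong (splits2 xs) λ (l , r) → cong (F (x ∷ l , r) +_) (∑-singleton (l , x ∷ r) F))

All-splits2-∷⁻ : ∀ {P : Split → Set} x xs → All P (splits2 (x ∷ xs)) →
  All (λ (l , r) → P (x ∷ l , r) × P (l , x ∷ r)) (splits2 xs)
All-splits2-∷⁻ {P} x xs ps = go (splits2 xs) ps
  where
  go : ∀ ys → All P (concatMap (λ { (l , r) → (x ∷ l , r) ∷ (l , x ∷ r) ∷ [] }) ys) →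
       All (λ (l , r) → P (x ∷ l , r) × P (l , x ∷ r)) ys
  go [] [] = []
  go (y ∷ ys) (p ∷ q ∷ ps) = (p , q) ∷ go ys ps

All-splits2-∷⁺ : ∀ {P : Split → Set} x xs →
  All (λ (l , r) → P (x ∷ l , r) × P (l , x ∷ r)) (splits2 xs) → All P (splits2 (x ∷ xs))
All-splits2-∷⁺ {P} x xs ps = go (splits2 xs) ps
  where
  go : ∀ ys → All (λ (l , r) → P (x ∷ l , r) × P (l , x ∷ r)) ys →
       All P (concatMap (λ { (l , r) → (x ∷ l , r) ∷ (l , x ∷ r) ∷ [] }) ys)
  go [] [] = []
  go (y ∷ ys) ((p , q) ∷ ps) = p ∷ q ∷ go ys ps

∑-splits2-emptyˡ : ∀ us (F : Split → ℕ) → (∀ u l r → F (u ∷ l , r) ≡ 0) → ∑ (splits2 us) F ≡ F ([] , us)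
∑-splits2-emptyˡ [] F z = ∑-singleton ([] , []) F
∑-splits2-emptyˡ (u ∷ us) F z = trans (∑-splits2-∷ u us F)
  (trans (∑-cong (splits2 us) λ (l , r) → cong (_+ F (l , u ∷ r)) (z u l r))
         (∑-splits2-emptyˡ us (λ (l , r) → F (l , u ∷ r)) (λ v l r → z v l (u ∷ r))))

∑-splits2-comm : ∀ us (F : Split → ℕ) → ∑ (splits2 us) F ≡ ∑ (splits2 us) λ (l , r) → F (r , l)
∑-splits2-comm [] F = refl
∑-splits2-comm (u ∷ us) F = begin
  ∑ (splits2 (u ∷ us)) F
    ≡⟨ ∑-splits2-∷ u us F ⟩
  (∑ (splits2 us) λ (l , r) → F (u ∷ l , r) + F (l , u ∷ r))
    ≡⟨ ∑-splits2-comm us (λ (l , r) → F (u ∷ l , r) + F (l , u ∷ r)) ⟩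
  (∑ (splits2 us) λ (l , r) → F (u ∷ r , l) + F (r , u ∷ l))
    ≡⟨ ∑-cong (splits2 us) (λ (l , r) → ℕ.+-comm (F (u ∷ r , l)) _) ⟩
  (∑ (splits2 us) λ (l , r) → F (r , u ∷ l) + F (u ∷ r , l))
    ≡⟨ sym (∑-splits2-∷ u us (λ (l , r) → F (r , l))) ⟩
  (∑ (splits2 (u ∷ us)) λ (l , r) → F (r , l)) ∎

∑-splits2-emptyʳ : ∀ us (F : Split → ℕ) → (∀ u l r → F (l , u ∷ r) ≡ 0) → ∑ (splits2 us) F ≡ F (us , [])
∑-splits2-emptyʳ us F z = trans (∑-splits2-comm us F)
  (∑-splits2-emptyˡ us (λ (l , r) → F (r , l)) (λ u l r → z u r l))

-- Distributing us over a 2×2 grid row by row or column by column.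
∑-splits2-interchange : ∀ us (H : List RTerm → List RTerm → List RTerm → List RTerm → ℕ) →
  (∑ (splits2 us) λ (a , b) → ∑ (splits2 a) λ (a₁ , a₂) → ∑ (splits2 b) λ (b₁ , b₂) → H a₁ a₂ b₁ b₂) ≡
  (∑ (splits2 us) λ (c , d) → ∑ (splits2 c) λ (a₁ , b₁) → ∑ (splits2 d) λ (a₂ , b₂) → H a₁ a₂ b₁ b₂)
∑-splits2-interchange [] H = refl
∑-splits2-interchange (u ∷ us) H = begin
  (∑ (splits2 (u ∷ us)) λ (a , b) → ∑ (splits2 a) λ (a₁ , a₂) → ∑ (splits2 b) λ (b₁ , b₂) → H a₁ a₂ b₁ b₂)
    ≡⟨ expand us H ⟩
  (R H₁ + R H₂) + (R H₃ + R H₄)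
    ≡⟨ cong₂ _+_ (cong₂ _+_ (∑-splits2-interchange us H₁) (∑-splits2-interchange us H₂))
                  (cong₂ _+_ (∑-splits2-interchange us H₃) (∑-splits2-interchange us H₄)) ⟩
  (S H₁ + S H₂) + (S H₃ + S H₄)
    ≡⟨ +-interchange (S H₁) (S H₂) (S H₃) (S H₄) ⟩
  (S H₁ + S H₃) + (S H₂ + S H₄)
    -- The column-wise sum is the row-wise sum of `H` with its two middle arguments exchanged, so
    -- the same expansion serves both sides, with the cells `H₂` and `H₃` trading places.
    ≡⟨ sym (expand us (λ a₁ b₁ a₂ b₂ → H a₁ a₂ b₁ b₂)) ⟩
  _ ∎
  where
  Quad = List RTerm → List RTerm → List RTerm → List RTerm → ℕ
  R S : Quad → ℕ
  R H = ∑ (splits2 us) λ (a , b) → ∑ (splits2 a) λ (a₁ , a₂) → ∑ (splits2 b) λ (b₁ , b₂) → H a₁ a₂ b₁ b₂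
  S H = ∑ (splits2 us) λ (c , d) → ∑ (splits2 c) λ (a₁ , b₁) → ∑ (splits2 d) λ (a₂ , b₂) → H a₁ a₂ b₁ b₂
  H₁ H₂ H₃ H₄ : Quad
  H₁ a₁ a₂ b₁ b₂ = H (u ∷ a₁) a₂ b₁ b₂
  H₂ a₁ a₂ b₁ b₂ = H a₁ (u ∷ a₂) b₁ b₂
  H₃ a₁ a₂ b₁ b₂ = H a₁ a₂ (u ∷ b₁) b₂
  H₄ a₁ a₂ b₁ b₂ = H a₁ a₂ b₁ (u ∷ b₂)
  expand : ∀ us (H : Quad) →
    (∑ (splits2 (u ∷ us)) λ (a , b) → ∑ (splits2 a) λ (a₁ , a₂) → ∑ (splits2 b) λ (b₁ , b₂) → H a₁ a₂ b₁ b₂) ≡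
    ((∑ (splits2 us) λ (a , b) → ∑ (splits2 a) λ (a₁ , a₂) → ∑ (splits2 b) λ (b₁ , b₂) → H (u ∷ a₁) a₂ b₁ b₂) +
     (∑ (splits2 us) λ (a , b) → ∑ (splits2 a) λ (a₁ , a₂) → ∑ (splits2 b) λ (b₁ , b₂) → H a₁ (u ∷ a₂) b₁ b₂)) +
    ((∑ (splits2 us) λ (a , b) → ∑ (splits2 a) λ (a₁ , a₂) → ∑ (splits2 b) λ (b₁ , b₂) → H a₁ a₂ (u ∷ b₁) b₂) +
     (∑ (splits2 us) λ (a , b) → ∑ (splits2 a) λ (a₁ , a₂) → ∑ (splits2 b) λ (b₁ , b₂) → H a₁ a₂ b₁ (u ∷ b₂)))
  expand us H = trans (∑-splits2-∷ u us _) (trans (∑-+ (splits2 us) _ _) (cong₂ _+_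
    (trans (∑-cong (splits2 us) λ (a , b) → trans (∑-splits2-∷ u a _) (∑-+ (splits2 a) _ _)) (∑-+ (splits2 us) _ _))
    (trans (∑-cong (splits2 us) λ (a , b) → trans
             (∑-cong (splits2 a) λ (a₁ , a₂) → trans (∑-splits2-∷ u b _) (∑-+ (splits2 b) _ _))
             (∑-+ (splits2 a) _ _))
           (∑-+ (splits2 us) _ _))))

-- The common shape of ∂ on applications and of ∂L on non-empty monomials.
combine : (A → B → C) → (List RTerm → List A) → (List RTerm → List B) → List RTerm → List C
combine _∙_ f g us = concatMap (λ (a , b) → concatMap (λ x → map (x ∙_) (g b)) (f a)) (splits2 us)

∑-pairs : (_∙_ : A → B → C) (xs : List A) (ys : List B) (φ : C → ℕ) →
  ∑ (concatMap (λ x → map (x ∙_) ys) xs) φ ≡ ∑[ x ← xs ] ∑[ y ← ys ] φ (x ∙ y)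
∑-pairs _∙_ xs ys φ = trans (∑-concatMap _ xs φ) (∑-cong xs λ x → ∑-map (x ∙_) ys φ)

∑-combine : (_∙_ : A → B → C) (f : List RTerm → List A) (g : List RTerm → List B) (us : List RTerm) (φ : C → ℕ) →
  ∑ (combine _∙_ f g us) φ ≡ ∑ (splits2 us) λ (a , b) → ∑[ x ← f a ] ∑[ y ← g b ] φ (x ∙ y)
∑-combine _∙_ f g us φ = trans (∑-concatMap _ (splits2 us) φ)
  (∑-cong (splits2 us) λ (a , b) → ∑-pairs _∙_ (f a) (g b) φ)

∑-∂-rapp : ∀ j s ts us (φ : RTerm → ℕ) →
  ∑ (∂ j (rapp s ts) us) φ ≡
  ∑ (splits2 us) λ (a , b) → ∑[ s′ ← ∂ j s a ] ∑[ ts′ ← ∂L j ts b ] φ (rapp s′ ts′)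
∑-∂-rapp j s ts = ∑-combine rapp (∂ j s) (∂L j ts)

∑-∂L-∷ : ∀ j t ts us (φ : List RTerm → ℕ) →
  ∑ (∂L j (t ∷ ts) us) φ ≡
  ∑ (splits2 us) λ (a , b) → ∑[ t′ ← ∂ j t a ] ∑[ ts′ ← ∂L j ts b ] φ (t′ ∷ ts′)
∑-∂L-∷ j t ts = ∑-combine _∷_ (∂ j t) (∂L j ts)

All-concatMap⁺ : ∀ {P : B → Set} (h : A → List B) {xs} → All (λ x → All P (h x)) xs → All P (concatMap h xs)
All-concatMap⁺ h [] = []
All-concatMap⁺ h (p ∷ ps) = All.++⁺ p (All-concatMap⁺ h ps)

All-concatMap⁻ : ∀ {P : B → Set} (h : A → List B) xs → All P (concatMap h xs) → All (λ x → All P (h x)) xs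
All-concatMap⁻ h [] _ = []
All-concatMap⁻ h (x ∷ xs) ps = All.++⁻ˡ (h x) ps ∷ All-concatMap⁻ h xs (All.++⁻ʳ (h x) ps)

All-combine⁻ : ∀ {P : C → Set} (_∙_ : A → B → C) f g us → All P (combine _∙_ f g us) →
  All (λ (a , b) → All (λ x → All (λ y → P (x ∙ y)) (g b)) (f a)) (splits2 us)
All-combine⁻ _∙_ f g us ps = All.map
  (λ {(a , b)} qs → All.map All.map⁻ (All-concatMap⁻ (λ x → map (x ∙_) (g b)) (f a) qs))
  (All-concatMap⁻ (λ (a , b) → concatMap (λ x → map (x ∙_) (g b)) (f a)) (splits2 us) ps)

All-pairs⁺ : ∀ {P : A → Set} {Q : B → Set} {R : C → Set} (_∙_ : A → B → C) → (∀ {x y} → P x → Q y → R (x ∙ y)) →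
  ∀ {xs ys} → All P xs → All Q ys → All R (concatMap (λ x → map (x ∙_) ys) xs)
All-pairs⁺ _∙_ r ps qs = All-concatMap⁺ _ (All.map (λ p → All.map⁺ (All.map (r p) qs)) ps)

All-combine⁺ : ∀ {P : C → Set} (_∙_ : A → B → C) f g us →
  All (λ (a , b) → All (λ x → All (λ y → P (x ∙ y)) (g b)) (f a)) (splits2 us) → All P (combine _∙_ f g us)
All-combine⁺ _∙_ f g us ps = All-concatMap⁺ _ (All.map (λ qs → All-concatMap⁺ _ (All.map All.map⁺ qs)) ps)

-- Shifting

≡ᵇ-refl : ∀ n → (n ≡ᵇ n) ≡ true
≡ᵇ-refl zero = refl
≡ᵇ-refl (suc n) = ≡ᵇ-refl n

≢⇒≡ᵇ-false : ∀ {m n} → m ≢ n → (m ≡ᵇ n) ≡ false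
≢⇒≡ᵇ-false {zero} {zero} m≢n = contradiction refl m≢n
≢⇒≡ᵇ-false {zero} {suc n} m≢n = refl
≢⇒≡ᵇ-false {suc m} {zero} m≢n = refl
≢⇒≡ᵇ-false {suc m} {suc n} m≢n = ≢⇒≡ᵇ-false (m≢n ∘ cong suc)

<⇒<ᵇ-true : ∀ {m n} → m < n → (m <ᵇ n) ≡ true
<⇒<ᵇ-true {zero} (s≤s _) = refl
<⇒<ᵇ-true {suc m} (s≤s m<n) = <⇒<ᵇ-true m<n

≥⇒<ᵇ-false : ∀ {m n} → n ≤ m → (m <ᵇ n) ≡ false
≥⇒<ᵇ-false {n = zero} _ = refl
≥⇒<ᵇ-false {n = suc n} (s≤s n≤m) = ≥⇒<ᵇ-false n≤m

data VarView (j : ℕ) : ℕ → Set where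
  below : ∀ {i} → i < j → VarView j i
  equal : VarView j j
  above : ∀ {i} → j ≤ i → VarView j (suc i)

varView : ∀ j i → VarView j i
varView zero zero = equal
varView zero (suc i) = above z≤n
varView (suc j) zero = below (s≤s z≤n)
varView (suc j) (suc i) with varView j i
... | below i<j = below (s≤s i<j)
... | equal = equal
... | above j≤i = above (s≤s j≤i)

rshift-below : ∀ {c i} → i < c → rshift c (rvar i) ≡ rvar i
rshift-below {c} {i} i<c rewrite <⇒<ᵇ-true i<c = refl

rshift-above : ∀ {c i} → c ≤ i → rshift c (rvar i) ≡ rvar (suc i)
rshift-above c≤i rewrite ≥⇒<ᵇ-false c≤i = refl

∂-below : ∀ {i j} → i < j → ∂ j (rvar i) [] ≡ rvar i ∷ []
∂-below i<j rewrite ≢⇒≡ᵇ-false (ℕ.<⇒≢ i<j) | <⇒<ᵇ-true i<j = refl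

∂-above : ∀ {i j} → j ≤ i → ∂ j (rvar (suc i)) [] ≡ rvar i ∷ []
∂-above {i} {j} j≤i rewrite ≢⇒≡ᵇ-false (ℕ.<⇒≢ (s≤s j≤i) ∘ sym) | ≥⇒<ᵇ-false (ℕ.m≤n⇒m≤1+n j≤i) = refl

∂-other : ∀ {i j} u us → i ≢ j → ∂ j (rvar i) (u ∷ us) ≡ []
∂-other u us i≢j rewrite ≢⇒≡ᵇ-false i≢j = refl

∂-equal-[] : ∀ j → ∂ j (rvar j) [] ≡ []
∂-equal-[] j rewrite ≡ᵇ-refl j = refl

∂-equal-[_] : ∀ {j} u → ∂ j (rvar j) (u ∷ []) ≡ u ∷ []
∂-equal-[_] {j} u rewrite ≡ᵇ-refl j = refl

∂-equal-∷∷ : ∀ j u v us → ∂ j (rvar j) (u ∷ v ∷ us) ≡ []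
∂-equal-∷∷ j u v us rewrite ≡ᵇ-refl j = refl

rshiftL-map : ∀ c ts → rshiftL c ts ≡ map (rshift c) ts
rshiftL-map c [] = refl
rshiftL-map c (t ∷ ts) = cong (rshift c t ∷_) (rshiftL-map c ts)

mutual
  rshift-rshift : ∀ {c d} s → c ≤ d → rshift c (rshift d s) ≡ rshift (suc d) (rshift c s)
  rshift-rshift {c} {d} (rvar i) c≤d with ℕ.<-≤-connex i c
  ... | inj₁ i<c rewrite <⇒<ᵇ-true (ℕ.<-≤-trans i<c c≤d) | <⇒<ᵇ-true i<c | <⇒<ᵇ-true (ℕ.m≤n⇒m≤1+n (ℕ.<-≤-trans i<c c≤d)) = refl
  ... | inj₂ c≤i with ℕ.<-≤-connex i d
  ...   | inj₁ i<d rewrite <⇒<ᵇ-true i<d | ≥⇒<ᵇ-false c≤i | <⇒<ᵇ-true i<d = refl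
  ...   | inj₂ d≤i rewrite ≥⇒<ᵇ-false d≤i | ≥⇒<ᵇ-false c≤i | ≥⇒<ᵇ-false d≤i | ≥⇒<ᵇ-false (ℕ.m≤n⇒m≤1+n c≤i) = refl
  rshift-rshift (rlam s) c≤d = cong rlam (rshift-rshift s (s≤s c≤d))
  rshift-rshift (rapp s ts) c≤d = cong₂ rapp (rshift-rshift s c≤d) (rshiftL-rshiftL ts c≤d)
  rshift-rshift (s ⊕•) c≤d = cong _⊕• (rshift-rshift s c≤d)
  rshift-rshift (•⊕ s) c≤d = cong •⊕_ (rshift-rshift s c≤d)

  rshiftL-rshiftL : ∀ {c d} ts → c ≤ d → rshiftL c (rshiftL d ts) ≡ rshiftL (suc d) (rshiftL c ts)
  rshiftL-rshiftL [] c≤d = refl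
  rshiftL-rshiftL (t ∷ ts) c≤d = cong₂ _∷_ (rshift-rshift t c≤d) (rshiftL-rshiftL ts c≤d)

splits2-rshiftL : ∀ c us → splits2 (rshiftL c us) ≡ map (λ (a , b) → rshiftL c a , rshiftL c b) (splits2 us)
splits2-rshiftL c [] = refl
splits2-rshiftL c (u ∷ us) = begin
  concatMap (extend (rshift c u)) (splits2 (rshiftL c us))
    ≡⟨ cong (concatMap (extend (rshift c u))) (splits2-rshiftL c us) ⟩
  concatMap (extend (rshift c u)) (map σ (splits2 us))
    ≡⟨ List.concatMap-map (extend (rshift c u)) σ (splits2 us) ⟩
  concatMap (λ p → extend (rshift c u) (σ p)) (splits2 us)
    ≡⟨ sym (List.map-concatMap σ (extend u) (splits2 us)) ⟩
  map σ (concatMap (extend u) (splits2 us)) ∎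
  where
  extend : RTerm → Split → List Split
  extend x (l , r) = (x ∷ l , r) ∷ (l , x ∷ r) ∷ []
  σ : Split → Split
  σ (a , b) = rshiftL c a , rshiftL c b

∑-splits2-rshiftL : ∀ c us (F : Split → ℕ) →
  ∑ (splits2 (rshiftL c us)) F ≡ ∑ (splits2 us) λ (a , b) → F (rshiftL c a , rshiftL c b)
∑-splits2-rshiftL c us F rewrite splits2-rshiftL c us = ∑-map _ (splits2 us) F

combine-rshiftL : ∀ c {_∙_ : A → B → C} (f f′ : List RTerm → List A) (g g′ : List RTerm → List B)
  {h₁ : A → A} {h₂ : B → B} {h : C → C} →
  (∀ a → f′ (rshiftL c a) ≡ map h₁ (f a)) → (∀ b → g′ (rshiftL c b) ≡ map h₂ (g b)) →
  (∀ x y → h (x ∙ y) ≡ h₁ x ∙ h₂ y) →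
  ∀ us → combine _∙_ f′ g′ (rshiftL c us) ≡ map h (combine _∙_ f g us)
combine-rshiftL c {_∙_} f f′ g g′ {h₁} {h₂} {h} f-eq g-eq h-eq us = begin
  concatMap (cell f′ g′) (splits2 (rshiftL c us))
    ≡⟨ cong (concatMap (cell f′ g′)) (splits2-rshiftL c us) ⟩
  concatMap (cell f′ g′) (map (λ (a , b) → rshiftL c a , rshiftL c b) (splits2 us))
    ≡⟨ List.concatMap-map (cell f′ g′) _ (splits2 us) ⟩
  concatMap (λ (a , b) → cell f′ g′ (rshiftL c a , rshiftL c b)) (splits2 us)
    ≡⟨ List.concatMap-cong cell-eq (splits2 us) ⟩
  concatMap (λ p → map h (cell f g p)) (splits2 us)
    ≡⟨ sym (List.map-concatMap h (cell f g) (splits2 us)) ⟩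
  map h (combine _∙_ f g us) ∎
  where
  cell : (List RTerm → List _) → (List RTerm → List _) → Split → List _
  cell f g (a , b) = concatMap (λ x → map (x ∙_) (g b)) (f a)
  cell-eq : ∀ p → cell f′ g′ (rshiftL c (proj₁ p) , rshiftL c (proj₂ p)) ≡ map h (cell f g p)
  cell-eq (a , b) = begin
    concatMap (λ x → map (x ∙_) (g′ (rshiftL c b))) (f′ (rshiftL c a))
      ≡⟨ cong₂ (λ ys xs → concatMap (λ x → map (x ∙_) ys) xs) (g-eq b) (f-eq a) ⟩
    concatMap (λ x → map (x ∙_) (map h₂ (g b))) (map h₁ (f a))
      ≡⟨ List.concatMap-map _ h₁ (f a) ⟩
    concatMap (λ x → map (h₁ x ∙_) (map h₂ (g b))) (f a)
      ≡⟨ List.concatMap-cong (λ x → trans (sym (List.map-∘ (g b)))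
           (trans (List.map-cong (λ y → sym (h-eq x y)) (g b)) (List.map-∘ (g b)))) (f a) ⟩
    concatMap (λ x → map h (map (x ∙_) (g b))) (f a)
      ≡⟨ sym (List.map-concatMap h _ (f a)) ⟩
    map h (cell f g (a , b)) ∎

map-square : ∀ {f : A → B} {g : C → B} {h : D → A} {k : D → C} → (∀ x → f (h x) ≡ g (k x)) →
  ∀ xs → map f (map h xs) ≡ map g (map k xs)
map-square eq xs = trans (sym (List.map-∘ xs)) (trans (List.map-cong eq xs) (List.map-∘ xs))

∂-rshift-var-≤ : ∀ {c j} i us → c ≤ j → ∂ (suc j) (rshift c (rvar i)) (rshiftL c us) ≡ map (rshift c) (∂ j (rvar i) us)
∂-rshift-var-≤ {c} {j} i us c≤j with varView j i
∂-rshift-var-≤ {c} {j} i us c≤j | below i<j with ℕ.<-≤-connex i c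
∂-rshift-var-≤ {c} {j} i [] c≤j | below i<j | inj₁ i<c
  rewrite rshift-below i<c | ∂-below i<j | ∂-below (ℕ.m≤n⇒m≤1+n i<j) | <⇒<ᵇ-true i<c = refl
∂-rshift-var-≤ {c} {j} i (u ∷ us) c≤j | below i<j | inj₁ i<c
  rewrite rshift-below i<c | ∂-other u us (ℕ.<⇒≢ i<j)
        | ∂-other (rshift c u) (rshiftL c us) (ℕ.<⇒≢ (ℕ.m≤n⇒m≤1+n i<j)) = refl
∂-rshift-var-≤ {c} {j} i [] c≤j | below i<j | inj₂ c≤i
  rewrite rshift-above c≤i | ∂-below i<j | ∂-below (s≤s i<j) | ≥⇒<ᵇ-false c≤i = refl
∂-rshift-var-≤ {c} {j} i (u ∷ us) c≤j | below i<j | inj₂ c≤i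
  rewrite rshift-above c≤i | ∂-other u us (ℕ.<⇒≢ i<j)
        | ∂-other (rshift c u) (rshiftL c us) (ℕ.<⇒≢ (s≤s i<j)) = refl
∂-rshift-var-≤ {c} {j} .j [] c≤j | equal
  rewrite rshift-above c≤j | ∂-equal-[] j | ∂-equal-[] (suc j) = refl
∂-rshift-var-≤ {c} {j} .j (u ∷ []) c≤j | equal
  rewrite rshift-above c≤j | ∂-equal-[_] {j} u | ∂-equal-[_] {suc j} (rshift c u) = refl
∂-rshift-var-≤ {c} {j} .j (u ∷ v ∷ us) c≤j | equal
  rewrite rshift-above c≤j | ∂-equal-∷∷ j u v us
        | ∂-equal-∷∷ (suc j) (rshift c u) (rshift c v) (rshiftL c us) = refl
∂-rshift-var-≤ {c} {j} (suc i) [] c≤j | above j≤i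
  rewrite rshift-above (ℕ.m≤n⇒m≤1+n (ℕ.≤-trans c≤j j≤i)) | ∂-above j≤i | ∂-above (s≤s j≤i)
        | ≥⇒<ᵇ-false (ℕ.≤-trans c≤j j≤i) = refl
∂-rshift-var-≤ {c} {j} (suc i) (u ∷ us) c≤j | above j≤i
  rewrite rshift-above (ℕ.m≤n⇒m≤1+n (ℕ.≤-trans c≤j j≤i)) | ∂-other u us (ℕ.<⇒≢ (s≤s j≤i) ∘ sym)
        | ∂-other (rshift c u) (rshiftL c us) (ℕ.<⇒≢ (s≤s (s≤s j≤i)) ∘ sym) = refl

∂-rshift-var-≥ : ∀ {c j} i us → j ≤ c → ∂ j (rshift (suc c) (rvar i)) (rshiftL c us) ≡ map (rshift c) (∂ j (rvar i) us)
∂-rshift-var-≥ {c} {j} i us j≤c with varView j i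
∂-rshift-var-≥ {c} {j} i [] j≤c | below i<j
  rewrite rshift-below (ℕ.m≤n⇒m≤1+n (ℕ.<-≤-trans i<j j≤c)) | ∂-below i<j | <⇒<ᵇ-true (ℕ.<-≤-trans i<j j≤c) = refl
∂-rshift-var-≥ {c} {j} i (u ∷ us) j≤c | below i<j
  rewrite rshift-below (ℕ.m≤n⇒m≤1+n (ℕ.<-≤-trans i<j j≤c)) | ∂-other u us (ℕ.<⇒≢ i<j)
        | ∂-other (rshift c u) (rshiftL c us) (ℕ.<⇒≢ i<j) = refl
∂-rshift-var-≥ {c} {j} .j [] j≤c | equal
  rewrite rshift-below (s≤s j≤c) | ∂-equal-[] j = refl
∂-rshift-var-≥ {c} {j} .j (u ∷ []) j≤c | equal
  rewrite rshift-below (s≤s j≤c) | ∂-equal-[_] {j} u | ∂-equal-[_] {j} (rshift c u) = refl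
∂-rshift-var-≥ {c} {j} .j (u ∷ v ∷ us) j≤c | equal
  rewrite rshift-below (s≤s j≤c) | ∂-equal-∷∷ j u v us
        | ∂-equal-∷∷ j (rshift c u) (rshift c v) (rshiftL c us) = refl
∂-rshift-var-≥ {c} {j} (suc i) us j≤c | above j≤i with ℕ.<-≤-connex i c
∂-rshift-var-≥ {c} {j} (suc i) [] j≤c | above j≤i | inj₁ i<c
  rewrite rshift-below (s≤s i<c) | ∂-above j≤i | <⇒<ᵇ-true i<c = refl
∂-rshift-var-≥ {c} {j} (suc i) (u ∷ us) j≤c | above j≤i | inj₁ i<c
  rewrite rshift-below (s≤s i<c) | ∂-other u us (ℕ.<⇒≢ (s≤s j≤i) ∘ sym)
        | ∂-other (rshift c u) (rshiftL c us) (ℕ.<⇒≢ (s≤s j≤i) ∘ sym) = refl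
∂-rshift-var-≥ {c} {j} (suc i) [] j≤c | above j≤i | inj₂ c≤i
  rewrite rshift-above (s≤s c≤i) | ∂-above j≤i | ∂-above (ℕ.m≤n⇒m≤1+n j≤i) | ≥⇒<ᵇ-false c≤i = refl
∂-rshift-var-≥ {c} {j} (suc i) (u ∷ us) j≤c | above j≤i | inj₂ c≤i
  rewrite rshift-above (s≤s c≤i) | ∂-other u us (ℕ.<⇒≢ (s≤s j≤i) ∘ sym)
        | ∂-other (rshift c u) (rshiftL c us) (ℕ.<⇒≢ (ℕ.m≤n⇒m≤1+n (s≤s j≤i)) ∘ sym) = refl

-- Shifting by c after substituting for j is substituting for j′ after shifting by c′.
data Shifted (c j : ℕ) : ℕ → ℕ → Set where
  low  : c ≤ j → Shifted c j c (suc j)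
  high : j ≤ c → Shifted c j (suc c) j

Shifted-suc : ∀ {c j c′ j′} → Shifted c j c′ j′ → Shifted (suc c) (suc j) (suc c′) (suc j′)
Shifted-suc (low c≤j) = low (s≤s c≤j)
Shifted-suc (high j≤c) = high (s≤s j≤c)

mutual
  ∂-rshift : ∀ {c j c′ j′} → Shifted c j c′ j′ → ∀ s us → ∂ j′ (rshift c′ s) (rshiftL c us) ≡ map (rshift c) (∂ j s us)
  ∂-rshift (low c≤j) (rvar i) us = ∂-rshift-var-≤ i us c≤j
  ∂-rshift (high j≤c) (rvar i) us = ∂-rshift-var-≥ i us j≤c
  ∂-rshift {c} {j} sh (rlam s) us
    rewrite rshiftL-rshiftL us (z≤n {c}) | ∂-rshift (Shifted-suc sh) s (rshiftL 0 us) = map-square (λ _ → refl) (∂ (suc j) s (rshiftL 0 us))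
  ∂-rshift {c} {j} {c′} {j′} sh (rapp s ts) us =
    combine-rshiftL c (∂ j s) (∂ j′ (rshift c′ s)) (∂L j ts) (∂L j′ (rshiftL c′ ts)) (∂-rshift sh s) (∂L-rshift sh ts) (λ _ _ → refl) us
  ∂-rshift {c} {j} sh (s ⊕•) us rewrite ∂-rshift sh s us = map-square (λ _ → refl) (∂ j s us)
  ∂-rshift {c} {j} sh (•⊕ s) us rewrite ∂-rshift sh s us = map-square (λ _ → refl) (∂ j s us)

  ∂L-rshift : ∀ {c j c′ j′} → Shifted c j c′ j′ → ∀ ts us → ∂L j′ (rshiftL c′ ts) (rshiftL c us) ≡ map (rshiftL c) (∂L j ts us)
  ∂L-rshift sh [] [] = refl
  ∂L-rshift sh [] (u ∷ us) = refl
  ∂L-rshift {c} {j} {c′} {j′} sh (t ∷ ts) us =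
    combine-rshiftL c (∂ j t) (∂ j′ (rshift c′ t)) (∂L j ts) (∂L j′ (rshiftL c′ ts)) (∂-rshift sh t) (∂L-rshift sh ts) (λ _ _ → refl) us

mutual
  -- Shifting at `k` leaves no occurrence of `k`, so substituting the empty monomial merely lowers
  -- the indices again. The variable case of the substitution lemma produces terms of this kind.
  ∑-∂-rshift-[] : ∀ k s (φ : RTerm → ℕ) → ∑ (∂ k (rshift k s) []) φ ≡ φ s
  ∑-∂-rshift-[] k (rvar i) φ with ℕ.<-≤-connex i k
  ... | inj₁ i<k rewrite rshift-below i<k | ∂-below i<k = ∑-singleton (rvar i) φ
  ... | inj₂ k≤i rewrite rshift-above k≤i | ∂-above k≤i = ∑-singleton (rvar i) φ
  ∑-∂-rshift-[] k (rlam s) φ = trans (∑-map rlam (∂ (suc k) (rshift (suc k) s) []) φ) (∑-∂-rshift-[] (suc k) s (φ ∘ rlam))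
  ∑-∂-rshift-[] k (rapp s ts) φ = trans (∑-∂-rapp k (rshift k s) (rshiftL k ts) [] φ) (trans (ℕ.+-identityʳ _)
    (trans (∑-∂-rshift-[] k s (λ s′ → ∑[ ts′ ← ∂L k (rshiftL k ts) [] ] φ (rapp s′ ts′))) (∑-∂L-rshiftL-[] k ts (φ ∘ rapp s))))
  ∑-∂-rshift-[] k (s ⊕•) φ = trans (∑-map _⊕• (∂ k (rshift k s) []) φ) (∑-∂-rshift-[] k s (φ ∘ _⊕•))
  ∑-∂-rshift-[] k (•⊕ s) φ = trans (∑-map •⊕_ (∂ k (rshift k s) []) φ) (∑-∂-rshift-[] k s (φ ∘ •⊕_))

  ∑-∂L-rshiftL-[] : ∀ k ts (φ : List RTerm → ℕ) → ∑ (∂L k (rshiftL k ts) []) φ ≡ φ ts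
  ∑-∂L-rshiftL-[] k [] φ = ∑-singleton [] φ
  ∑-∂L-rshiftL-[] k (t ∷ ts) φ = trans (∑-∂L-∷ k (rshift k t) (rshiftL k ts) [] φ) (trans (ℕ.+-identityʳ _)
    (trans (∑-∂-rshift-[] k t (λ t′ → ∑[ ts′ ← ∂L k (rshiftL k ts) [] ] φ (t′ ∷ ts′))) (∑-∂L-rshiftL-[] k ts (φ ∘ (t ∷_)))))

∑-splits2-zero : ∀ u us (F : Split → ℕ) → (∀ u l r → F (u ∷ l , r) ≡ 0) → (∀ u l r → F (l , u ∷ r) ≡ 0) →
  ∑ (splits2 (u ∷ us)) F ≡ 0
∑-splits2-zero u us F zˡ zʳ = trans (∑-splits2-emptyˡ (u ∷ us) F zˡ) (zʳ u [] us)

mutual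
  -- No occurrence of `k` is left that could consume `u`.
  ∑-∂-rshift-∷ : ∀ k s u us (φ : RTerm → ℕ) → ∑ (∂ k (rshift k s) (u ∷ us)) φ ≡ 0
  ∑-∂-rshift-∷ k (rvar i) u us φ with ℕ.<-≤-connex i k
  ... | inj₁ i<k rewrite rshift-below i<k | ∂-other u us (ℕ.<⇒≢ i<k) = refl
  ... | inj₂ k≤i rewrite rshift-above k≤i | ∂-other u us (ℕ.<⇒≢ (s≤s k≤i) ∘ sym) = refl
  ∑-∂-rshift-∷ k (rlam s) u us φ = trans (∑-map rlam (∂ (suc k) (rshift (suc k) s) (rshift 0 u ∷ rshiftL 0 us)) φ) (∑-∂-rshift-∷ (suc k) s (rshift 0 u) (rshiftL 0 us) (φ ∘ rlam))
  ∑-∂-rshift-∷ k (rapp s ts) u us φ = trans (∑-∂-rapp k (rshift k s) (rshiftL k ts) (u ∷ us) φ)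
    (∑-splits2-zero u us _ (λ v l r → ∑-∂-rshift-∷ k s v l _)
      (λ v l r → trans (∑-cong (∂ k (rshift k s) l) λ s′ → ∑-∂L-rshiftL-∷ k ts v r _) (∑-zero (∂ k (rshift k s) l))))
  ∑-∂-rshift-∷ k (s ⊕•) u us φ = trans (∑-map _⊕• (∂ k (rshift k s) (u ∷ us)) φ) (∑-∂-rshift-∷ k s u us (φ ∘ _⊕•))
  ∑-∂-rshift-∷ k (•⊕ s) u us φ = trans (∑-map •⊕_ (∂ k (rshift k s) (u ∷ us)) φ) (∑-∂-rshift-∷ k s u us (φ ∘ •⊕_))

  ∑-∂L-rshiftL-∷ : ∀ k ts u us (φ : List RTerm → ℕ) → ∑ (∂L k (rshiftL k ts) (u ∷ us)) φ ≡ 0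
  ∑-∂L-rshiftL-∷ k [] u us φ = refl
  ∑-∂L-rshiftL-∷ k (t ∷ ts) u us φ = trans (∑-∂L-∷ k (rshift k t) (rshiftL k ts) (u ∷ us) φ)
    (∑-splits2-zero u us _ (λ v l r → ∑-∂-rshift-∷ k t v l _)
      (λ v l r → trans (∑-cong (∂ k (rshift k t) l) λ s′ → ∑-∂L-rshiftL-∷ k ts v r _) (∑-zero (∂ k (rshift k t) l))))

-- The substitution lemma

∑-splits2-assoc : ∀ us (K : List RTerm → List RTerm → List RTerm → ℕ) →
  (∑ (splits2 us) λ (a , b) → ∑ (splits2 a) λ (x , y) → K x y b) ≡
  (∑ (splits2 us) λ (x , r) → ∑ (splits2 r) λ (y , b) → K x y b)
∑-splits2-assoc [] K = refl
∑-splits2-assoc (u ∷ us) K = begin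
  (∑ (splits2 (u ∷ us)) λ (a , b) → ∑ (splits2 a) λ (x , y) → K x y b)
    ≡⟨ trans (∑-splits2-∷ u us _) (trans (∑-+ (splits2 us) _ _) (cong (_+ Lhs K₃)
         (trans (∑-cong (splits2 us) λ (a , b) → trans (∑-splits2-∷ u a _) (∑-+ (splits2 a) _ _)) (∑-+ (splits2 us) _ _)))) ⟩
  (Lhs K₁ + Lhs K₂) + Lhs K₃
    ≡⟨ cong₂ _+_ (cong₂ _+_ (∑-splits2-assoc us K₁) (∑-splits2-assoc us K₂)) (∑-splits2-assoc us K₃) ⟩
  (Rhs K₁ + Rhs K₂) + Rhs K₃
    ≡⟨ ℕ.+-assoc (Rhs K₁) _ _ ⟩
  Rhs K₁ + (Rhs K₂ + Rhs K₃)
    ≡⟨ sym (trans (∑-splits2-∷ u us _) (trans (∑-+ (splits2 us) _ _) (cong (Rhs K₁ +_)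
         (trans (∑-cong (splits2 us) λ (x , r) → trans (∑-splits2-∷ u r _) (∑-+ (splits2 r) _ _)) (∑-+ (splits2 us) _ _))))) ⟩
  (∑ (splits2 (u ∷ us)) λ (x , r) → ∑ (splits2 r) λ (y , b) → K x y b) ∎
  where
  Lhs Rhs : (List RTerm → List RTerm → List RTerm → ℕ) → ℕ
  Lhs K = ∑ (splits2 us) λ (a , b) → ∑ (splits2 a) λ (x , y) → K x y b
  Rhs K = ∑ (splits2 us) λ (x , r) → ∑ (splits2 r) λ (y , b) → K x y b
  K₁ K₂ K₃ : List RTerm → List RTerm → List RTerm → ℕ
  K₁ x y b = K (u ∷ x) y b
  K₂ x y b = K x (u ∷ y) b
  K₃ x y b = K x y (u ∷ b)

∑-splits2-assoc-comm : ∀ us (K : List RTerm → List RTerm → List RTerm → ℕ) →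
  (∑ (splits2 us) λ (a , b) → ∑ (splits2 b) λ (x , y) → K x a y) ≡
  (∑ (splits2 us) λ (x , r) → ∑ (splits2 r) λ (a , y) → K x a y)
∑-splits2-assoc-comm us K = begin
  (∑ (splits2 us) λ (a , b) → ∑ (splits2 b) λ (x , y) → K x a y)
    ≡⟨ sym (∑-splits2-assoc us (λ a x y → K x a y)) ⟩
  (∑ (splits2 us) λ (r , y) → ∑ (splits2 r) λ (a , x) → K x a y)
    ≡⟨ ∑-cong (splits2 us) (λ (r , y) → ∑-splits2-comm r _) ⟩
  (∑ (splits2 us) λ (r , y) → ∑ (splits2 r) λ (x , a) → K x a y)
    ≡⟨ ∑-splits2-assoc us K ⟩
  _ ∎

-- Elements of a substituted list stay at the positions of the originals, so a split of the result
-- is a split of `ts` together with a division of `us` between the two parts.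
∑-∂L-splits2 : ∀ j ts us (H : Split → ℕ) →
  ∑[ ts′ ← ∂L j ts us ] ∑ (splits2 ts′) H ≡
  ∑ (splits2 ts) λ (c , d) → ∑ (splits2 us) λ (a , b) → ∑[ c′ ← ∂L j c a ] ∑[ d′ ← ∂L j d b ] H (c′ , d′)
∑-∂L-splits2 j [] [] H = sym (trans (ℕ.+-identityʳ _) (ℕ.+-identityʳ _))
∑-∂L-splits2 j [] (u ∷ us) H = sym (trans (∑-singleton ([] , []) F) (∑-splits2-zero u us G
    (λ _ _ _ → refl) (λ v l r → ∑-zero (∂L j [] l))))
  where
  G : Split → ℕ
  G (a , b) = ∑[ c′ ← ∂L j [] a ] ∑[ d′ ← ∂L j [] b ] H (c′ , d′)
  F : Split → ℕ
  F (c , d) = ∑ (splits2 (u ∷ us)) λ (a , b) → ∑[ c′ ← ∂L j c a ] ∑[ d′ ← ∂L j d b ] H (c′ , d′)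
∑-∂L-splits2 j (t ∷ ts) us H = begin
  ∑[ ts′ ← ∂L j (t ∷ ts) us ] ∑ (splits2 ts′) H
    ≡⟨ ∑-∂L-∷ j t ts us (λ ts′ → ∑ (splits2 ts′) H) ⟩
  (∑ (splits2 us) λ (x , r) → ∑[ t′ ← ∂ j t x ] ∑[ ts′ ← ∂L j ts r ] ∑ (splits2 (t′ ∷ ts′)) H)
    ≡⟨ ∑-cong (splits2 us) (λ (x , r) → ∑-cong (∂ j t x) λ t′ → trans
         (∑-cong (∂L j ts r) λ ts′ → trans (∑-splits2-∷ t′ ts′ H) (∑-+ (splits2 ts′) _ _))
         (trans (∑-+ (∂L j ts r) _ _) (cong₂ _+_
           (∑-∂L-splits2 j ts r (λ (l , r) → H (t′ ∷ l , r))) (∑-∂L-splits2 j ts r (λ (l , r) → H (l , t′ ∷ r)))))) ⟩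
  (∑ (splits2 us) λ (x , r) → ∑[ t′ ← ∂ j t x ]
     ((∑ (splits2 ts) λ (c , d) → ∑ (splits2 r) λ (a , b) → ∑[ c′ ← ∂L j c a ] ∑[ d′ ← ∂L j d b ] H (t′ ∷ c′ , d′)) +
      (∑ (splits2 ts) λ (c , d) → ∑ (splits2 r) λ (a , b) → ∑[ c′ ← ∂L j c a ] ∑[ d′ ← ∂L j d b ] H (c′ , t′ ∷ d′))))
    ≡⟨ trans (∑-cong (splits2 us) λ (x , r) → ∑-+ (∂ j t x) _ _) (∑-+ (splits2 us) _ _) ⟩
  (∑ (splits2 us) λ (x , r) → ∑[ t′ ← ∂ j t x ]
      ∑ (splits2 ts) λ (c , d) → ∑ (splits2 r) λ (a , b) → ∑[ c′ ← ∂L j c a ] ∑[ d′ ← ∂L j d b ] H (t′ ∷ c′ , d′)) +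
  (∑ (splits2 us) λ (x , r) → ∑[ t′ ← ∂ j t x ]
      ∑ (splits2 ts) λ (c , d) → ∑ (splits2 r) λ (a , b) → ∑[ c′ ← ∂L j c a ] ∑[ d′ ← ∂L j d b ] H (c′ , t′ ∷ d′))
    ≡⟨ cong₂ _+_ left right ⟩
  (∑ (splits2 ts) λ (c , d) → ∑ (splits2 us) λ (a , b) → ∑[ c′ ← ∂L j (t ∷ c) a ] ∑[ d′ ← ∂L j d b ] H (c′ , d′)) +
  (∑ (splits2 ts) λ (c , d) → ∑ (splits2 us) λ (a , b) → ∑[ c′ ← ∂L j c a ] ∑[ d′ ← ∂L j (t ∷ d) b ] H (c′ , d′))
    ≡⟨ sym (trans (∑-splits2-∷ t ts _) (∑-+ (splits2 ts) _ _)) ⟩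
  _ ∎
  where
  out : ∀ (M : RTerm → List RTerm → List RTerm → List RTerm → List RTerm → ℕ) →
    (∑ (splits2 us) λ (x , r) → ∑[ t′ ← ∂ j t x ] ∑ (splits2 ts) λ (c , d) → ∑ (splits2 r) λ (a , b) → M t′ c d a b) ≡
    (∑ (splits2 ts) λ (c , d) → ∑ (splits2 us) λ (x , r) → ∑ (splits2 r) λ (a , b) → ∑[ t′ ← ∂ j t x ] M t′ c d a b)
  out M = trans
    (∑-cong (splits2 us) λ (x , r) → trans (∑-swap (∂ j t x) (splits2 ts) _)
      (∑-cong (splits2 ts) λ (c , d) → ∑-swap (∂ j t x) (splits2 r) _))
    (∑-swap (splits2 us) (splits2 ts) _)
  left : (∑ (splits2 us) λ (x , r) → ∑[ t′ ← ∂ j t x ]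
      ∑ (splits2 ts) λ (c , d) → ∑ (splits2 r) λ (a , b) → ∑[ c′ ← ∂L j c a ] ∑[ d′ ← ∂L j d b ] H (t′ ∷ c′ , d′)) ≡
    (∑ (splits2 ts) λ (c , d) → ∑ (splits2 us) λ (a , b) → ∑[ c′ ← ∂L j (t ∷ c) a ] ∑[ d′ ← ∂L j d b ] H (c′ , d′))
  left = trans (out (λ t′ c d a b → ∑[ c′ ← ∂L j c a ] ∑[ d′ ← ∂L j d b ] H (t′ ∷ c′ , d′)))
    (∑-cong (splits2 ts) λ (c , d) → trans (sym (∑-splits2-assoc us _))
      (∑-cong (splits2 us) λ (a , b) → sym (∑-∂L-∷ j t c a (λ c′ → ∑[ d′ ← ∂L j d b ] H (c′ , d′)))))
  right : (∑ (splits2 us) λ (x , r) → ∑[ t′ ← ∂ j t x ]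
      ∑ (splits2 ts) λ (c , d) → ∑ (splits2 r) λ (a , b) → ∑[ c′ ← ∂L j c a ] ∑[ d′ ← ∂L j d b ] H (c′ , t′ ∷ d′)) ≡
    (∑ (splits2 ts) λ (c , d) → ∑ (splits2 us) λ (a , b) → ∑[ c′ ← ∂L j c a ] ∑[ d′ ← ∂L j (t ∷ d) b ] H (c′ , d′))
  right = trans (out (λ t′ c d a b → ∑[ c′ ← ∂L j c a ] ∑[ d′ ← ∂L j d b ] H (c′ , t′ ∷ d′)))
    (∑-cong (splits2 ts) λ (c , d) → trans
      (sym (∑-splits2-assoc-comm us (λ x a b → ∑[ t′ ← ∂ j t x ] ∑[ c′ ← ∂L j c a ] ∑[ d′ ← ∂L j d b ] H (c′ , t′ ∷ d′))))
      (∑-cong (splits2 us) λ (a , b) → trans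
        (∑-cong (splits2 b) λ (x , y) → ∑-swap (∂ j t x) (∂L j c a) _)
        (trans (∑-swap (splits2 b) (∂L j c a) _)
          (∑-cong (∂L j c a) λ c′ → sym (∑-∂L-∷ j t d b (λ d′ → H (c′ , d′)))))))

-- The induction step shared by applications and non-empty monomials. `f-eq` and `g-eq` are the
-- substitution lemma for the two components: `f` and `g` substitute `ts` and are followed by `F`
-- and `F₂`, which substitute `us`; in the other order `f′` and `g′` substitute `us`, and `G` and
-- `G₂` then substitute the arguments, which have received their own share of `us`.
module _ (j : ℕ) (f f′ : List RTerm → List A) (F G : A → List RTerm → List A)
         (g g′ : List RTerm → List B) (F₂ G₂ : B → List RTerm → List B)
  (f-eq : ∀ ts us (φ : A → ℕ) → ∑[ x ← f ts ] ∑ (F x us) φ ≡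
    ∑ (splits2 us) λ (a , b) → ∑[ s′ ← f′ a ] ∑[ ts′ ← ∂L j ts b ] ∑ (G s′ ts′) φ)
  (g-eq : ∀ ts us (φ : B → ℕ) → ∑[ x ← g ts ] ∑ (F₂ x us) φ ≡
    ∑ (splits2 us) λ (a , b) → ∑[ s′ ← g′ a ] ∑[ ts′ ← ∂L j ts b ] ∑ (G₂ s′ ts′) φ)
  where

  private
    Q : (A → B → ℕ) → (c d a₁ a₂ b₁ b₂ : List RTerm) → ℕ
    Q φ c d a₁ a₂ b₁ b₂ = ∑[ s′ ← f′ a₁ ] ∑[ c′ ← ∂L j c a₂ ] ∑[ x ← G s′ c′ ]
      ∑[ xs′ ← g′ b₁ ] ∑[ d′ ← ∂L j d b₂ ] ∑[ y ← G₂ xs′ d′ ] φ x y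

    lhs : ∀ (φ : A → B → ℕ) c d us →
      (∑[ x ← f c ] ∑[ y ← g d ] ∑ (splits2 us) λ (a , b) → ∑[ x′ ← F x a ] ∑[ y′ ← F₂ y b ] φ x′ y′) ≡
      (∑ (splits2 us) λ (a , b) → ∑ (splits2 a) λ (a₁ , b₁) → ∑ (splits2 b) λ (a₂ , b₂) → Q φ c d a₁ a₂ b₁ b₂)
    lhs φ c d us = begin
      (∑[ x ← f c ] ∑[ y ← g d ] ∑ (splits2 us) λ (a , b) → ∑[ x′ ← F x a ] ∑[ y′ ← F₂ y b ] φ x′ y′)
        ≡⟨ trans (∑-cong (f c) λ x → ∑-swap (g d) (splits2 us) _) (∑-swap (f c) (splits2 us) _) ⟩
      (∑ (splits2 us) λ (a , b) → ∑[ x ← f c ] ∑[ y ← g d ] ∑[ x′ ← F x a ] ∑[ y′ ← F₂ y b ] φ x′ y′)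
        ≡⟨ ∑-cong (splits2 us) (λ (a , b) → trans
             (∑-cong (f c) λ x → ∑-swap (g d) (F x a) _)
             (f-eq c a (λ x′ → ∑[ y ← g d ] ∑[ y′ ← F₂ y b ] φ x′ y′))) ⟩
      (∑ (splits2 us) λ (a , b) → ∑ (splits2 a) λ (a₁ , a₂) → ∑[ s′ ← f′ a₁ ] ∑[ c′ ← ∂L j c a₂ ] ∑[ x ← G s′ c′ ]
        ∑[ y ← g d ] ∑[ y′ ← F₂ y b ] φ x y′)
        ≡⟨ ∑-cong (splits2 us) (λ (a , b) → ∑-cong (splits2 a) λ (a₁ , a₂) → trans
             (∑-cong (f′ a₁) λ s′ → trans
               (∑-cong (∂L j c a₂) λ c′ → trans
                 (∑-cong (G s′ c′) λ x → g-eq d b (φ x))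
                 (∑-swap (G s′ c′) (splits2 b) _))
               (∑-swap (∂L j c a₂) (splits2 b) _))
             (∑-swap (f′ a₁) (splits2 b) _)) ⟩
      (∑ (splits2 us) λ (a , b) → ∑ (splits2 a) λ (a₁ , a₂) → ∑ (splits2 b) λ (b₁ , b₂) → Q φ c d a₁ a₂ b₁ b₂)
        -- So far `us` is divided between the two components and then, in each, between the
        -- component and its arguments. The other side of the lemma separates components from
        -- arguments first.
        ≡⟨ ∑-splits2-interchange us (Q φ c d) ⟩
      _ ∎

    rhs : ∀ (φ : A → B → ℕ) ts a₁ b₁ b →
      (∑[ s′ ← f′ a₁ ] ∑[ xs′ ← g′ b₁ ] ∑[ ts′ ← ∂L j ts b ] ∑ (splits2 ts′) λ (c′ , d′) →
        ∑[ x ← G s′ c′ ] ∑[ y ← G₂ xs′ d′ ] φ x y) ≡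
      (∑ (splits2 ts) λ (c , d) → ∑ (splits2 b) λ (a₂ , b₂) → Q φ c d a₁ a₂ b₁ b₂)
    rhs φ ts a₁ b₁ b = begin
      (∑[ s′ ← f′ a₁ ] ∑[ xs′ ← g′ b₁ ] ∑[ ts′ ← ∂L j ts b ] ∑ (splits2 ts′) λ (c′ , d′) →
        ∑[ x ← G s′ c′ ] ∑[ y ← G₂ xs′ d′ ] φ x y)
        ≡⟨ trans (∑-cong (f′ a₁) λ s′ → ∑-swap (g′ b₁) (∂L j ts b) _) (∑-swap (f′ a₁) (∂L j ts b) _) ⟩
      (∑[ ts′ ← ∂L j ts b ] ∑[ s′ ← f′ a₁ ] ∑[ xs′ ← g′ b₁ ] ∑ (splits2 ts′) λ (c′ , d′) →
        ∑[ x ← G s′ c′ ] ∑[ y ← G₂ xs′ d′ ] φ x y)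
        ≡⟨ ∑-cong (∂L j ts b) (λ ts′ → trans
             (∑-cong (f′ a₁) λ s′ → ∑-swap (g′ b₁) (splits2 ts′) _) (∑-swap (f′ a₁) (splits2 ts′) _)) ⟩
      (∑[ ts′ ← ∂L j ts b ] ∑ (splits2 ts′) λ (c′ , d′) → ∑[ s′ ← f′ a₁ ] ∑[ xs′ ← g′ b₁ ]
        ∑[ x ← G s′ c′ ] ∑[ y ← G₂ xs′ d′ ] φ x y)
        ≡⟨ ∑-∂L-splits2 j ts b _ ⟩
      (∑ (splits2 ts) λ (c , d) → ∑ (splits2 b) λ (a₂ , b₂) → ∑[ c′ ← ∂L j c a₂ ] ∑[ d′ ← ∂L j d b₂ ]
        ∑[ s′ ← f′ a₁ ] ∑[ xs′ ← g′ b₁ ] ∑[ x ← G s′ c′ ] ∑[ y ← G₂ xs′ d′ ] φ x y)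
        ≡⟨ ∑-cong (splits2 ts) (λ (c , d) → ∑-cong (splits2 b) λ (a₂ , b₂) → trans
             (∑-cong (∂L j c a₂) λ c′ → ∑-swap (∂L j d b₂) (f′ a₁) _)
             (∑-swap (∂L j c a₂) (f′ a₁) _)) ⟩
      (∑ (splits2 ts) λ (c , d) → ∑ (splits2 b) λ (a₂ , b₂) → ∑[ s′ ← f′ a₁ ] ∑[ c′ ← ∂L j c a₂ ]
        ∑[ d′ ← ∂L j d b₂ ] ∑[ xs′ ← g′ b₁ ] ∑[ x ← G s′ c′ ] ∑[ y ← G₂ xs′ d′ ] φ x y)
        ≡⟨ ∑-cong (splits2 ts) (λ (c , d) → ∑-cong (splits2 b) λ (a₂ , b₂) →
             ∑-cong (f′ a₁) λ s′ → ∑-cong (∂L j c a₂) λ c′ → trans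
               (∑-swap (∂L j d b₂) (g′ b₁) _)
               (trans (∑-cong (g′ b₁) λ xs′ → ∑-swap (∂L j d b₂) (G s′ c′) _) (∑-swap (g′ b₁) (G s′ c′) _))) ⟩
      _ ∎

  ∑-substitution-pair : ∀ ts us (φ : A → B → ℕ) →
    (∑ (splits2 ts) λ (c , d) → ∑[ x ← f c ] ∑[ y ← g d ]
      ∑ (splits2 us) λ (a , b) → ∑[ x′ ← F x a ] ∑[ y′ ← F₂ y b ] φ x′ y′) ≡
    (∑ (splits2 us) λ (a , b) → ∑ (splits2 a) λ (a₁ , b₁) → ∑[ s′ ← f′ a₁ ] ∑[ xs′ ← g′ b₁ ]
      ∑[ ts′ ← ∂L j ts b ] ∑ (splits2 ts′) λ (c′ , d′) → ∑[ x ← G s′ c′ ] ∑[ y ← G₂ xs′ d′ ] φ x y)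
  ∑-substitution-pair ts us φ = begin
    _
      ≡⟨ ∑-cong (splits2 ts) (λ (c , d) → lhs φ c d us) ⟩
    (∑ (splits2 ts) λ (c , d) → ∑ (splits2 us) λ (a , b) → ∑ (splits2 a) λ (a₁ , b₁) → ∑ (splits2 b) λ (a₂ , b₂) →
      Q φ c d a₁ a₂ b₁ b₂)
      ≡⟨ trans (∑-swap (splits2 ts) (splits2 us) _) (∑-cong (splits2 us) λ (a , b) → ∑-swap (splits2 ts) (splits2 a) _) ⟩
    (∑ (splits2 us) λ (a , b) → ∑ (splits2 a) λ (a₁ , b₁) → ∑ (splits2 ts) λ (c , d) → ∑ (splits2 b) λ (a₂ , b₂) →
      Q φ c d a₁ a₂ b₁ b₂)
      ≡⟨ ∑-cong (splits2 us) (λ (a , b) → ∑-cong (splits2 a) λ (a₁ , b₁) → sym (rhs φ ts a₁ b₁ b)) ⟩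
    _ ∎

∑-∂L-∷-zero : ∀ j t ts us (φ : List RTerm → ℕ) → (∀ t′ ts′ → φ (t′ ∷ ts′) ≡ 0) → ∑ (∂L j (t ∷ ts) us) φ ≡ 0
∑-∂L-∷-zero j t ts us φ z = trans (∑-∂L-∷ j t ts us φ) (trans
  (∑-cong (splits2 us) λ (a , b) → trans
    (∑-cong (∂ j t a) λ t′ → trans (∑-cong (∂L j ts b) λ ts′ → z t′ ts′) (∑-zero (∂L j ts b)))
    (∑-zero (∂ j t a)))
  (∑-zero (splits2 us)))

∑-∂L-[_] : ∀ {j} t us (φ : List RTerm → ℕ) → ∑ (∂L j (t ∷ []) us) φ ≡ ∑[ t′ ← ∂ j t us ] φ (t′ ∷ [])
∑-∂L-[_] {j} t us φ = trans (∑-∂L-∷ j t [] us φ) (trans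
  (∑-splits2-emptyʳ us (λ (a , b) → ∑[ t′ ← ∂ j t a ] ∑[ ts′ ← ∂L j [] b ] φ (t′ ∷ ts′))
    (λ u l r → ∑-zero (∂ j t l)))
  (∑-cong (∂ j t us) λ t′ → ∑-singleton [] (φ ∘ (t′ ∷_))))

-- As `i < suc j`, the variable itself takes nothing from `us`, and all of it must go to the
-- arguments. This treats variables below `k` and `k` itself together.
∑-∂∂-lower : ∀ {k j i} ts us (φ : RTerm → ℕ) → i ≤ k → k ≤ j →
  (∑ (splits2 us) λ (a , b) → ∑[ s′ ← ∂ (suc j) (rvar i) (rshiftL k a) ] ∑[ ts′ ← ∂L j ts b ] ∑ (∂ k s′ ts′) φ) ≡
  ∑[ ts′ ← ∂L j ts us ] ∑ (∂ k (rvar i) ts′) φ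
∑-∂∂-lower {k} {j} {i} ts us φ i≤k k≤j = trans (∑-splits2-emptyˡ us F nonempty) empty
  where
  i<1+j : i < suc j
  i<1+j = s≤s (ℕ.≤-trans i≤k k≤j)
  F : Split → ℕ
  F (a , b) = ∑[ s′ ← ∂ (suc j) (rvar i) (rshiftL k a) ] ∑[ ts′ ← ∂L j ts b ] ∑ (∂ k s′ ts′) φ
  nonempty : ∀ u l r → F (u ∷ l , r) ≡ 0
  nonempty u l r rewrite ∂-other (rshift k u) (rshiftL k l) (ℕ.<⇒≢ i<1+j) = refl
  empty : F ([] , us) ≡ ∑[ ts′ ← ∂L j ts us ] ∑ (∂ k (rvar i) ts′) φ
  empty rewrite ∂-below i<1+j = ∑-singleton (rvar i) (λ s′ → ∑[ ts′ ← ∂L j ts us ] ∑ (∂ k s′ ts′) φ)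

∑-∂∂-var : ∀ {k j} i ts us (φ : RTerm → ℕ) → k ≤ j →
  ∑[ e ← ∂ k (rvar i) ts ] ∑ (∂ j e us) φ ≡
  ∑ (splits2 us) λ (a , b) → ∑[ s′ ← ∂ (suc j) (rvar i) (rshiftL k a) ] ∑[ ts′ ← ∂L j ts b ] ∑ (∂ k s′ ts′) φ
∑-∂∂-var {k} {j} i ts us φ k≤j with varView k i
∑-∂∂-var {k} {j} i [] [] φ k≤j | below i<k = sym (trans (∑-∂∂-lower [] [] φ (ℕ.<⇒≤ i<k) k≤j)
  (trans (∑-singleton [] (λ ts′ → ∑ (∂ k (rvar i) ts′) φ)) eq))
  where
  eq : ∑ (∂ k (rvar i) []) φ ≡ ∑[ e ← ∂ k (rvar i) [] ] ∑ (∂ j e []) φ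
  eq rewrite ∂-below i<k | ∂-below (ℕ.<-≤-trans i<k k≤j) = sym (∑-singleton (rvar i) (λ x → φ x + 0))
∑-∂∂-var {k} {j} i [] (u ∷ us) φ k≤j | below i<k = sym (trans (∑-∂∂-lower [] (u ∷ us) φ (ℕ.<⇒≤ i<k) k≤j) eq)
  where
  eq : 0 ≡ ∑[ e ← ∂ k (rvar i) [] ] ∑ (∂ j e (u ∷ us)) φ
  eq rewrite ∂-below i<k | ∂-other u us (ℕ.<⇒≢ (ℕ.<-≤-trans i<k k≤j)) = refl
∑-∂∂-var {k} {j} i (t ∷ ts) us φ k≤j | below i<k rewrite ∂-other t ts (ℕ.<⇒≢ i<k) =
  sym (trans (∑-∂∂-lower (t ∷ ts) us φ (ℕ.<⇒≤ i<k) k≤j) (∑-∂L-∷-zero j t ts us _ zero′))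
  where
  zero′ : ∀ t′ ts′ → ∑ (∂ k (rvar i) (t′ ∷ ts′)) φ ≡ 0
  zero′ t′ ts′ rewrite ∂-other t′ ts′ (ℕ.<⇒≢ i<k) = refl
∑-∂∂-var {k} {j} .k [] [] φ k≤j | equal = sym (trans (∑-∂∂-lower [] [] φ ℕ.≤-refl k≤j) eq)
  where
  eq : ∑ (∂ k (rvar k) []) φ + 0 ≡ ∑[ e ← ∂ k (rvar k) [] ] ∑ (∂ j e []) φ
  eq rewrite ∂-equal-[] k = refl
∑-∂∂-var {k} {j} .k [] (u ∷ us) φ k≤j | equal = sym (trans (∑-∂∂-lower [] (u ∷ us) φ ℕ.≤-refl k≤j) eq)
  where
  eq : 0 ≡ ∑[ e ← ∂ k (rvar k) [] ] ∑ (∂ j e (u ∷ us)) φ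
  eq rewrite ∂-equal-[] k = refl
∑-∂∂-var {k} {j} .k (t ∷ []) us φ k≤j | equal rewrite ∂-equal-[_] {k} t =
  sym (trans (∑-∂∂-lower (t ∷ []) us φ ℕ.≤-refl k≤j) (trans (∑-∂L-[ t ] us _)
    (trans (∑-cong (∂ j t us) single) (sym (ℕ.+-identityʳ _)))))
  where
  single : ∀ t′ → ∑ (∂ k (rvar k) (t′ ∷ [])) φ ≡ φ t′
  single t′ rewrite ∂-equal-[_] {k} t′ = ∑-singleton t′ φ
∑-∂∂-var {k} {j} .k (t ∷ t₂ ∷ ts) us φ k≤j | equal rewrite ∂-equal-∷∷ k t t₂ ts =
  sym (trans (∑-∂∂-lower (t ∷ t₂ ∷ ts) us φ ℕ.≤-refl k≤j) (trans (∑-∂L-∷ j t (t₂ ∷ ts) us _)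
    (trans (∑-cong (splits2 us) λ (a , b) → trans
      (∑-cong (∂ j t a) λ t′ → ∑-∂L-∷-zero j t₂ ts b _ (zero′ t′)) (∑-zero (∂ j t a))) (∑-zero (splits2 us)))))
  where
  zero′ : ∀ t′ t″ ts′ → ∑ (∂ k (rvar k) (t′ ∷ t″ ∷ ts′)) φ ≡ 0
  zero′ t′ t″ ts′ rewrite ∂-equal-∷∷ k t′ t″ ts′ = refl
-- Here the variable is `rshift k (rvar i)`, so the substitution for `suc j` yields terms shifted at
-- `k`. On these `∂ k` undoes the shift if `ts` is empty and gives 0 otherwise, exactly as
-- substituting `ts` first does.
∑-∂∂-var {k} {j} (suc i) ts us φ k≤j | above k≤i = trans (eq ts) (sym (∑-cong (splits2 us) λ (a , b) → trans
    (cong (λ xs → ∑[ s′ ← xs ] ∑[ ts′ ← ∂L j ts b ] ∑ (∂ k s′ ts′) φ) (shifted a))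
    (∑-map (rshift k) (∂ j (rvar i) a) _)))
  where
  shifted : ∀ a → ∂ (suc j) (rvar (suc i)) (rshiftL k a) ≡ map (rshift k) (∂ j (rvar i) a)
  shifted a = trans (cong (λ x → ∂ (suc j) x (rshiftL k a)) (sym (rshift-above k≤i))) (∂-rshift (low k≤j) (rvar i) a)
  F : List RTerm → Split → ℕ
  F ts (a , b) = ∑[ s′ ← ∂ j (rvar i) a ] ∑[ ts′ ← ∂L j ts b ] ∑ (∂ k (rshift k s′) ts′) φ
  eq : ∀ ts → ∑[ e ← ∂ k (rvar (suc i)) ts ] ∑ (∂ j e us) φ ≡ ∑ (splits2 us) (F ts)
  eq [] rewrite ∂-above k≤i = trans (ℕ.+-identityʳ _) (sym (trans
    (∑-splits2-emptyʳ us (F []) λ u l r → ∑-zero (∂ j (rvar i) l))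
    (∑-cong (∂ j (rvar i) us) λ s′ → trans (ℕ.+-identityʳ _) (∑-∂-rshift-[] k s′ φ))))
  eq (t ∷ ts) rewrite ∂-other t ts (ℕ.<⇒≢ (s≤s k≤i) ∘ sym) = sym (trans
    (∑-cong (splits2 us) λ (a , b) → trans
      (∑-cong (∂ j (rvar i) a) λ s′ → ∑-∂L-∷-zero j t ts b _ λ t′ ts′ → ∑-∂-rshift-∷ k s′ t′ ts′ φ)
      (∑-zero (∂ j (rvar i) a)))
    (∑-zero (splits2 us)))

mutual
  -- The linear form of M[N/x][P/y] = M[P/y][N[P/y]/x]: each element of `us` goes to an occurrence
  -- either in `s` or in `ts`. As `k ≤ j`, the variable called `j` after the substitution for `k` is
  -- `suc j` before it, and the elements placed into `s` are shifted to make room for `k`.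
  ∑-substitution : ∀ {k j} s ts us (φ : RTerm → ℕ) → k ≤ j →
    ∑[ e ← ∂ k s ts ] ∑ (∂ j e us) φ ≡
    ∑ (splits2 us) λ (a , b) → ∑[ s′ ← ∂ (suc j) s (rshiftL k a) ] ∑[ ts′ ← ∂L j ts b ] ∑ (∂ k s′ ts′) φ
  ∑-substitution (rvar i) ts us φ k≤j = ∑-∂∂-var i ts us φ k≤j
  ∑-substitution {k} {j} (rlam s) ts us φ k≤j = begin
    ∑[ e ← map rlam (∂ (suc k) s (rshiftL 0 ts)) ] ∑ (∂ j e us) φ
      ≡⟨ trans (∑-map rlam (∂ (suc k) s (rshiftL 0 ts)) _)
           (∑-cong (∂ (suc k) s (rshiftL 0 ts)) λ e → ∑-map rlam (∂ (suc j) e (rshiftL 0 us)) φ) ⟩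
    ∑[ e ← ∂ (suc k) s (rshiftL 0 ts) ] ∑ (∂ (suc j) e (rshiftL 0 us)) (φ ∘ rlam)
      ≡⟨ ∑-substitution s (rshiftL 0 ts) (rshiftL 0 us) (φ ∘ rlam) (s≤s k≤j) ⟩
    (∑ (splits2 (rshiftL 0 us)) λ (a , b) → ∑[ s′ ← ∂ (suc (suc j)) s (rshiftL (suc k) a) ]
      ∑[ ts′ ← ∂L (suc j) (rshiftL 0 ts) b ] ∑ (∂ (suc k) s′ ts′) (φ ∘ rlam))
      ≡⟨ ∑-splits2-rshiftL 0 us _ ⟩
    (∑ (splits2 us) λ (a , b) → ∑[ s′ ← ∂ (suc (suc j)) s (rshiftL (suc k) (rshiftL 0 a)) ]
      ∑[ ts′ ← ∂L (suc j) (rshiftL 0 ts) (rshiftL 0 b) ] ∑ (∂ (suc k) s′ ts′) (φ ∘ rlam))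
      ≡⟨ ∑-cong (splits2 us) (λ (a , b) → cong₂
           (λ as xs → ∑[ s′ ← ∂ (suc (suc j)) s as ] ∑[ ts′ ← xs ] ∑ (∂ (suc k) s′ ts′) (φ ∘ rlam))
           (sym (rshiftL-rshiftL a z≤n)) (∂L-rshift (low z≤n) ts b)) ⟩
    (∑ (splits2 us) λ (a , b) → ∑[ s′ ← ∂ (suc (suc j)) s (rshiftL 0 (rshiftL k a)) ]
      ∑[ ts′ ← map (rshiftL 0) (∂L j ts b) ] ∑ (∂ (suc k) s′ ts′) (φ ∘ rlam))
      ≡⟨ ∑-cong (splits2 us) (λ (a , b) → sym (trans (∑-map rlam (∂ (suc (suc j)) s (rshiftL 0 (rshiftL k a))) _)
           (∑-cong (∂ (suc (suc j)) s (rshiftL 0 (rshiftL k a))) λ s′ → trans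
             (∑-cong (∂L j ts b) λ ts′ → ∑-map rlam (∂ (suc k) s′ (rshiftL 0 ts′)) φ)
             (sym (∑-map (rshiftL 0) (∂L j ts b) _))))) ⟩
    _ ∎
  ∑-substitution {k} {j} (rapp s xs) ts us φ k≤j = begin
    ∑[ e ← ∂ k (rapp s xs) ts ] ∑ (∂ j e us) φ
      ≡⟨ trans (∑-∂-rapp k s xs ts _) (∑-cong (splits2 ts) λ (c , d) → ∑-cong (∂ k s c) λ x → ∑-cong (∂L k xs d) λ y →
           ∑-∂-rapp j x y us φ) ⟩
    _
      ≡⟨ ∑-substitution-pair j (∂ k s) (λ a → ∂ (suc j) s (rshiftL k a)) (∂ j) (∂ k)
           (∂L k xs) (λ a → ∂L (suc j) xs (rshiftL k a)) (∂L j) (∂L k)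
           (λ ts us φ → ∑-substitution s ts us φ k≤j)
           (λ ts us φ → ∑-substitutionL xs ts us φ k≤j)
           ts us (λ x y → φ (rapp x y)) ⟩
    _
      ≡⟨ ∑-cong (splits2 us) (λ (a , b) → sym (trans (∑-∂-rapp (suc j) s xs (rshiftL k a) _)
           (trans (∑-splits2-rshiftL k a _) (∑-cong (splits2 a) λ (a₁ , b₁) →
             ∑-cong (∂ (suc j) s (rshiftL k a₁)) λ s′ → ∑-cong (∂L (suc j) xs (rshiftL k b₁)) λ xs′ →
             ∑-cong (∂L j ts b) λ ts′ → ∑-∂-rapp k s′ xs′ ts′ φ)))) ⟩
    _ ∎
  ∑-substitution {k} {j} (s ⊕•) ts us φ k≤j = trans (∑-map _⊕• (∂ k s ts) _)
    (trans (∑-cong (∂ k s ts) λ e → ∑-map _⊕• (∂ j e us) φ)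
    (trans (∑-substitution s ts us (φ ∘ _⊕•) k≤j)
    (∑-cong (splits2 us) λ (a , b) → sym (trans (∑-map _⊕• (∂ (suc j) s (rshiftL k a)) _)
      (∑-cong (∂ (suc j) s (rshiftL k a)) λ s′ → ∑-cong (∂L j ts b) λ ts′ → ∑-map _⊕• (∂ k s′ ts′) φ)))))
  ∑-substitution {k} {j} (•⊕ s) ts us φ k≤j = trans (∑-map •⊕_ (∂ k s ts) _)
    (trans (∑-cong (∂ k s ts) λ e → ∑-map •⊕_ (∂ j e us) φ)
    (trans (∑-substitution s ts us (φ ∘ •⊕_) k≤j)
    (∑-cong (splits2 us) λ (a , b) → sym (trans (∑-map •⊕_ (∂ (suc j) s (rshiftL k a)) _)
      (∑-cong (∂ (suc j) s (rshiftL k a)) λ s′ → ∑-cong (∂L j ts b) λ ts′ → ∑-map •⊕_ (∂ k s′ ts′) φ)))))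

  ∑-substitutionL : ∀ {k j} xs ts us (φ : List RTerm → ℕ) → k ≤ j →
    ∑[ e ← ∂L k xs ts ] ∑ (∂L j e us) φ ≡
    ∑ (splits2 us) λ (a , b) → ∑[ xs′ ← ∂L (suc j) xs (rshiftL k a) ] ∑[ ts′ ← ∂L j ts b ] ∑ (∂L k xs′ ts′) φ
  ∑-substitutionL {k} {j} [] ts us φ k≤j = trans (eq ts) (sym (trans (∑-splits2-emptyˡ us F λ _ _ _ → refl)
      (ℕ.+-identityʳ _)))
    where
    F : Split → ℕ
    F (a , b) = ∑[ xs′ ← ∂L (suc j) [] (rshiftL k a) ] ∑[ ts′ ← ∂L j ts b ] ∑ (∂L k xs′ ts′) φ
    ∂L-[] : ∀ us → ∑[ ts′ ← ∂L j [] us ] ∑ (∂L k [] ts′) φ ≡ ∑ (∂L j [] us) φ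
    ∂L-[] [] = ℕ.+-identityʳ _
    ∂L-[] (u ∷ us) = refl
    eq : ∀ ts → ∑[ e ← ∂L k [] ts ] ∑ (∂L j e us) φ ≡ ∑[ ts′ ← ∂L j ts us ] ∑ (∂L k [] ts′) φ
    eq [] = trans (ℕ.+-identityʳ _) (sym (∂L-[] us))
    eq (t ∷ ts) = sym (∑-∂L-∷-zero j t ts us _ λ _ _ → refl)
  ∑-substitutionL {k} {j} (s ∷ xs) ts us φ k≤j = begin
    ∑[ e ← ∂L k (s ∷ xs) ts ] ∑ (∂L j e us) φ
      ≡⟨ trans (∑-∂L-∷ k s xs ts _) (∑-cong (splits2 ts) λ (c , d) → ∑-cong (∂ k s c) λ x → ∑-cong (∂L k xs d) λ y →
           ∑-∂L-∷ j x y us φ) ⟩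
    _
      ≡⟨ ∑-substitution-pair j (∂ k s) (λ a → ∂ (suc j) s (rshiftL k a)) (∂ j) (∂ k)
           (∂L k xs) (λ a → ∂L (suc j) xs (rshiftL k a)) (∂L j) (∂L k)
           (λ ts us φ → ∑-substitution s ts us φ k≤j)
           (λ ts us φ → ∑-substitutionL xs ts us φ k≤j)
           ts us (λ x y → φ (x ∷ y)) ⟩
    _
      ≡⟨ ∑-cong (splits2 us) (λ (a , b) → sym (trans (∑-∂L-∷ (suc j) s xs (rshiftL k a) _)
           (trans (∑-splits2-rshiftL k a _) (∑-cong (splits2 a) λ (a₁ , b₁) →
             ∑-cong (∂ (suc j) s (rshiftL k a₁)) λ s′ → ∑-cong (∂L (suc j) xs (rshiftL k b₁)) λ xs′ →
             ∑-cong (∂L j ts b) λ ts′ → ∑-∂L-∷ k s′ xs′ ts′ φ)))) ⟩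
    _ ∎

-- Reduction

mutual
  -- The relation `_→∂_` again, but a step inside a monomial is located by `here` and `there`. Two
  -- steps in one monomial can then be compared by induction instead of through two decompositions
  -- `ts₁ ++ t ∷ ts₂`.
  data _⇒_ : RTerm → List RTerm → Set where
    β     : ∀ {s ts} → rapp (rlam s) ts ⇒ ∂ 0 s ts
    app⊕• : ∀ {s ts} → rapp (s ⊕•) ts ⇒ ((rapp s ts ⊕•) ∷ [])
    app•⊕ : ∀ {s ts} → rapp (•⊕ s) ts ⇒ ((•⊕ rapp s ts) ∷ [])
    lam⊕• : ∀ {s} → rlam (s ⊕•) ⇒ ((rlam s ⊕•) ∷ [])
    lam•⊕ : ∀ {s} → rlam (•⊕ s) ⇒ ((•⊕ rlam s) ∷ [])
    lam   : ∀ {s E} → s ⇒ E → rlam s ⇒ map rlam E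
    left  : ∀ {s E} → s ⇒ E → (s ⊕•) ⇒ map _⊕• E
    right : ∀ {s E} → s ⇒ E → (•⊕ s) ⇒ map •⊕_ E
    fun   : ∀ {s ts E} → s ⇒ E → rapp s ts ⇒ map (λ s′ → rapp s′ ts) E
    arg   : ∀ {s ts Es} → ts ⇒ᴸ Es → rapp s ts ⇒ map (rapp s) Es

  data _⇒ᴸ_ : List RTerm → List (List RTerm) → Set where
    here  : ∀ {t ts E} → t ⇒ E → (t ∷ ts) ⇒ᴸ map (_∷ ts) E
    there : ∀ {t ts Es} → ts ⇒ᴸ Es → (t ∷ ts) ⇒ᴸ map (t ∷_) Es

infix 4 _⇒_ _⇒ᴸ_

toᴸ : ∀ {t E} ts₁ ts₂ → t ⇒ E → ts₁ ++ t ∷ ts₂ ⇒ᴸ map (λ t′ → ts₁ ++ t′ ∷ ts₂) E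
toᴸ [] ts₂ r = here r
toᴸ {E = E} (x ∷ ts₁) ts₂ r = ≡.subst (_ ⇒ᴸ_) (sym (List.map-∘ E)) (there (toᴸ ts₁ ts₂ r))

to⇒ : ∀ {s E} → s →∂ E → s ⇒ E
to⇒ (β s ts) = β
to⇒ (app⊕• s ts) = app⊕•
to⇒ (app•⊕ s ts) = app•⊕
to⇒ (lam⊕• s) = lam⊕•
to⇒ (lam•⊕ s) = lam•⊕
to⇒ (ctx-lam r) = lam (to⇒ r)
to⇒ (ctx-⊕• r) = left (to⇒ r)
to⇒ (ctx-•⊕ r) = right (to⇒ r)
to⇒ (ctx-fun ts r) = fun (to⇒ r)
to⇒ (ctx-arg {E = E} s ts₁ ts₂ r) = ≡.subst (_ ⇒_) (sym (List.map-∘ E)) (arg (toᴸ ts₁ ts₂ (to⇒ r)))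

mutual
  from⇒ : ∀ {s E} → s ⇒ E → s →∂ E
  from⇒ β = β _ _
  from⇒ app⊕• = app⊕• _ _
  from⇒ app•⊕ = app•⊕ _ _
  from⇒ lam⊕• = lam⊕• _
  from⇒ lam•⊕ = lam•⊕ _
  from⇒ (lam r) = ctx-lam (from⇒ r)
  from⇒ (left r) = ctx-⊕• (from⇒ r)
  from⇒ (right r) = ctx-•⊕ (from⇒ r)
  from⇒ (fun r) = ctx-fun _ (from⇒ r)
  from⇒ (arg r) with fromᴸ r
  ... | ts₁ , t , ts₂ , E , r′ , refl , refl = ≡.subst (_ →∂_) (List.map-∘ E) (ctx-arg _ ts₁ ts₂ r′)

  fromᴸ : ∀ {ts Es} → ts ⇒ᴸ Es → ∃ λ ts₁ → ∃ λ t → ∃ λ ts₂ → ∃ λ E →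
    t →∂ E × ts ≡ ts₁ ++ t ∷ ts₂ × Es ≡ map (λ t′ → ts₁ ++ t′ ∷ ts₂) E
  fromᴸ (here r) = [] , _ , _ , _ , from⇒ r , refl , refl
  fromᴸ (there {t} r) with fromᴸ r
  ... | ts₁ , t′ , ts₂ , E , r′ , refl , refl = t ∷ ts₁ , t′ , ts₂ , E , r′ , refl , sym (List.map-∘ E)

mutual
  ⇒-rshift : ∀ {s E} c → s ⇒ E → rshift c s ⇒ map (rshift c) E
  ⇒-rshift c (β {s} {ts}) = ≡.subst (rshift c (rapp (rlam s) ts) ⇒_) (∂-rshift (high z≤n) s ts) β
  ⇒-rshift c app⊕• = app⊕•
  ⇒-rshift c app•⊕ = app•⊕
  ⇒-rshift c lam⊕• = lam⊕•
  ⇒-rshift c lam•⊕ = lam•⊕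
  ⇒-rshift c (lam {E = E} r) = ≡.subst (_ ⇒_) (map-square (λ _ → refl) E) (lam (⇒-rshift (suc c) r))
  ⇒-rshift c (left {E = E} r) = ≡.subst (_ ⇒_) (map-square (λ _ → refl) E) (left (⇒-rshift c r))
  ⇒-rshift c (right {E = E} r) = ≡.subst (_ ⇒_) (map-square (λ _ → refl) E) (right (⇒-rshift c r))
  ⇒-rshift c (fun {E = E} r) = ≡.subst (_ ⇒_) (map-square (λ _ → refl) E) (fun (⇒-rshift c r))
  ⇒-rshift c (arg {Es = Es} r) = ≡.subst (_ ⇒_) (map-square (λ _ → refl) Es) (arg (⇒ᴸ-rshift c r))

  ⇒ᴸ-rshift : ∀ {ts Es} c → ts ⇒ᴸ Es → rshiftL c ts ⇒ᴸ map (rshiftL c) Es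
  ⇒ᴸ-rshift c (here {E = E} r) = ≡.subst (_ ⇒ᴸ_) (map-square (λ _ → refl) E) (here (⇒-rshift c r))
  ⇒ᴸ-rshift c (there {Es = Es} r) = ≡.subst (_ ⇒ᴸ_) (map-square (λ _ → refl) Es) (there (⇒ᴸ-rshift c r))

-- Additive functionals

Inv : (A → List A → Set) → (A → ℕ) → A → Set
Inv R ψ x = ∀ E → R x E → ψ x ≡ ∑ E ψ

-- ψ is additive along every reduction starting from x.
data Good (R : A → List A → Set) (ψ : A → ℕ) (x : A) : Set where
  good : Inv R ψ x → (∀ {E} → R x E → All (Good R ψ) E) → Good R ψ x

-- The hypothesis under which local confluence is proved: in the induction of Newman's lemma,
-- additivity is known from the proper reducts of `x` onwards but not yet at `x`.
GoodReducts : (A → List A → Set) → (A → ℕ) → A → Set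
GoodReducts R ψ x = ∀ {E} → R x E → All (Good R ψ) E

module _ {R : A → List A → Set} where

  Good⇒Inv : ∀ {ψ x} → Good R ψ x → Inv R ψ x
  Good⇒Inv (good i _) = i

  Good⇒GoodReducts : ∀ {ψ x} → Good R ψ x → GoodReducts R ψ x
  Good⇒GoodReducts (good _ g) = g

  Inv-∑ : ∀ {Ψ : A → B → ℕ} {x ys} → All (λ y → Inv R (λ x → Ψ x y) x) ys → Inv R (λ x → ∑[ y ← ys ] Ψ x y) x
  Inv-∑ {Ψ = Ψ} {ys = ys} is E r = trans (∑-congᴬ is λ y i → i E r) (∑-swap ys E _)

-- A one-hole context whose hole and result may each be a term or a monomial. Additivity of ψ at
-- `C x` is additivity of `ψ ∘ C` at `x`, so a congruence case of an induction over all ψ is the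
-- induction hypothesis for `ψ ∘ C`.
record Context (R : A → List A → Set) (R′ : B → List B → Set) (C : A → B) : Set where
  constructor context
  field C-cong : ∀ {x E} → R x E → R′ (C x) (map C E)

  Inv-context : ∀ {ψ x} → Inv R′ ψ (C x) → Inv R (ψ ∘ C) x
  Inv-context {ψ} i E r = trans (i _ (C-cong r)) (∑-map C E ψ)

  mutual
    Good-context : ∀ {ψ x} → Good R′ ψ (C x) → Good R (ψ ∘ C) x
    Good-context (good i g) = good (Inv-context i) λ r → All-Good-context _ (g (C-cong r))

    All-Good-context : ∀ {ψ} E → All (Good R′ ψ) (map C E) → All (Good R (ψ ∘ C)) E
    All-Good-context [] [] = []
    All-Good-context (e ∷ E) (g ∷ gs) = Good-context g ∷ All-Good-context E gs

  GoodReducts-context : ∀ {ψ x} → GoodReducts R′ ψ (C x) → GoodReducts R (ψ ∘ C) x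
  GoodReducts-context g r = All-Good-context _ (g (C-cong r))

open Context

-- What `_⊕•` and `•⊕_` have in common; the diagrams involving a marker are closed once for both.
record Marker (c : RTerm → RTerm) : Set where
  field
    ∂-marker    : ∀ j s us → ∂ j (c s) us ≡ map c (∂ j s us)
    app-marker  : ∀ {s ts} → rapp (c s) ts ⇒ (c (rapp s ts) ∷ [])
    lam-marker  : ∀ {s} → rlam (c s) ⇒ (c (rlam s) ∷ [])
    cong-marker : ∀ {s E} → s ⇒ E → c s ⇒ map c E

⊕•-marker : Marker _⊕•
⊕•-marker = record { ∂-marker = λ _ _ _ → refl ; app-marker = app⊕• ; lam-marker = lam⊕• ; cong-marker = left }

•⊕-marker : Marker •⊕_
•⊕-marker = record { ∂-marker = λ _ _ _ → refl ; app-marker = app•⊕ ; lam-marker = lam•⊕ ; cong-marker = right }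

rlam-context : Context _⇒_ _⇒_ rlam
rlam-context = context lam

⊕•-context : Context _⇒_ _⇒_ _⊕•
⊕•-context = context left

•⊕-context : Context _⇒_ _⇒_ •⊕_
•⊕-context = context right

fun-context : ∀ ts → Context _⇒_ _⇒_ (λ s → rapp s ts)
fun-context ts = context fun

arg-context : ∀ s → Context _⇒ᴸ_ _⇒_ (rapp s)
arg-context s = context arg

here-context : ∀ ts → Context _⇒_ _⇒ᴸ_ (_∷ ts)
here-context ts = context here

there-context : ∀ t → Context _⇒ᴸ_ _⇒ᴸ_ (t ∷_)
there-context t = context there

-- Whether a variable accepts a list of arguments depends on the length of the list only, so a step
-- inside the list cannot change it.
⇒ᴸ-length : ∀ {ts Es} → ts ⇒ᴸ Es → All (λ ts′ → length ts′ ≡ length ts) Es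
⇒ᴸ-length (here {E = E} r) = All.map⁺ (All.universal (λ _ → refl) E)
⇒ᴸ-length (there r) = All.map⁺ (All.map (cong suc) (⇒ᴸ-length r))

-- In every split the reduced element lies in exactly one half, so separate additivity in each half
-- suffices.
∑-splits2-⇒ᴸ : ∀ {us Us} (F : Split → ℕ) →
  All (λ (a , b) → Inv _⇒ᴸ_ (λ a → F (a , b)) a × Inv _⇒ᴸ_ (λ b → F (a , b)) b) (splits2 us) → us ⇒ᴸ Us →
  ∑ (splits2 us) F ≡ ∑[ us′ ← Us ] ∑ (splits2 us′) F
∑-splits2-⇒ᴸ F is (here {t} {ts} {E} r) = begin
  ∑ (splits2 (t ∷ ts)) F
    ≡⟨ ∑-splits2-∷ t ts F ⟩
  (∑ (splits2 ts) λ (l , r) → F (t ∷ l , r) + F (l , t ∷ r))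
    ≡⟨ ∑-congᴬ (All-splits2-∷⁻ t ts is) (λ (l , r′) ((i , _) , (_ , j)) → trans
         (cong₂ _+_ (trans (i _ (here r)) (∑-map (_∷ l) E _)) (trans (j _ (here r)) (∑-map (_∷ r′) E _)))
         (sym (∑-+ E _ _))) ⟩
  (∑ (splits2 ts) λ (l , r) → ∑[ t′ ← E ] (F (t′ ∷ l , r) + F (l , t′ ∷ r)))
    ≡⟨ ∑-swap (splits2 ts) E _ ⟩
  (∑[ t′ ← E ] ∑ (splits2 ts) λ (l , r) → F (t′ ∷ l , r) + F (l , t′ ∷ r))
    ≡⟨ sym (trans (∑-map (_∷ ts) E _) (∑-cong E λ t′ → ∑-splits2-∷ t′ ts F)) ⟩
  (∑[ us′ ← map (_∷ ts) E ] ∑ (splits2 us′) F) ∎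
∑-splits2-⇒ᴸ F is (there {t} {ts} {Es} r) = begin
  ∑ (splits2 (t ∷ ts)) F
    ≡⟨ ∑-splits2-∷ t ts F ⟩
  (∑ (splits2 ts) λ (l , r) → F (t ∷ l , r) + F (l , t ∷ r))
    ≡⟨ ∑-splits2-⇒ᴸ (λ (l , r) → F (t ∷ l , r) + F (l , t ∷ r))
         (All.map (λ {(l , r)} ((i₁ , i₂) , (j₁ , j₂)) →
             (λ E r → trans (cong₂ _+_ (trans (i₁ _ (there r)) (∑-map (t ∷_) E _)) (j₁ E r)) (sym (∑-+ E _ _))) ,
             (λ E r → trans (cong₂ _+_ (i₂ E r) (trans (j₂ _ (there r)) (∑-map (t ∷_) E _))) (sym (∑-+ E _ _))))
           (All-splits2-∷⁻ t ts is)) r ⟩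
  (∑[ us′ ← Es ] ∑ (splits2 us′) λ (l , r) → F (t ∷ l , r) + F (l , t ∷ r))
    ≡⟨ sym (trans (∑-map (t ∷_) Es _) (∑-cong Es λ us′ → ∑-splits2-∷ t us′ F)) ⟩
  (∑[ us′ ← map (t ∷_) Es ] ∑ (splits2 us′) F) ∎

∑-∂-other : ∀ {i j} us (φ : RTerm → ℕ) → i ≢ j → length us ≢ 0 → ∑ (∂ j (rvar i) us) φ ≡ 0
∑-∂-other [] φ i≢j ≢0 = contradiction refl ≢0
∑-∂-other (u ∷ us) φ i≢j ≢0 rewrite ∂-other u us i≢j = refl

∑-∂-equal : ∀ {j} us (φ : RTerm → ℕ) → length us ≢ 1 → ∑ (∂ j (rvar j) us) φ ≡ 0
∑-∂-equal {j} [] φ ≢1 rewrite ∂-equal-[] j = refl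
∑-∂-equal (u ∷ []) φ ≢1 = contradiction refl ≢1
∑-∂-equal {j} (u ∷ v ∷ us) φ ≢1 rewrite ∂-equal-∷∷ j u v us = refl

∑-combine-⇒ᴸ : ∀ {R : A → List A → Set} {S : B → List B → Set} (f : List RTerm → List A) (g : List RTerm → List B) →
  (∀ {us Us} ψ → All (Inv R ψ) (f us) → us ⇒ᴸ Us → ∑ (f us) ψ ≡ ∑[ us′ ← Us ] ∑ (f us′) ψ) →
  (∀ {us Us} ψ → All (Inv S ψ) (g us) → us ⇒ᴸ Us → ∑ (g us) ψ ≡ ∑[ us′ ← Us ] ∑ (g us′) ψ) →
  ∀ {us Us} (ψ : A → B → ℕ) →
  All (λ (a , b) → All (λ x → All (λ y → Inv R (λ x → ψ x y) x × Inv S (ψ x) y) (g b)) (f a)) (splits2 us) →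
  us ⇒ᴸ Us →
  (∑ (splits2 us) λ (a , b) → ∑[ x ← f a ] ∑[ y ← g b ] ψ x y) ≡
  (∑[ us′ ← Us ] ∑ (splits2 us′) λ (a , b) → ∑[ x ← f a ] ∑[ y ← g b ] ψ x y)
∑-combine-⇒ᴸ {R = R} f g f-red g-red ψ is = ∑-splits2-⇒ᴸ (λ (a , b) → ∑[ x ← f a ] ∑[ y ← g b ] ψ x y)
  (All.map (λ {(a , b)} js →
     (λ E r → f-red _ (All.map (λ ks → Inv-∑ {R = R} {Ψ = ψ} (All.map proj₁ ks)) js) r) ,
     (λ E r → trans (∑-congᴬ js λ x ks → g-red (ψ x) (All.map proj₂ ks) r) (∑-swap (f a) E _))) is)

mutual
  -- Substitution is linear: each summand contains each element of `us` exactly once, so a step in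
  -- `us` is a single step in every summand.
  ∑-∂-⇒ᴸ : ∀ {j us Us} s ψ → All (Inv _⇒_ ψ) (∂ j s us) → us ⇒ᴸ Us →
    ∑ (∂ j s us) ψ ≡ ∑[ us′ ← Us ] ∑ (∂ j s us′) ψ
  ∑-∂-⇒ᴸ {j} {us} {Us} (rvar i) ψ is r with i ℕ.≟ j
  ∑-∂-⇒ᴸ {j} {us} {Us} (rvar i) ψ is r | no i≢j = trans (∑-∂-other us ψ i≢j (nonempty r)) (sym (trans
    (∑-congᴬ (⇒ᴸ-length r) λ us′ eq → ∑-∂-other us′ ψ i≢j (nonempty r ∘ trans (sym eq))) (∑-zero Us)))
    where
    nonempty : ∀ {us Us} → us ⇒ᴸ Us → length us ≢ 0
    nonempty (here _) ()
    nonempty (there _) ()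
  ∑-∂-⇒ᴸ {j} {t ∷ []} (rvar .j) ψ is (here {E = E} r) | yes refl rewrite ∂-equal-[_] {j} t with is
  ... | i ∷ [] = trans (ℕ.+-identityʳ _) (trans (i _ r) (sym (trans (∑-map (_∷ []) E _) (∑-cong E single))))
    where
    single : ∀ t′ → ∑ (∂ j (rvar j) (t′ ∷ [])) ψ ≡ ψ t′
    single t′ rewrite ∂-equal-[_] {j} t′ = ∑-singleton t′ ψ
  ∑-∂-⇒ᴸ {j} {t ∷ []} (rvar .j) ψ is (there ()) | yes refl
  ∑-∂-⇒ᴸ {j} {us@(_ ∷ _ ∷ _)} {Us} (rvar .j) ψ is r | yes refl = trans (∑-∂-equal {j} us ψ λ ()) (sym (trans
    (∑-congᴬ (⇒ᴸ-length r) λ us′ eq → ∑-∂-equal {j} us′ ψ λ eq′ → 2+n≢1 (trans (sym eq) eq′)) (∑-zero Us)))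
    where
    2+n≢1 : ∀ {n} → suc (suc n) ≢ 1
    2+n≢1 ()
  ∑-∂-⇒ᴸ {j} {us} {Us} (rlam s) ψ is r = begin
    ∑ (map rlam (∂ (suc j) s (rshiftL 0 us))) ψ
      ≡⟨ ∑-map rlam (∂ (suc j) s (rshiftL 0 us)) ψ ⟩
    ∑ (∂ (suc j) s (rshiftL 0 us)) (ψ ∘ rlam)
      ≡⟨ ∑-∂-⇒ᴸ s (ψ ∘ rlam) (All.map (Inv-context rlam-context) (All.map⁻ is)) (⇒ᴸ-rshift 0 r) ⟩
    ∑[ us′ ← map (rshiftL 0) Us ] ∑ (∂ (suc j) s us′) (ψ ∘ rlam)
      ≡⟨ ∑-map (rshiftL 0) Us _ ⟩
    ∑[ us′ ← Us ] ∑ (∂ (suc j) s (rshiftL 0 us′)) (ψ ∘ rlam)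
      ≡⟨ ∑-cong Us (λ us′ → sym (∑-map rlam (∂ (suc j) s (rshiftL 0 us′)) ψ)) ⟩
    ∑[ us′ ← Us ] ∑ (∂ j (rlam s) us′) ψ ∎
  ∑-∂-⇒ᴸ {j} {us} {Us} (rapp s ts) ψ is r = trans (∑-∂-rapp j s ts us ψ) (trans
    (∑-combine-⇒ᴸ {R = _⇒_} {_⇒ᴸ_} (∂ j s) (∂L j ts) (∑-∂-⇒ᴸ s) (∑-∂L-⇒ᴸ ts) (λ x y → ψ (rapp x y))
      (All.map (All.map (All.map (λ {y} i → Inv-context (fun-context y) i , Inv-context (arg-context _) i))) (All-combine⁻ rapp (∂ j s) (∂L j ts) us is)) r)
    (∑-cong Us λ us′ → sym (∑-∂-rapp j s ts us′ ψ)))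
  ∑-∂-⇒ᴸ {j} {us} {Us} (s ⊕•) ψ is r = trans (∑-map _⊕• (∂ j s us) ψ)
    (trans (∑-∂-⇒ᴸ s (ψ ∘ _⊕•) (All.map (Inv-context ⊕•-context) (All.map⁻ is)) r)
      (∑-cong Us λ us′ → sym (∑-map _⊕• (∂ j s us′) ψ)))
  ∑-∂-⇒ᴸ {j} {us} {Us} (•⊕ s) ψ is r = trans (∑-map •⊕_ (∂ j s us) ψ)
    (trans (∑-∂-⇒ᴸ s (ψ ∘ •⊕_) (All.map (Inv-context •⊕-context) (All.map⁻ is)) r)
      (∑-cong Us λ us′ → sym (∑-map •⊕_ (∂ j s us′) ψ)))

  ∑-∂L-⇒ᴸ : ∀ {j us Us} ts ψ → All (Inv _⇒ᴸ_ ψ) (∂L j ts us) → us ⇒ᴸ Us →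
    ∑ (∂L j ts us) ψ ≡ ∑[ us′ ← Us ] ∑ (∂L j ts us′) ψ
  ∑-∂L-⇒ᴸ [] ψ is (here {E = E} r) = sym (trans (∑-map (_∷ _) E _) (∑-zero E))
  ∑-∂L-⇒ᴸ [] ψ is (there {Es = Es} r) = sym (trans (∑-map (_ ∷_) Es _) (∑-zero Es))
  ∑-∂L-⇒ᴸ {j} {us} {Us} (t ∷ ts) ψ is r = trans (∑-∂L-∷ j t ts us ψ) (trans
    (∑-combine-⇒ᴸ {R = _⇒_} {_⇒ᴸ_} (∂ j t) (∂L j ts) (∑-∂-⇒ᴸ t) (∑-∂L-⇒ᴸ ts) (λ x y → ψ (x ∷ y))
      (All.map (All.map (All.map (λ {y} i → Inv-context (here-context y) i , Inv-context (there-context _) i))) (All-combine⁻ _∷_ (∂ j t) (∂L j ts) us is)) r)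
    (∑-cong Us λ us′ → sym (∑-∂L-∷ j t ts us′ ψ)))

Inv-unary : ∀ {ψ x y} → Inv _⇒_ ψ x → x ⇒ (y ∷ []) → ψ x ≡ ψ y
Inv-unary i r = trans (i _ r) (ℕ.+-identityʳ _)

module _ {c : RTerm → RTerm} (m : Marker c) where
  open Marker m

  ∑-∂-app-marker : ∀ j s ts us ψ → All (Inv _⇒_ ψ) (∂ j (rapp (c s) ts) us) →
    ∑ (∂ j (rapp (c s) ts) us) ψ ≡ ∑ (∂ j (c (rapp s ts)) us) ψ
  ∑-∂-app-marker j s ts us ψ is = begin
    ∑ (∂ j (rapp (c s) ts) us) ψ
      ≡⟨ ∑-∂-rapp j (c s) ts us ψ ⟩
    (∑ (splits2 us) λ (a , b) → ∑[ x ← ∂ j (c s) a ] ∑[ y ← ∂L j ts b ] ψ (rapp x y))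
      ≡⟨ ∑-congᴬ (All-combine⁻ rapp (∂ j (c s)) (∂L j ts) us is) (λ (a , b) js →
           trans (cong (λ xs → ∑[ x ← xs ] ∑[ y ← ∂L j ts b ] ψ (rapp x y)) (∂-marker j s a)) (trans (∑-map c (∂ j s a) _)
             (∑-congᴬ (All.map⁻ (≡.subst (All _) (∂-marker j s a) js)) λ x ks → ∑-congᴬ ks λ y i → Inv-unary i app-marker))) ⟩
    (∑ (splits2 us) λ (a , b) → ∑[ x ← ∂ j s a ] ∑[ y ← ∂L j ts b ] ψ (c (rapp x y)))
      ≡⟨ sym (trans (cong (λ xs → ∑ xs ψ) (∂-marker j (rapp s ts) us))
           (trans (∑-map c (∂ j (rapp s ts) us) ψ) (∑-∂-rapp j s ts us (ψ ∘ c)))) ⟩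
    ∑ (∂ j (c (rapp s ts)) us) ψ ∎

  ∑-∂-lam-marker : ∀ j s us ψ → All (Inv _⇒_ ψ) (∂ j (rlam (c s)) us) →
    ∑ (∂ j (rlam (c s)) us) ψ ≡ ∑ (∂ j (c (rlam s)) us) ψ
  ∑-∂-lam-marker j s us ψ is rewrite ∂-marker (suc j) s (rshiftL 0 us) | ∂-marker j (rlam s) us = begin
    ∑ (map rlam (map c xs)) ψ
      ≡⟨ trans (∑-map rlam (map c xs) ψ) (∑-map c xs _) ⟩
    ∑[ x ← xs ] ψ (rlam (c x))
      ≡⟨ ∑-congᴬ (All.map⁻ (All.map⁻ is)) (λ x i → Inv-unary i lam-marker) ⟩
    ∑[ x ← xs ] ψ (c (rlam x))
      ≡⟨ sym (trans (∑-map c (map rlam xs) ψ) (∑-map rlam xs _)) ⟩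
    ∑ (map c (map rlam xs)) ψ ∎
    where
    xs = ∂ (suc j) s (rshiftL 0 us)

mutual
  -- A redex of `s` survives, neither copied nor erased, in every summand of `∂ j s us`, and
  -- contracting it there agrees with contracting it beforehand. For a β-redex this agreement is the
  -- substitution lemma with `k = 0`.
  ∑-∂-⇒ : ∀ {s E j} us ψ → s ⇒ E → All (Inv _⇒_ ψ) (∂ j s us) → ∑ (∂ j s us) ψ ≡ ∑[ s′ ← E ] ∑ (∂ j s′ us) ψ
  ∑-∂-⇒ {j = j} us ψ (β {s} {ts}) is = begin
    ∑ (∂ j (rapp (rlam s) ts) us) ψ
      ≡⟨ ∑-∂-rapp j (rlam s) ts us ψ ⟩
    (∑ (splits2 us) λ (a , b) → ∑[ x ← map rlam (∂ (suc j) s (rshiftL 0 a)) ] ∑[ y ← ∂L j ts b ] ψ (rapp x y))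
      ≡⟨ ∑-congᴬ (All-combine⁻ rapp (∂ j (rlam s)) (∂L j ts) us is) (λ (a , b) js →
           trans (∑-map rlam (∂ (suc j) s (rshiftL 0 a)) _)
             (∑-congᴬ (All.map⁻ js) λ x ks → ∑-congᴬ ks λ y i → i _ β)) ⟩
    (∑ (splits2 us) λ (a , b) → ∑[ x ← ∂ (suc j) s (rshiftL 0 a) ] ∑[ y ← ∂L j ts b ] ∑ (∂ 0 x y) ψ)
      ≡⟨ sym (∑-substitution s ts us ψ z≤n) ⟩
    ∑[ s′ ← ∂ 0 s ts ] ∑ (∂ j s′ us) ψ ∎
  ∑-∂-⇒ {j = j} us ψ (app⊕• {s} {ts}) is = trans (∑-∂-app-marker ⊕•-marker j s ts us ψ is) (sym (ℕ.+-identityʳ _))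
  ∑-∂-⇒ {j = j} us ψ (app•⊕ {s} {ts}) is = trans (∑-∂-app-marker •⊕-marker j s ts us ψ is) (sym (ℕ.+-identityʳ _))
  ∑-∂-⇒ {j = j} us ψ (lam⊕• {s}) is = trans (∑-∂-lam-marker ⊕•-marker j s us ψ is) (sym (ℕ.+-identityʳ _))
  ∑-∂-⇒ {j = j} us ψ (lam•⊕ {s}) is = trans (∑-∂-lam-marker •⊕-marker j s us ψ is) (sym (ℕ.+-identityʳ _))
  ∑-∂-⇒ {j = j} us ψ (lam {s} {E} r) is = trans (∑-map rlam (∂ (suc j) s (rshiftL 0 us)) ψ)
    (trans (∑-∂-⇒ (rshiftL 0 us) (ψ ∘ rlam) r (All.map (Inv-context rlam-context) (All.map⁻ is)))
      (sym (trans (∑-map rlam E _) (∑-cong E λ s′ → ∑-map rlam (∂ (suc j) s′ (rshiftL 0 us)) ψ))))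
  ∑-∂-⇒ {j = j} us ψ (left {s} {E} r) is = trans (∑-map _⊕• (∂ j s us) ψ)
    (trans (∑-∂-⇒ us (ψ ∘ _⊕•) r (All.map (Inv-context ⊕•-context) (All.map⁻ is)))
      (sym (trans (∑-map _⊕• E _) (∑-cong E λ s′ → ∑-map _⊕• (∂ j s′ us) ψ))))
  ∑-∂-⇒ {j = j} us ψ (right {s} {E} r) is = trans (∑-map •⊕_ (∂ j s us) ψ)
    (trans (∑-∂-⇒ us (ψ ∘ •⊕_) r (All.map (Inv-context •⊕-context) (All.map⁻ is)))
      (sym (trans (∑-map •⊕_ E _) (∑-cong E λ s′ → ∑-map •⊕_ (∂ j s′ us) ψ))))
  ∑-∂-⇒ {j = j} us ψ (fun {s} {ts} {E} r) is = trans (∑-∂-rapp j s ts us ψ) (trans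
    (∑-congᴬ (All-combine⁻ rapp (∂ j s) (∂L j ts) us is) λ (a , b) js →
      ∑-∂-⇒ a _ r (All.map (λ ks → Inv-∑ {R = _⇒_} (All.map (λ {y} → Inv-context (fun-context y)) ks)) js))
    (trans (∑-swap (splits2 us) E _) (sym (trans (∑-map (λ s′ → rapp s′ ts) E _)
      (∑-cong E λ s′ → ∑-∂-rapp j s′ ts us ψ)))))
  ∑-∂-⇒ {j = j} us ψ (arg {s} {ts} {Es} r) is = trans (∑-∂-rapp j s ts us ψ) (trans
    (∑-congᴬ (All-combine⁻ rapp (∂ j s) (∂L j ts) us is) λ (a , b) js → trans
      (∑-congᴬ js λ x ks → ∑-∂L-⇒ b _ r (All.map (Inv-context (arg-context x)) ks)) (∑-swap (∂ j s a) Es _))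
    (trans (∑-swap (splits2 us) Es _) (sym (trans (∑-map (rapp s) Es _)
      (∑-cong Es λ ts′ → ∑-∂-rapp j s ts′ us ψ)))))

  ∑-∂L-⇒ : ∀ {ts Es j} us ψ → ts ⇒ᴸ Es → All (Inv _⇒ᴸ_ ψ) (∂L j ts us) →
    ∑ (∂L j ts us) ψ ≡ ∑[ ts′ ← Es ] ∑ (∂L j ts′ us) ψ
  ∑-∂L-⇒ {j = j} us ψ (here {t} {ts} {E} r) is = trans (∑-∂L-∷ j t ts us ψ) (trans
    (∑-congᴬ (All-combine⁻ _∷_ (∂ j t) (∂L j ts) us is) λ (a , b) js →
      ∑-∂-⇒ a _ r (All.map (λ ks → Inv-∑ {R = _⇒_} (All.map (λ {y} → Inv-context (here-context y)) ks)) js))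
    (trans (∑-swap (splits2 us) E _) (sym (trans (∑-map (_∷ ts) E _)
      (∑-cong E λ t′ → ∑-∂L-∷ j t′ ts us ψ)))))
  ∑-∂L-⇒ {j = j} us ψ (there {t} {ts} {Es} r) is = trans (∑-∂L-∷ j t ts us ψ) (trans
    (∑-congᴬ (All-combine⁻ _∷_ (∂ j t) (∂L j ts) us is) λ (a , b) js → trans
      (∑-congᴬ js λ x ks → ∑-∂L-⇒ b _ r (All.map (Inv-context (there-context x)) ks)) (∑-swap (∂ j t a) Es _))
    (trans (∑-swap (splits2 us) Es _) (sym (trans (∑-map (t ∷_) Es _)
      (∑-cong Es λ ts′ → ∑-∂L-∷ j t ts′ us ψ)))))

-- Local confluence

∑-commute : ∀ {R : A → List A → Set} {S : B → List B → Set} {x y E F} (ψ : A → B → ℕ) → R x E → S y F →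
  All (λ x′ → Inv S (ψ x′) y) E → All (λ y′ → Inv R (λ x → ψ x y′) x) F → ∑[ x′ ← E ] ψ x′ y ≡ ∑[ y′ ← F ] ψ x y′
∑-commute {E = E} {F = F} ψ r s is js =
  trans (∑-congᴬ is λ x′ i → i F s) (trans (∑-swap E F ψ) (sym (∑-congᴬ js λ y′ j → j E r)))

private
  Inv-reduct : ∀ {R : A → List A → Set} {R′ : B → List B → Set} {C : A → B} {x E ψ} → Context R R′ C → R x E →
    GoodReducts R′ ψ (C x) → All (λ x′ → Inv R′ ψ (C x′)) E
  Inv-reduct c r g = All.map Good⇒Inv (All.map⁻ (g (C-cong c r)))

  Good-unary : ∀ {ψ x y} → GoodReducts _⇒_ ψ x → x ⇒ (y ∷ []) → Good _⇒_ ψ y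
  Good-unary g r = All.head (g r)

∑-confluent-β : ∀ {s ts E} ψ → GoodReducts _⇒_ ψ (rapp (rlam s) ts) → rapp (rlam s) ts ⇒ E → ∑ (∂ 0 s ts) ψ ≡ ∑ E ψ
∑-confluent-β ψ g β = refl
∑-confluent-β {s} {ts} ψ g (fun (lam {E = E} r)) = trans (∑-∂-⇒ ts ψ r (All.map Good⇒Inv (g β))) (sym (trans
  (∑-map (λ s′ → rapp s′ ts) (map rlam E) ψ) (trans (∑-map rlam E _)
  (∑-congᴬ (All.map⁻ (All.map⁻ (g (fun (lam r))))) λ s′ h → Good⇒Inv h _ β))))
-- A critical pair. On the other branch the marker leaves the abstraction, then leaves the
-- application, and β is contracted under it; the result is the same list because `∂` commutes with
-- markers by definition.
∑-confluent-β {ts = ts} ψ g (fun (lam⊕• {s})) = sym (trans (ℕ.+-identityʳ _) (trans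
  (Inv-unary (Good⇒Inv h) app⊕•) (Good⇒Inv (Good-unary (Good⇒GoodReducts h) app⊕•) _ (left β))))
  where h = Good-unary g (fun lam⊕•)
∑-confluent-β {ts = ts} ψ g (fun (lam•⊕ {s})) = sym (trans (ℕ.+-identityʳ _) (trans
  (Inv-unary (Good⇒Inv h) app•⊕) (Good⇒Inv (Good-unary (Good⇒GoodReducts h) app•⊕) _ (right β))))
  where h = Good-unary g (fun lam•⊕)
∑-confluent-β {s} {ts} ψ g (arg {Es = Es} r) = trans (∑-∂-⇒ᴸ s ψ (All.map Good⇒Inv (g β)) r) (sym (trans
  (∑-map (rapp (rlam s)) Es ψ) (∑-congᴬ (Inv-reduct (arg-context _) r g) λ ts′ i → i _ β)))

module _ {c : RTerm → RTerm} (m : Marker c) where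
  open Marker m

  private
    after : ∀ {ψ s t E} → GoodReducts _⇒_ ψ s → s ⇒ (c t ∷ []) → t ⇒ E → ψ (c t) ≡ ∑[ e ← E ] ψ (c e)
    after {ψ} {E = E} g r r′ = trans (Good⇒Inv (Good-unary g r) _ (cong-marker r′)) (∑-map c E ψ)

  ∑-confluent-app-fun : ∀ {s ts E} ψ → GoodReducts _⇒_ ψ (rapp (c s) ts) → s ⇒ E →
    ψ (c (rapp s ts)) + 0 ≡ ∑ (map (λ s′ → rapp s′ ts) (map c E)) ψ
  ∑-confluent-app-fun {ts = ts} {E} ψ g r = trans (ℕ.+-identityʳ _) (trans
    (trans (after {ψ} g app-marker (fun r)) (∑-map (λ s′ → rapp s′ ts) E _)) (sym (trans
    (trans (∑-map (λ s′ → rapp s′ ts) (map c E) ψ) (∑-map c E _))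
    (∑-congᴬ (All.map⁻ (All.map⁻ (g (fun (cong-marker r))))) λ s′ h → Inv-unary (Good⇒Inv h) app-marker))))

  ∑-confluent-app-arg : ∀ {s ts Es} ψ → GoodReducts _⇒_ ψ (rapp (c s) ts) → ts ⇒ᴸ Es →
    ψ (c (rapp s ts)) + 0 ≡ ∑ (map (rapp (c s)) Es) ψ
  ∑-confluent-app-arg {s} {Es = Es} ψ g r = trans (ℕ.+-identityʳ _) (trans
    (trans (after {ψ} g app-marker (arg r)) (∑-map (rapp s) Es _)) (sym (trans (∑-map (rapp (c s)) Es ψ)
    (∑-congᴬ (Inv-reduct (arg-context _) r g) λ ts′ i → Inv-unary i app-marker))))

  ∑-confluent-lam-cong : ∀ {s E} ψ → GoodReducts _⇒_ ψ (rlam (c s)) → s ⇒ E →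
    ψ (c (rlam s)) + 0 ≡ ∑ (map rlam (map c E)) ψ
  ∑-confluent-lam-cong {E = E} ψ g r = trans (ℕ.+-identityʳ _) (trans
    (trans (after {ψ} g lam-marker (lam r)) (∑-map rlam E _)) (sym (trans
    (trans (∑-map rlam (map c E) ψ) (∑-map c E _))
    (∑-congᴬ (All.map⁻ (All.map⁻ (g (lam (cong-marker r))))) λ s′ h → Inv-unary (Good⇒Inv h) lam-marker))))

∑-confluent-app⊕• : ∀ {s ts E} ψ → GoodReducts _⇒_ ψ (rapp (s ⊕•) ts) → rapp (s ⊕•) ts ⇒ E → ψ (rapp s ts ⊕•) + 0 ≡ ∑ E ψ
∑-confluent-app⊕• ψ g app⊕• = refl
∑-confluent-app⊕• ψ g (fun (left r)) = ∑-confluent-app-fun ⊕•-marker ψ g r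
∑-confluent-app⊕• ψ g (arg r) = ∑-confluent-app-arg ⊕•-marker ψ g r

∑-confluent-app•⊕ : ∀ {s ts E} ψ → GoodReducts _⇒_ ψ (rapp (•⊕ s) ts) → rapp (•⊕ s) ts ⇒ E → ψ (•⊕ rapp s ts) + 0 ≡ ∑ E ψ
∑-confluent-app•⊕ ψ g app•⊕ = refl
∑-confluent-app•⊕ ψ g (fun (right r)) = ∑-confluent-app-fun •⊕-marker ψ g r
∑-confluent-app•⊕ ψ g (arg r) = ∑-confluent-app-arg •⊕-marker ψ g r

-- The redexes are disjoint, and both sides equal the double sum over `E` and `Es`: performing the
-- second step after the first is additive by goodness of the reducts.
∑-confluent-fun-arg : ∀ {s ts E Es} ψ → GoodReducts _⇒_ ψ (rapp s ts) → s ⇒ E → ts ⇒ᴸ Es →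
  ∑ (map (λ s′ → rapp s′ ts) E) ψ ≡ ∑ (map (rapp s) Es) ψ
∑-confluent-fun-arg {s} {ts} {E} {Es} ψ g r r′ = trans (∑-map (λ s′ → rapp s′ ts) E ψ) (trans
  (∑-commute {R = _⇒_} {_⇒ᴸ_} (λ s ts → ψ (rapp s ts)) r r′
    (All.map (Inv-context (arg-context _)) (Inv-reduct (fun-context ts) r g))
    (All.map (λ {y} → Inv-context (fun-context y)) (Inv-reduct (arg-context s) r′ g)))
  (sym (∑-map (rapp s) Es ψ)))

∑-confluent-here-there : ∀ {t ts E Es} ψ → GoodReducts _⇒ᴸ_ ψ (t ∷ ts) → t ⇒ E → ts ⇒ᴸ Es →
  ∑ (map (_∷ ts) E) ψ ≡ ∑ (map (t ∷_) Es) ψ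
∑-confluent-here-there {t} {ts} {E} {Es} ψ g r r′ = trans (∑-map (_∷ ts) E ψ) (trans
  (∑-commute {R = _⇒_} {_⇒ᴸ_} (λ t ts → ψ (t ∷ ts)) r r′
    (All.map (Inv-context (there-context _)) (Inv-reduct (here-context ts) r g))
    (All.map (λ {y} → Inv-context (here-context y)) (Inv-reduct (there-context t) r′ g)))
  (sym (∑-map (t ∷_) Es ψ)))

mutual
  -- No common reduct is exhibited. The steps that would close the diagram start at proper reducts
  -- of `s`, where ψ is additive, so they leave the ψ-sums unchanged and the two sums can be
  -- compared directly.
  ∑-confluent : ∀ {s E₁ E₂} ψ → GoodReducts _⇒_ ψ s → s ⇒ E₁ → s ⇒ E₂ → ∑ E₁ ψ ≡ ∑ E₂ ψ
  ∑-confluent ψ g β r = ∑-confluent-β ψ g r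
  ∑-confluent ψ g app⊕• r = ∑-confluent-app⊕• ψ g r
  ∑-confluent ψ g app•⊕ r = ∑-confluent-app•⊕ ψ g r
  ∑-confluent ψ g lam⊕• lam⊕• = refl
  ∑-confluent ψ g lam⊕• (lam (left r)) = ∑-confluent-lam-cong ⊕•-marker ψ g r
  ∑-confluent ψ g lam•⊕ lam•⊕ = refl
  ∑-confluent ψ g lam•⊕ (lam (right r)) = ∑-confluent-lam-cong •⊕-marker ψ g r
  ∑-confluent ψ g (lam (left r)) lam⊕• = sym (∑-confluent-lam-cong ⊕•-marker ψ g r)
  ∑-confluent ψ g (lam (right r)) lam•⊕ = sym (∑-confluent-lam-cong •⊕-marker ψ g r)
  ∑-confluent ψ g (lam {E = E} r) (lam {E = E′} r′) = trans (∑-map rlam E ψ) (trans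
    (∑-confluent (ψ ∘ rlam) (GoodReducts-context rlam-context g) r r′) (sym (∑-map rlam E′ ψ)))
  ∑-confluent ψ g (left {E = E} r) (left {E = E′} r′) = trans (∑-map _⊕• E ψ) (trans
    (∑-confluent (ψ ∘ _⊕•) (GoodReducts-context ⊕•-context g) r r′) (sym (∑-map _⊕• E′ ψ)))
  ∑-confluent ψ g (right {E = E} r) (right {E = E′} r′) = trans (∑-map •⊕_ E ψ) (trans
    (∑-confluent (ψ ∘ •⊕_) (GoodReducts-context •⊕-context g) r r′) (sym (∑-map •⊕_ E′ ψ)))
  ∑-confluent ψ g r@(fun _) β = sym (∑-confluent-β ψ g r)
  ∑-confluent ψ g r@(fun _) app⊕• = sym (∑-confluent-app⊕• ψ g r)
  ∑-confluent ψ g r@(fun _) app•⊕ = sym (∑-confluent-app•⊕ ψ g r)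
  ∑-confluent ψ g (fun {ts = ts} {E} r) (fun {E = E′} r′) = trans (∑-map (λ s → rapp s ts) E ψ) (trans
    (∑-confluent (λ s → ψ (rapp s ts)) (GoodReducts-context (fun-context ts) g) r r′) (sym (∑-map (λ s → rapp s ts) E′ ψ)))
  ∑-confluent ψ g (fun r) (arg r′) = ∑-confluent-fun-arg ψ g r r′
  ∑-confluent ψ g r@(arg _) β = sym (∑-confluent-β ψ g r)
  ∑-confluent ψ g r@(arg _) app⊕• = sym (∑-confluent-app⊕• ψ g r)
  ∑-confluent ψ g r@(arg _) app•⊕ = sym (∑-confluent-app•⊕ ψ g r)
  ∑-confluent ψ g (arg r) (fun r′) = sym (∑-confluent-fun-arg ψ g r′ r)
  ∑-confluent ψ g (arg {s} {Es = E} r) (arg {Es = E′} r′) = trans (∑-map (rapp s) E ψ) (trans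
    (∑-confluentᴸ (ψ ∘ rapp s) (GoodReducts-context (arg-context s) g) r r′) (sym (∑-map (rapp s) E′ ψ)))

  ∑-confluentᴸ : ∀ {ts E₁ E₂} ψ → GoodReducts _⇒ᴸ_ ψ ts → ts ⇒ᴸ E₁ → ts ⇒ᴸ E₂ → ∑ E₁ ψ ≡ ∑ E₂ ψ
  ∑-confluentᴸ ψ g (here {ts = ts} {E} r) (here {E = E′} r′) = trans (∑-map (_∷ ts) E ψ) (trans
    (∑-confluent (λ t → ψ (t ∷ ts)) (GoodReducts-context (here-context ts) g) r r′) (sym (∑-map (_∷ ts) E′ ψ)))
  ∑-confluentᴸ ψ g (here r) (there r′) = ∑-confluent-here-there ψ g r r′
  ∑-confluentᴸ ψ g (there r) (here r′) = sym (∑-confluent-here-there ψ g r′ r)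
  ∑-confluentᴸ ψ g (there {t} {Es = E} r) (there {Es = E′} r′) = trans (∑-map (t ∷_) E ψ) (trans
    (∑-confluentᴸ (ψ ∘ (t ∷_)) (GoodReducts-context (there-context t) g) r r′) (sym (∑-map (t ∷_) E′ ψ)))

-- Termination and invariance of normal forms

-- Variables and ⊕-markers weigh nothing, so that ∂ is exactly additive; the markers are counted by height,
-- which doubles under λ and in function position so that it decreases when a marker moves up.
mutual
  nodes : RTerm → ℕ
  nodes (rvar _) = 0
  nodes (rlam s) = suc (nodes s)
  nodes (rapp s ts) = suc (nodes s + nodesL ts)
  nodes (s ⊕•) = nodes s
  nodes (•⊕ s) = nodes s

  nodesL : List RTerm → ℕ
  nodesL [] = 0
  nodesL (t ∷ ts) = nodes t + nodesL ts

mutual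
  height : RTerm → ℕ
  height (rvar _) = 0
  height (rlam s) = height s + height s
  height (rapp s ts) = (height s + height s) + heightL ts
  height (s ⊕•) = suc (height s)
  height (•⊕ s) = suc (height s)

  heightL : List RTerm → ℕ
  heightL [] = 0
  heightL (t ∷ ts) = height t + heightL ts

infix 4 _≪_ _≺_ _≺ᴸ_
_≪_ : ℕ × ℕ → ℕ × ℕ → Set
_≪_ = ×-Lex _≡_ _<_ _<_

_≺_ : RTerm → RTerm → Set
s ≺ t = (nodes s , height s) ≪ (nodes t , height t)

_≺ᴸ_ : List RTerm → List RTerm → Set
ss ≺ᴸ ts = (nodesL ss , heightL ss) ≪ (nodesL ts , heightL ts)

≺-wellFounded : WellFounded _≺_
≺-wellFounded = On.wellFounded (λ s → nodes s , height s) (×-wellFounded <-wellFounded <-wellFounded)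

≪-mono : ∀ {m m′ h h′} (f g : ℕ → ℕ) → (∀ {x y} → x < y → f x < f y) → (∀ {x y} → x < y → g x < g y) →
  (m , h) ≪ (m′ , h′) → (f m , g h) ≪ (f m′ , g h′)
≪-mono f g f-mono g-mono (inj₁ m<m′) = inj₁ (f-mono m<m′)
≪-mono f g f-mono g-mono (inj₂ (m≡m′ , h<h′)) = inj₂ (cong f m≡m′ , g-mono h<h′)

≺-rlam : ∀ {s t} → s ≺ t → rlam s ≺ rlam t
≺-rlam = ≪-mono suc (λ h → h + h) s≤s (λ lt → ℕ.+-mono-< lt lt)

≺-⊕• : ∀ {s t} → s ≺ t → (s ⊕•) ≺ (t ⊕•)
≺-⊕• = ≪-mono id suc id s≤s

≺-•⊕ : ∀ {s t} → s ≺ t → (•⊕ s) ≺ (•⊕ t)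
≺-•⊕ = ≪-mono id suc id s≤s

≺-fun : ∀ {s t} ts → s ≺ t → rapp s ts ≺ rapp t ts
≺-fun ts = ≪-mono (λ m → suc (m + nodesL ts)) (λ h → (h + h) + heightL ts)
  (λ lt → s≤s (ℕ.+-monoˡ-< _ lt)) (λ lt → ℕ.+-monoˡ-< _ (ℕ.+-mono-< lt lt))

≺-arg : ∀ {ss ts} s → ss ≺ᴸ ts → rapp s ss ≺ rapp s ts
≺-arg s = ≪-mono (λ m → suc (nodes s + m)) ((height s + height s) +_)
  (λ lt → s≤s (ℕ.+-monoʳ-< (nodes s) lt)) (ℕ.+-monoʳ-< (height s + height s))

≺-here : ∀ {s t} ts → s ≺ t → (s ∷ ts) ≺ᴸ (t ∷ ts)
≺-here ts = ≪-mono (_+ nodesL ts) (_+ heightL ts) (ℕ.+-monoˡ-< _) (ℕ.+-monoˡ-< _)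

≺-there : ∀ {ss ts} t → ss ≺ᴸ ts → (t ∷ ss) ≺ᴸ (t ∷ ts)
≺-there t = ≪-mono (nodes t +_) (height t +_) (ℕ.+-monoʳ-< (nodes t)) (ℕ.+-monoʳ-< (height t))

mutual
  nodes-rshift : ∀ c s → nodes (rshift c s) ≡ nodes s
  nodes-rshift c (rvar i) with i <ᵇ c
  ... | true = refl
  ... | false = refl
  nodes-rshift c (rlam s) = cong suc (nodes-rshift (suc c) s)
  nodes-rshift c (rapp s ts) = cong suc (cong₂ _+_ (nodes-rshift c s) (nodesL-rshiftL c ts))
  nodes-rshift c (s ⊕•) = nodes-rshift c s
  nodes-rshift c (•⊕ s) = nodes-rshift c s

  nodesL-rshiftL : ∀ c ts → nodesL (rshiftL c ts) ≡ nodesL ts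
  nodesL-rshiftL c [] = refl
  nodesL-rshiftL c (t ∷ ts) = cong₂ _+_ (nodes-rshift c t) (nodesL-rshiftL c ts)

nodesL-splits2 : ∀ us → All (λ (a , b) → nodesL a + nodesL b ≡ nodesL us) (splits2 us)
nodesL-splits2 [] = refl ∷ []
nodesL-splits2 (u ∷ us) = All-splits2-∷⁺ u us (All.map (λ {(a , b)} eq →
  trans (ℕ.+-assoc (nodes u) (nodesL a) (nodesL b)) (cong (nodes u +_) eq) ,
  trans (sym (ℕ.+-assoc (nodesL a) (nodes u) (nodesL b))) (trans (cong (_+ nodesL b) (ℕ.+-comm (nodesL a) (nodes u)))
    (trans (ℕ.+-assoc (nodes u) (nodesL a) (nodesL b)) (cong (nodes u +_) eq)))) (nodesL-splits2 us))

private
  nodes-pair : ∀ {x y p q a b u} → x ≡ p + a → y ≡ q + b → a + b ≡ u → x + y ≡ (p + q) + u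
  nodes-pair {p = p} {q} {a} {b} refl refl refl = +-interchange p a q b

mutual
  nodes-∂ : ∀ {j} s us → All (λ e → nodes e ≡ nodes s + nodesL us) (∂ j s us)
  nodes-∂ {j} (rvar i) us with varView j i
  nodes-∂ {j} (rvar i) [] | below i<j rewrite ∂-below i<j = refl ∷ []
  nodes-∂ {j} (rvar i) (u ∷ us) | below i<j rewrite ∂-other u us (ℕ.<⇒≢ i<j) = []
  nodes-∂ {j} (rvar .j) [] | equal rewrite ∂-equal-[] j = []
  nodes-∂ {j} (rvar .j) (u ∷ []) | equal rewrite ∂-equal-[_] {j} u = sym (ℕ.+-identityʳ _) ∷ []
  nodes-∂ {j} (rvar .j) (u ∷ v ∷ us) | equal rewrite ∂-equal-∷∷ j u v us = []
  nodes-∂ {j} (rvar (suc i)) [] | above j≤i rewrite ∂-above j≤i = refl ∷ []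
  nodes-∂ {j} (rvar (suc i)) (u ∷ us) | above j≤i rewrite ∂-other u us (ℕ.<⇒≢ (s≤s j≤i) ∘ sym) = []
  nodes-∂ {j} (rlam s) us = All.map⁺ (All.map (λ eq → cong suc (trans eq (cong (nodes s +_) (nodesL-rshiftL 0 us))))
    (nodes-∂ s (rshiftL 0 us)))
  nodes-∂ {j} (rapp s ts) us = All-combine⁺ rapp (∂ j s) (∂L j ts) us (All.map (λ {(a , b)} eq →
    All.map (λ eq₁ → All.map (λ eq₂ → cong suc (nodes-pair {p = nodes s} eq₁ eq₂ eq)) (nodesL-∂L ts b)) (nodes-∂ s a)) (nodesL-splits2 us))
  nodes-∂ {j} (s ⊕•) us = All.map⁺ (nodes-∂ s us)
  nodes-∂ {j} (•⊕ s) us = All.map⁺ (nodes-∂ s us)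

  nodesL-∂L : ∀ {j} ts us → All (λ e → nodesL e ≡ nodesL ts + nodesL us) (∂L j ts us)
  nodesL-∂L [] [] = refl ∷ []
  nodesL-∂L [] (u ∷ us) = []
  nodesL-∂L {j} (t ∷ ts) us = All-combine⁺ _∷_ (∂ j t) (∂L j ts) us (All.map (λ {(a , b)} eq →
    All.map (λ eq₁ → All.map (λ eq₂ → nodes-pair {p = nodes t} eq₁ eq₂ eq) (nodesL-∂L ts b)) (nodes-∂ t a)) (nodesL-splits2 us))

-- A β-step removes one abstraction and one application and, by linearity, duplicates nothing; the
-- heights may grow arbitrarily, which the lexicographic order permits.
∂-≺ : ∀ s ts → All (_≺ rapp (rlam s) ts) (∂ 0 s ts)
∂-≺ s ts = All.map (λ eq → inj₁ (s≤s (ℕ.m≤n⇒m≤1+n (ℕ.≤-reflexive eq)))) (nodes-∂ s ts)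

marker-≺-app : ∀ a b → suc ((a + a) + b) < (suc a + suc a) + b
marker-≺-app a b rewrite ℕ.+-suc a a = ℕ.≤-refl

marker-≺-lam : ∀ a → suc (a + a) < suc a + suc a
marker-≺-lam a rewrite ℕ.+-suc a a = ℕ.≤-refl

mutual
  ⇒-≺ : ∀ {s E} → s ⇒ E → All (_≺ s) E
  ⇒-≺ (β {s} {ts}) = ∂-≺ s ts
  ⇒-≺ (app⊕• {s} {ts}) = inj₂ (refl , marker-≺-app (height s) (heightL ts)) ∷ []
  ⇒-≺ (app•⊕ {s} {ts}) = inj₂ (refl , marker-≺-app (height s) (heightL ts)) ∷ []
  ⇒-≺ (lam⊕• {s}) = inj₂ (refl , marker-≺-lam (height s)) ∷ []
  ⇒-≺ (lam•⊕ {s}) = inj₂ (refl , marker-≺-lam (height s)) ∷ []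
  ⇒-≺ (lam {s} r) = All.map⁺ (All.map (λ {x} → ≺-rlam {x} {s}) (⇒-≺ r))
  ⇒-≺ (left {s} r) = All.map⁺ (All.map (λ {x} → ≺-⊕• {x} {s}) (⇒-≺ r))
  ⇒-≺ (right {s} r) = All.map⁺ (All.map (λ {x} → ≺-•⊕ {x} {s}) (⇒-≺ r))
  ⇒-≺ (fun {s} {ts} r) = All.map⁺ (All.map (λ {x} → ≺-fun {x} {s} ts) (⇒-≺ r))
  ⇒-≺ (arg {s} {ts} r) = All.map⁺ (All.map (λ {x} → ≺-arg {x} {ts} s) (⇒ᴸ-≺ᴸ r))

  ⇒ᴸ-≺ᴸ : ∀ {ts Es} → ts ⇒ᴸ Es → All (_≺ᴸ ts) Es
  ⇒ᴸ-≺ᴸ (here {t} {ts} r) = All.map⁺ (All.map (λ {x} → ≺-here {x} {t} ts) (⇒-≺ r))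
  ⇒ᴸ-≺ᴸ (there {t} {ts} r) = All.map⁺ (All.map (λ {x} → ≺-there {x} {ts} t) (⇒ᴸ-≺ᴸ r))

module Normalization {nf : RTerm → List RTerm} (isNF : IsNF nf) where

  normalSum : (RTerm → ℕ) → RTerm → ℕ
  normalSum ψ s = ∑ (nf s) ψ

  private
    step-inv : ∀ {G G′} → G ⟶∂ G′ → ∃ λ F₁ → ∃ λ s → ∃ λ E → ∃ λ F₂ → s ⇒ E × G ≡ F₁ ++ s ∷ F₂ × G′ ≡ F₁ ++ E ++ F₂
    step-inv (step {s} {E} F₁ F₂ r) = F₁ , s , E , F₂ , to⇒ r , refl , refl

    singleton-step : ∀ {s G} → (s ∷ []) ⟶∂ G → s ⇒ G
    singleton-step st with step-inv st
    ... | [] , s , E , [] , r , refl , refl = ≡.subst (s ⇒_) (sym (List.++-identityʳ E)) r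
    ... | [] , s , E , _ ∷ _ , r , () , _
    ... | _ ∷ [] , s , E , F₂ , r , () , _
    ... | _ ∷ _ ∷ _ , s , E , F₂ , r , () , _

  Irreducible : RTerm → Set
  Irreducible s = ∀ {E} → ¬ (s ⇒ E)

  nf-irreducible : ∀ {s} → Irreducible s → nf s ≡ s ∷ []
  nf-irreducible {s} irr with nf s | proj₁ (isNF s)
  ... | _ | ε = refl
  ... | _ | st ◅ _ = contradiction (singleton-step st) irr

  Normal⇒Irreducible : ∀ F₁ N → Normal (F₁ ++ N) → All Irreducible N
  Normal⇒Irreducible F₁ [] norm = []
  Normal⇒Irreducible F₁ (e ∷ N) norm = (λ r → norm _ (step F₁ N (from⇒ r))) ∷
    Normal⇒Irreducible (F₁ ++ e ∷ []) N (≡.subst Normal (sym (List.++-assoc F₁ (e ∷ []) N)) norm)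

  normalSum-irreducible : ∀ {s} ψ → Irreducible s → normalSum ψ s ≡ ψ s
  normalSum-irreducible {s} ψ irr rewrite nf-irreducible irr = ∑-singleton s ψ

  private
    -- Each step preserves the sum of `normalSum ψ`, all terms on the way being good; at the end
    -- every term is normal and `normalSum ψ` agrees with ψ.
    normalSum-star : ∀ {G N} ψ → All (Good _⇒_ (normalSum ψ)) G → Star _⟶∂_ G N → Normal N → ∑ N ψ ≡ ∑ G (normalSum ψ)
    normalSum-star ψ gs ε norm = sym (∑-congᴬ (Normal⇒Irreducible [] _ norm) λ e irr → normalSum-irreducible ψ irr)
    normalSum-star ψ gs (st ◅ sts) norm with step-inv st
    ... | F₁ , s , E , F₂ , r , refl , refl with All.++⁻ F₁ gs
    ... | gs₁ , good i g ∷ gs₂ = trans (normalSum-star ψ (All.++⁺ gs₁ (All.++⁺ (g r) gs₂)) sts norm)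
        (trans (∑-++ F₁ (E ++ F₂) _) (trans
          (cong (_ +_) (trans (∑-++ E F₂ _) (cong (_+ _) (sym (i E r)))))
          (sym (∑-++ F₁ (s ∷ F₂) _))))

    -- Newman's lemma, by induction along `_≺_`: the reducts are good by hypothesis, so local
    -- confluence is available at `s`.
    normalSum-good : ∀ ψ {s} → Acc _≺_ s → Good _⇒_ (normalSum ψ) s
    normalSum-good ψ {s} (acc rs) = good invariant reducts
      where
      reducts : GoodReducts _⇒_ (normalSum ψ) s
      reducts r = All.map (λ e≺s → normalSum-good ψ (rs e≺s)) (⇒-≺ r)
      invariant : Inv _⇒_ (normalSum ψ) s
      invariant E r with nf s | isNF s
      ... | _ | ε , norm = contradiction r (All.head (Normal⇒Irreducible [] (s ∷ []) norm))
      -- The given reduction to `nf s` starts with the step `st`, and from there on the sum is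
      -- preserved by the induction hypothesis. Local confluence carries the resulting equation from
      -- `st` over to the arbitrary step `r`.
      ... | _ | st ◅ sts , norm = trans (normalSum-star ψ (reducts (singleton-step st)) sts norm)
        (∑-confluent (normalSum ψ) reducts (singleton-step st) r)

  normalSum-invariant : ∀ ψ s → Inv _⇒_ (normalSum ψ) s
  normalSum-invariant ψ s = Good⇒Inv (normalSum-good ψ (≺-wellFounded s))

-- Uniform substitution

picks : List A → List (A × List A)
picks [] = []
picks (x ∷ xs) = (x , xs) ∷ map (λ (y , ys) → y , x ∷ ys) (picks xs)

∑-picks-∷ : ∀ x (xs : List A) F → ∑ (picks (x ∷ xs)) F ≡ F (x , xs) + ∑ (picks xs) λ (y , ys) → F (y , x ∷ ys)
∑-picks-∷ x xs F = cong (F (x , xs) +_) (∑-map _ (picks xs) F)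

-- matches s t is the number of ways of permuting the monomials of s, at all depths, that yield the list term t.
mutual
  matches : RTerm → RTerm → ℕ
  matches (rvar i) (rvar j) = if i ≡ᵇ j then 1 else 0
  matches (rlam s) (rlam t) = matches s t
  matches (rapp s ss) (rapp t ts) = matches s t * matchesL ss ts
  matches (s ⊕•) (t ⊕•) = matches s t
  matches (•⊕ s) (•⊕ t) = matches s t
  matches _ _ = 0

  matchesL : List RTerm → List RTerm → ℕ
  matchesL ss (t ∷ ts) = ∑ (picks ss) λ (s , ss′) → matches s t * matchesL ss′ ts
  matchesL [] [] = 1
  matchesL (_ ∷ _) [] = 0

matches-var : ∀ i → matches (rvar i) (rvar i) ≡ 1
matches-var i rewrite ≡ᵇ-refl i = refl

matchesL-surplus : ∀ u v us e → matchesL (u ∷ v ∷ us) (e ∷ []) ≡ 0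
matchesL-surplus u v us e = trans (∑-picks-∷ u (v ∷ us) (λ (y , ys) → matches y e * matchesL ys []))
  (cong₂ _+_ (ℕ.*-zeroʳ (matches u e))
    (trans (∑-cong (picks (v ∷ us)) λ (y , ys) → ℕ.*-zeroʳ (matches y e)) (∑-zero (picks (v ∷ us)))))

∑-splits2-picks : ∀ us (G : RTerm → List RTerm → List RTerm → ℕ) →
  (∑ (splits2 us) λ (a , b) → ∑ (picks a) λ (z , a′) → G z a′ b) ≡
  (∑ (picks us) λ (z , us′) → ∑ (splits2 us′) λ (a′ , b) → G z a′ b)
∑-splits2-picks [] G = refl
∑-splits2-picks (u ∷ us) G = begin
  (∑ (splits2 (u ∷ us)) λ (a , b) → ∑ (picks a) λ (z , a′) → G z a′ b)
    ≡⟨ trans (∑-splits2-∷ u us _) (trans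
         (∑-cong (splits2 us) λ (a , b) → trans (cong (_+ picked a (u ∷ b)) (∑-picks-∷ u a _)) (ℕ.+-assoc (G u a b) _ _))
         (∑-+ (splits2 us) _ _)) ⟩
  (∑ (splits2 us) λ (a , b) → G u a b) +
  (∑ (splits2 us) λ (a , b) → (∑ (picks a) λ (z , a′) → G z (u ∷ a′) b) + picked a (u ∷ b))
    ≡⟨ cong ((∑ (splits2 us) λ (a , b) → G u a b) +_) (trans (∑-+ (splits2 us) _ _) (trans
         (cong₂ _+_ (∑-splits2-picks us (λ z a′ b → G z (u ∷ a′) b)) (∑-splits2-picks us (λ z a′ b → G z a′ (u ∷ b))))
         (sym (∑-+ (picks us) _ _)))) ⟩
  (∑ (splits2 us) λ (a , b) → G u a b) +
  (∑ (picks us) λ (z , us′) → (∑ (splits2 us′) λ (a′ , b) → G z (u ∷ a′) b) + (∑ (splits2 us′) λ (a′ , b) → G z a′ (u ∷ b)))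
    ≡⟨ sym (trans (∑-picks-∷ u us _) (cong ((∑ (splits2 us) λ (a , b) → G u a b) +_) (∑-cong (picks us) λ (z , us′) →
         trans (∑-splits2-∷ u us′ _) (∑-+ (splits2 us′) _ _)))) ⟩
  _ ∎
  where
  picked : List RTerm → List RTerm → ℕ
  picked a b = ∑ (picks a) λ (z , a′) → G z a′ b

-- Laplace expansion of a permanent: the bijections are grouped by the set of elements of `us` that
-- they send into `xs`.
matchesL-++ : ∀ us xs ys → matchesL us (xs ++ ys) ≡ ∑ (splits2 us) λ (a , b) → matchesL a xs * matchesL b ys
matchesL-++ us [] ys = sym (trans (∑-splits2-emptyˡ us (λ (a , b) → matchesL a [] * matchesL b ys) (λ _ _ _ → refl))
  (ℕ.*-identityˡ _))
matchesL-++ us (x ∷ xs) ys = begin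
  (∑ (picks us) λ (z , us′) → matches z x * matchesL us′ (xs ++ ys))
    ≡⟨ ∑-cong (picks us) (λ (z , us′) → trans (cong (matches z x *_) (matchesL-++ us′ xs ys))
         (trans (sym (∑-*ˡ (splits2 us′) (matches z x) _))
           (∑-cong (splits2 us′) λ (a , b) → sym (ℕ.*-assoc (matches z x) (matchesL a xs) (matchesL b ys))))) ⟩
  (∑ (picks us) λ (z , us′) → ∑ (splits2 us′) λ (a , b) → (matches z x * matchesL a xs) * matchesL b ys)
    ≡⟨ sym (∑-splits2-picks us (λ z a b → (matches z x * matchesL a xs) * matchesL b ys)) ⟩
  (∑ (splits2 us) λ (a , b) → ∑ (picks a) λ (z , a′) → (matches z x * matchesL a′ xs) * matchesL b ys)
    ≡⟨ ∑-cong (splits2 us) (λ (a , b) → ∑-*ʳ (picks a) _ (matchesL b ys)) ⟩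
  _ ∎

-- Picking an element after the substitution amounts to picking its original and the share of `us`
-- it receives. In the form on the right the picked element can be matched against a target
-- independently of the rest.
∑-∂L-picks : ∀ j ts us (H : RTerm × List RTerm → ℕ) →
  ∑[ ts′ ← ∂L j ts us ] ∑ (picks ts′) H ≡
  ∑ (picks ts) λ (t , ts′) → ∑ (splits2 us) λ (a , b) → ∑[ x ← ∂ j t a ] ∑[ xs ← ∂L j ts′ b ] H (x , xs)
∑-∂L-picks j [] [] H = refl
∑-∂L-picks j [] (u ∷ us) H = refl
∑-∂L-picks j (t ∷ ts) us H = begin
  ∑[ ts′ ← ∂L j (t ∷ ts) us ] ∑ (picks ts′) H
    ≡⟨ ∑-∂L-∷ j t ts us _ ⟩
  (∑ (splits2 us) λ (a , b) → ∑[ x ← ∂ j t a ] ∑[ xs ← ∂L j ts b ] ∑ (picks (x ∷ xs)) H)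
    ≡⟨ trans (∑-cong (splits2 us) λ (a , b) → trans (∑-cong (∂ j t a) λ x → trans
           (∑-cong (∂L j ts b) λ xs → ∑-picks-∷ x xs H) (∑-+ (∂L j ts b) _ _)) (∑-+ (∂ j t a) _ _))
         (∑-+ (splits2 us) _ _) ⟩
  (∑ (splits2 us) λ (a , b) → ∑[ x ← ∂ j t a ] ∑[ xs ← ∂L j ts b ] H (x , xs)) +
  (∑ (splits2 us) λ (a , b) → ∑[ x ← ∂ j t a ] ∑[ xs ← ∂L j ts b ] ∑ (picks xs) λ (y , ys) → H (y , x ∷ ys))
    ≡⟨ cong ((∑ (splits2 us) λ (a , b) → ∑[ x ← ∂ j t a ] ∑[ xs ← ∂L j ts b ] H (x , xs)) +_) later ⟩
  (∑ (splits2 us) λ (a , b) → ∑[ x ← ∂ j t a ] ∑[ xs ← ∂L j ts b ] H (x , xs)) +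
  (∑ (picks ts) λ (t₂ , ts₂) → ∑ (splits2 us) λ (e , r) → ∑[ y ← ∂ j t₂ e ] ∑[ zs ← ∂L j (t ∷ ts₂) r ] H (y , zs))
    ≡⟨ sym (∑-picks-∷ t ts _) ⟩
  _ ∎
  where
  later : (∑ (splits2 us) λ (a , b) → ∑[ x ← ∂ j t a ] ∑[ xs ← ∂L j ts b ] ∑ (picks xs) λ (y , ys) → H (y , x ∷ ys)) ≡
    (∑ (picks ts) λ (t₂ , ts₂) → ∑ (splits2 us) λ (e , r) → ∑[ y ← ∂ j t₂ e ] ∑[ zs ← ∂L j (t ∷ ts₂) r ] H (y , zs))
  later = begin
    (∑ (splits2 us) λ (a , b) → ∑[ x ← ∂ j t a ] ∑[ xs ← ∂L j ts b ] ∑ (picks xs) λ (y , ys) → H (y , x ∷ ys))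
      ≡⟨ ∑-cong (splits2 us) (λ (a , b) → trans (∑-cong (∂ j t a) λ x → ∑-∂L-picks j ts b (λ (y , ys) → H (y , x ∷ ys)))
           (∑-swap (∂ j t a) (picks ts) _)) ⟩
    (∑ (splits2 us) λ (a , b) → ∑ (picks ts) λ (t₂ , ts₂) → ∑[ x ← ∂ j t a ]
      ∑ (splits2 b) λ (e , f) → ∑[ y ← ∂ j t₂ e ] ∑[ ys ← ∂L j ts₂ f ] H (y , x ∷ ys))
      ≡⟨ ∑-swap (splits2 us) (picks ts) _ ⟩
    (∑ (picks ts) λ (t₂ , ts₂) → ∑ (splits2 us) λ (a , b) → ∑[ x ← ∂ j t a ]
      ∑ (splits2 b) λ (e , f) → ∑[ y ← ∂ j t₂ e ] ∑[ ys ← ∂L j ts₂ f ] H (y , x ∷ ys))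
      ≡⟨ ∑-cong (picks ts) (λ (t₂ , ts₂) → trans
           (∑-cong (splits2 us) λ (a , b) → trans (∑-swap (∂ j t a) (splits2 b) _)
             (∑-cong (splits2 b) λ (e , f) → ∑-swap (∂ j t a) (∂ j t₂ e) _))
           (∑-splits2-assoc-comm us (λ e a f → ∑[ y ← ∂ j t₂ e ] ∑[ x ← ∂ j t a ] ∑[ ys ← ∂L j ts₂ f ] H (y , x ∷ ys)))) ⟩
    (∑ (picks ts) λ (t₂ , ts₂) → ∑ (splits2 us) λ (e , r) → ∑ (splits2 r) λ (a , f) →
      ∑[ y ← ∂ j t₂ e ] ∑[ x ← ∂ j t a ] ∑[ ys ← ∂L j ts₂ f ] H (y , x ∷ ys))
      ≡⟨ ∑-cong (picks ts) (λ (t₂ , ts₂) → ∑-cong (splits2 us) λ (e , r) → trans (∑-swap (splits2 r) (∂ j t₂ e) _)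
           (∑-cong (∂ j t₂ e) λ y → sym (∑-∂L-∷ j t ts₂ r (λ zs → H (y , zs))))) ⟩
    _ ∎

-- Supports of Taylor expansions

infix 4 _∈𝒯_
-- The support, described on list terms without mention of coefficients, so that all counting below
-- stays in ℕ; `T-∈` and `membership` relate it to `T` later.
data _∈𝒯_ : RTerm → Approx → Set where
  var   : ∀ {i} → rvar i ∈𝒯 var i
  lam   : ∀ {s N} → s ∈𝒯 N → rlam s ∈𝒯 lam N
  app   : ∀ {s ts P Q} → s ∈𝒯 P → All (_∈𝒯 Q) ts → rapp s ts ∈𝒯 app P Q
  left  : ∀ {s P Q} → s ∈𝒯 P → s ⊕• ∈𝒯 P ⊕ Q
  right : ∀ {s P Q} → s ∈𝒯 Q → •⊕ s ∈𝒯 P ⊕ Q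

mutual
  ∈𝒯-shift : ∀ {s} c N → s ∈𝒯 emb N → rshift c s ∈𝒯 emb (shift c N)
  ∈𝒯-shift c (var i) var with i <ᵇ c
  ... | true = var
  ... | false = var
  ∈𝒯-shift c (lam N) (lam p) = lam (∈𝒯-shift (suc c) N p)
  ∈𝒯-shift c (app N P) (app p ps) = app (∈𝒯-shift c N p) (All-∈𝒯-shift c P ps)
  ∈𝒯-shift c (N ⊕ P) (left p) = left (∈𝒯-shift c N p)
  ∈𝒯-shift c (N ⊕ P) (right p) = right (∈𝒯-shift c P p)

  All-∈𝒯-shift : ∀ {ts} c N → All (_∈𝒯 emb N) ts → All (_∈𝒯 emb (shift c N)) (rshiftL c ts)
  All-∈𝒯-shift c N [] = []
  All-∈𝒯-shift c N (p ∷ ps) = ∈𝒯-shift c N p ∷ All-∈𝒯-shift c N ps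

mutual
  -- Arguments found below an abstraction belong to the support of a shifted term; this brings them
  -- back outside it.
  ∈𝒯-unshift : ∀ {t} c N → t ∈𝒯 emb (shift c N) → ∃ λ s → t ≡ rshift c s × s ∈𝒯 emb N
  ∈𝒯-unshift c (var i) p with ℕ.<-≤-connex i c
  ∈𝒯-unshift c (var i) p | inj₁ i<c rewrite <⇒<ᵇ-true i<c with p
  ... | var = rvar i , sym (rshift-below i<c) , var
  ∈𝒯-unshift c (var i) p | inj₂ c≤i rewrite ≥⇒<ᵇ-false c≤i with p
  ... | var = rvar i , sym (rshift-above c≤i) , var
  ∈𝒯-unshift c (lam N) (lam p) with ∈𝒯-unshift (suc c) N p
  ... | s , refl , q = rlam s , refl , lam q
  ∈𝒯-unshift c (app N P) (app p ps) with ∈𝒯-unshift c N p | All-∈𝒯-unshift c P ps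
  ... | s , refl , q | ts , refl , qs = rapp s ts , refl , app q qs
  ∈𝒯-unshift c (N ⊕ P) (left p) with ∈𝒯-unshift c N p
  ... | s , refl , q = s ⊕• , refl , left q
  ∈𝒯-unshift c (N ⊕ P) (right p) with ∈𝒯-unshift c P p
  ... | s , refl , q = •⊕ s , refl , right q

  All-∈𝒯-unshift : ∀ {ts} c N → All (_∈𝒯 emb (shift c N)) ts → ∃ λ ss → ts ≡ rshiftL c ss × All (_∈𝒯 emb N) ss
  All-∈𝒯-unshift c N [] = [] , refl , []
  All-∈𝒯-unshift c N (p ∷ ps) with ∈𝒯-unshift c N p | All-∈𝒯-unshift c N ps
  ... | s , refl , q | ss , refl , qs = s ∷ ss , refl , q ∷ qs

∑-picks-rshiftL : ∀ c ts (F : RTerm × List RTerm → ℕ) →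
  ∑ (picks (rshiftL c ts)) F ≡ ∑ (picks ts) λ (t , ts′) → F (rshift c t , rshiftL c ts′)
∑-picks-rshiftL c [] F = refl
∑-picks-rshiftL c (t ∷ ts) F = trans (∑-picks-∷ (rshift c t) (rshiftL c ts) F) (trans
  (cong (F (rshift c t , rshiftL c ts) +_) (∑-picks-rshiftL c ts _)) (sym (∑-picks-∷ t ts _)))

matches-var-rshift : ∀ c i → matches (rshift c (rvar i)) (rshift c (rvar i)) ≡ matches (rvar i) (rvar i)
matches-var-rshift c i with i <ᵇ c
... | true = refl
... | false = refl

mutual
  -- Two elements of the support of one `N` carry the same variable at each variable of `N`, so
  -- shifting cannot create or destroy a match.
  matches-rshift : ∀ {N s t} c → s ∈𝒯 N → t ∈𝒯 N → matches (rshift c s) (rshift c t) ≡ matches s t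
  matches-rshift c (var {i}) var = matches-var-rshift c i
  matches-rshift c (lam p) (lam q) = matches-rshift (suc c) p q
  matches-rshift c (app p ps) (app q qs) = cong₂ _*_ (matches-rshift c p q) (matchesL-rshiftL c _ _ ps qs)
  matches-rshift c (left p) (left q) = matches-rshift c p q
  matches-rshift c (left p) (right q) = refl
  matches-rshift c (right p) (left q) = refl
  matches-rshift c (right p) (right q) = matches-rshift c p q

  matchesL-rshiftL : ∀ {N} c ss ts → All (_∈𝒯 N) ss → All (_∈𝒯 N) ts →
    matchesL (rshiftL c ss) (rshiftL c ts) ≡ matchesL ss ts
  matchesL-rshiftL c [] [] _ _ = refl
  matchesL-rshiftL c (s ∷ ss) [] _ _ = refl
  matchesL-rshiftL c ss (t ∷ ts) ps (q ∷ qs) = trans (∑-picks-rshiftL c ss _)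
    (∑-congᴬ (All-picks ps) λ (s , ss′) (p , ps′) →
      cong₂ _*_ (matches-rshift c p q) (matchesL-rshiftL c ss′ ts ps′ qs))

  All-picks : ∀ {P : A → Set} {xs} → All P xs → All (λ (y , ys) → P y × All P ys) (picks xs)
  All-picks [] = []
  All-picks (p ∷ ps) = (p , ps) ∷ All.map⁺ (All.map (λ (q , qs) → q , p ∷ qs) (All-picks ps))

All-splits2 : ∀ {P : RTerm → Set} {us} → All P us → All (λ (a , b) → All P a × All P b) (splits2 us)
All-splits2 [] = ([] , []) ∷ []
All-splits2 {us = u ∷ us} (p ∷ ps) = All-splits2-∷⁺ u us
  (All.map (λ (qs , rs) → (p ∷ qs , rs) , (qs , p ∷ rs)) (All-splits2 ps))

subst-below : ∀ {i j} N → i < j → subst j N (var i) ≡ var i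
subst-below N i<j rewrite ≢⇒≡ᵇ-false (ℕ.<⇒≢ i<j) | <⇒<ᵇ-true i<j = refl

subst-equal : ∀ j N → subst j N (var j) ≡ N
subst-equal j N rewrite ≡ᵇ-refl j = refl

subst-above : ∀ {i j} N → j ≤ i → subst j N (var (suc i)) ≡ var i
subst-above {i} {j} N j≤i rewrite ≢⇒≡ᵇ-false (ℕ.<⇒≢ (s≤s j≤i) ∘ sym) | ≥⇒<ᵇ-false (ℕ.m≤n⇒m≤1+n j≤i) = refl

mutual
  ∂-∈𝒯 : ∀ {j s us} M N → s ∈𝒯 emb M → All (_∈𝒯 emb N) us → All (_∈𝒯 emb (subst j N M)) (∂ j s us)
  ∂-∈𝒯 {j} (var i) N var ps with varView j i
  ∂-∈𝒯 {j} {us = []} (var i) N var ps | below i<j rewrite subst-below N i<j | ∂-below i<j = var ∷ []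
  ∂-∈𝒯 {j} {us = u ∷ us} (var i) N var ps | below i<j rewrite ∂-other u us (ℕ.<⇒≢ i<j) = []
  ∂-∈𝒯 {j} {us = []} (var .j) N var ps | equal rewrite ∂-equal-[] j = []
  ∂-∈𝒯 {j} {us = u ∷ []} (var .j) N var (p ∷ []) | equal rewrite subst-equal j N | ∂-equal-[_] {j} u = p ∷ []
  ∂-∈𝒯 {j} {us = u ∷ v ∷ us} (var .j) N var ps | equal rewrite ∂-equal-∷∷ j u v us = []
  ∂-∈𝒯 {j} {us = []} (var (suc i)) N var ps | above j≤i rewrite subst-above N j≤i | ∂-above j≤i = var ∷ []
  ∂-∈𝒯 {j} {us = u ∷ us} (var (suc i)) N var ps | above j≤i rewrite ∂-other u us (ℕ.<⇒≢ (s≤s j≤i) ∘ sym) = []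
  ∂-∈𝒯 (lam M) N (lam p) ps = All.map⁺ (All.map lam (∂-∈𝒯 M (shift 0 N) p (All-∈𝒯-shift 0 N ps)))
  ∂-∈𝒯 {j} {rapp s ts} {us} (app M P) N (app p qs) ps = All-combine⁺ rapp (∂ j s) (∂L j ts) us (All.map
    (λ (as , bs) → All.map (λ x → All.map (app x) (∂L-∈𝒯 P N qs bs)) (∂-∈𝒯 M N p as)) (All-splits2 ps))
  ∂-∈𝒯 (M ⊕ P) N (left p) ps = All.map⁺ (All.map left (∂-∈𝒯 M N p ps))
  ∂-∈𝒯 (M ⊕ P) N (right p) ps = All.map⁺ (All.map right (∂-∈𝒯 P N p ps))

  ∂L-∈𝒯 : ∀ {j ts us} M N → All (_∈𝒯 emb M) ts → All (_∈𝒯 emb N) us →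
    All (All (_∈𝒯 emb (subst j N M))) (∂L j ts us)
  ∂L-∈𝒯 M N [] [] = [] ∷ []
  ∂L-∈𝒯 M N [] (_ ∷ _) = []
  ∂L-∈𝒯 {j} {t ∷ ts} {us} M N (q ∷ qs) ps = All-combine⁺ _∷_ (∂ j t) (∂L j ts) us (All.map
    (λ (as , bs) → All.map (λ x → All.map (x ∷_) (∂L-∈𝒯 M N qs bs)) (∂-∈𝒯 M N q as)) (All-splits2 ps))

∑-matches-pair : ∀ {X Y : Set} (xs : List X) (ys : List Y) (f : X → ℕ) (g : Y → ℕ) {a b c d : ℕ} →
  ∑ xs f ≡ a * b → ∑ ys g ≡ c * d → ∑[ x ← xs ] ∑[ y ← ys ] (f x * g y) ≡ (a * c) * (b * d)
∑-matches-pair xs ys f g {a} {b} {c} {d} eq₁ eq₂ = trans (∑-product xs ys f g)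
  (trans (cong₂ _*_ eq₁ eq₂) (*-interchange a b c d))

-- A list term of the expansion of M[N/j] decomposes uniquely along M; q₀ lists the substituted terms in reading order.
mutual
  unsubst : ∀ {j} M N {e₀} → e₀ ∈𝒯 emb (subst j N M) → ∃ λ p₀ → ∃ λ q₀ → p₀ ∈𝒯 emb M × All (_∈𝒯 emb N) q₀ ×
    (∀ {p q} → p ∈𝒯 emb M → All (_∈𝒯 emb N) q → ∑[ e ← ∂ j p q ] matches e e₀ ≡ matches p p₀ * matchesL q q₀)
  unsubst {j} (var i) N e∈ with varView j i
  unsubst {j} (var i) N e∈ | below i<j rewrite subst-below N i<j with e∈
  ... | var = rvar i , [] , var , [] , count-eq
    where
    count-eq : ∀ {p q} → p ∈𝒯 var i → All (_∈𝒯 emb N) q →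
      ∑[ e ← ∂ j p q ] matches e (rvar i) ≡ matches p (rvar i) * matchesL q []
    count-eq {q = []} var _ rewrite ∂-below i<j = trans (ℕ.+-identityʳ _) (sym (ℕ.*-identityʳ _))
    count-eq {q = u ∷ us} var _ rewrite ∂-other u us (ℕ.<⇒≢ i<j) = sym (ℕ.*-zeroʳ (matches (rvar i) (rvar i)))
  -- The single occurrence of `j` receives all of `e₀`; for any other number of arguments than one,
  -- both sides are 0.
  unsubst {j} (var .j) N {e₀} e∈ | equal rewrite subst-equal j N = rvar j , e₀ ∷ [] , var , e∈ ∷ [] , count-eq
    where
    count-eq : ∀ {p q} → p ∈𝒯 var j → All (_∈𝒯 emb N) q →
      ∑[ e ← ∂ j p q ] matches e e₀ ≡ matches p (rvar j) * matchesL q (e₀ ∷ [])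
    count-eq {q = []} var _ rewrite ∂-equal-[] j = sym (ℕ.*-zeroʳ (matches (rvar j) (rvar j)))
    count-eq {q = u ∷ []} var _ rewrite ∂-equal-[_] {j} u | matches-var j =
      trans (cong (_+ 0) (sym (ℕ.*-identityʳ _))) (sym (ℕ.*-identityˡ _))
    count-eq {q = u ∷ v ∷ us} var _ rewrite ∂-equal-∷∷ j u v us = sym (trans
      (cong (matches (rvar j) (rvar j) *_) (matchesL-surplus u v us e₀)) (ℕ.*-zeroʳ (matches (rvar j) (rvar j))))
  unsubst {j} (var (suc i)) N e∈ | above j≤i rewrite subst-above N j≤i with e∈
  ... | var = rvar (suc i) , [] , var , [] , count-eq
    where
    count-eq : ∀ {p q} → p ∈𝒯 var (suc i) → All (_∈𝒯 emb N) q →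
      ∑[ e ← ∂ j p q ] matches e (rvar i) ≡ matches p (rvar (suc i)) * matchesL q []
    count-eq {q = []} var _ rewrite ∂-above j≤i = trans (ℕ.+-identityʳ _) (sym (ℕ.*-identityʳ _))
    count-eq {q = u ∷ us} var _ rewrite ∂-other u us (ℕ.<⇒≢ (s≤s j≤i) ∘ sym) = sym (ℕ.*-zeroʳ (matches (rvar i) (rvar i)))
  unsubst {j} (lam M) N (lam e∈) with unsubst M (shift 0 N) e∈
  ... | p₀ , q₀ , p₀∈ , q₀∈ , eq with All-∈𝒯-unshift 0 N q₀∈
  ... | q₁ , refl , q₁∈ = rlam p₀ , q₁ , lam p₀∈ , q₁∈ , λ { {rlam p} {q} (lam p∈) q∈ →
    trans (∑-map rlam (∂ (suc j) p (rshiftL 0 q)) _) (trans (eq p∈ (All-∈𝒯-shift 0 N q∈))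
      (cong (matches p p₀ *_) (matchesL-rshiftL 0 q q₁ q∈ q₁∈))) }
  unsubst {j} (app M P) N {rapp a₀ as} (app e∈ es∈) with unsubst M N e∈ | unsubstL P N es∈
  ... | p₀ , q₀ , p₀∈ , q₀∈ , eq | ps , qs , ps∈ , qs∈ , eqs =
    rapp p₀ ps , q₀ ++ qs , app p₀∈ ps∈ , All.++⁺ q₀∈ qs∈ , λ { {rapp p ts} {q} (app p∈ ts∈) q∈ → begin
      ∑[ e ← ∂ j (rapp p ts) q ] matches e (rapp a₀ as)
        ≡⟨ ∑-∂-rapp j p ts q _ ⟩
      (∑ (splits2 q) λ (a , b) → ∑[ x ← ∂ j p a ] ∑[ y ← ∂L j ts b ] (matches x a₀ * matchesL y as))
        ≡⟨ ∑-congᴬ (All-splits2 q∈) (λ (a , b) (a∈ , b∈) →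
             ∑-matches-pair (∂ j p a) (∂L j ts b) _ _ {matches p p₀} (eq p∈ a∈) (eqs ts∈ b∈)) ⟩
      (∑ (splits2 q) λ (a , b) → (matches p p₀ * matchesL ts ps) * (matchesL a q₀ * matchesL b qs))
        ≡⟨ ∑-*ˡ (splits2 q) (matches p p₀ * matchesL ts ps) _ ⟩
      (matches p p₀ * matchesL ts ps) * (∑ (splits2 q) λ (a , b) → matchesL a q₀ * matchesL b qs)
        -- Because the arguments are listed in reading order, those of an application are the
        -- concatenation of those of its parts, and the sum over divisions of `q` is the Laplace
        -- expansion of a single permanent.
        ≡⟨ cong ((matches p p₀ * matchesL ts ps) *_) (sym (matchesL-++ q q₀ qs)) ⟩
      (matches p p₀ * matchesL ts ps) * matchesL q (q₀ ++ qs) ∎ }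
  unsubst {j} (M ⊕ P) N (left e∈) with unsubst M N e∈
  ... | p₀ , q₀ , p₀∈ , q₀∈ , eq = p₀ ⊕• , q₀ , left p₀∈ , q₀∈ , λ
    { {p ⊕•} {q} (left p∈) q∈ → trans (∑-map _⊕• (∂ j p q) _) (eq p∈ q∈)
    ; {•⊕ p} {q} (right p∈) q∈ → trans (∑-map •⊕_ (∂ j p q) _) (∑-zero (∂ j p q)) }
  unsubst {j} (M ⊕ P) N (right e∈) with unsubst P N e∈
  ... | p₀ , q₀ , p₀∈ , q₀∈ , eq = •⊕ p₀ , q₀ , right p₀∈ , q₀∈ , λ
    { {•⊕ p} {q} (right p∈) q∈ → trans (∑-map •⊕_ (∂ j p q) _) (eq p∈ q∈)
    ; {p ⊕•} {q} (left p∈) q∈ → trans (∑-map _⊕• (∂ j p q) _) (∑-zero (∂ j p q)) }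

  unsubstL : ∀ {j} M N {es₀} → All (_∈𝒯 emb (subst j N M)) es₀ → ∃ λ ps₀ → ∃ λ q₀ → All (_∈𝒯 emb M) ps₀ × All (_∈𝒯 emb N) q₀ ×
    (∀ {ps q} → All (_∈𝒯 emb M) ps → All (_∈𝒯 emb N) q →
      ∑[ es ← ∂L j ps q ] matchesL es es₀ ≡ matchesL ps ps₀ * matchesL q q₀)
  unsubstL {j} M N [] = [] , [] , [] , [] , λ
    { {[]} {[]} _ _ → refl
    ; {[]} {u ∷ us} _ _ → refl
    ; {p ∷ ps} {q} _ _ → ∑-∂L-∷-zero j p ps q _ λ _ _ → refl }
  unsubstL {j} M N {a ∷ as} (e∈ ∷ es∈) with unsubst M N e∈ | unsubstL M N es∈
  ... | p₀ , q₀ , p₀∈ , q₀∈ , eq | ps₀ , qs₀ , ps₀∈ , qs₀∈ , eqs =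
    p₀ ∷ ps₀ , q₀ ++ qs₀ , p₀∈ ∷ ps₀∈ , All.++⁺ q₀∈ qs₀∈ , λ {ps} {q} ps∈ q∈ → begin
      ∑[ es ← ∂L j ps q ] matchesL es (a ∷ as)
        ≡⟨ ∑-∂L-picks j ps q _ ⟩
      (∑ (picks ps) λ (p , ps′) → ∑ (splits2 q) λ (c , d) → ∑[ x ← ∂ j p c ] ∑[ xs ← ∂L j ps′ d ] (matches x a * matchesL xs as))
        ≡⟨ ∑-congᴬ (All-picks ps∈) (λ (p , ps′) (p∈ , ps′∈) → ∑-congᴬ (All-splits2 q∈) λ (c , d) (c∈ , d∈) →
             ∑-matches-pair (∂ j p c) (∂L j ps′ d) _ _ {matches p p₀} (eq p∈ c∈) (eqs ps′∈ d∈)) ⟩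
      (∑ (picks ps) λ (p , ps′) → ∑ (splits2 q) λ (c , d) → (matches p p₀ * matchesL ps′ ps₀) * (matchesL c q₀ * matchesL d qs₀))
        ≡⟨ ∑-product (picks ps) (splits2 q) _ _ ⟩
      matchesL ps (p₀ ∷ ps₀) * (∑ (splits2 q) λ (c , d) → matchesL c q₀ * matchesL d qs₀)
        ≡⟨ cong (matchesL ps (p₀ ∷ ps₀) *_) (sym (matchesL-++ q q₀ qs₀)) ⟩
      matchesL ps (p₀ ∷ ps₀) * matchesL q (q₀ ++ qs₀) ∎

-- Hereditary head reduction

rIsVarHead : RTerm → Bool
rIsVarHead (rvar _) = true
rIsVarHead (rapp s _) = rIsVarHead s
rIsVarHead (rlam _) = false
rIsVarHead (_ ⊕•) = false
rIsVarHead (•⊕ _) = false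

-- `L` moves a choice out of an abstraction instead of reducing the choice itself, hence the body is
-- inspected before its reducts `E` are used.
underLam : RTerm → List RTerm → List RTerm
underLam (s ⊕•) _ = (rlam s ⊕•) ∷ []
underLam (•⊕ s) _ = (•⊕ rlam s) ∷ []
underLam (rvar _) E = map rlam E
underLam (rlam _) E = map rlam E
underLam (rapp _ _) E = map rlam E

-- The counterpart of L on resource terms.
mutual
  Lr : RTerm → List RTerm
  Lr (rvar i) = rvar i ∷ []
  Lr (rlam s) = underLam s (Lr s)
  Lr (rapp s ts) = Lrapp s ts
  Lr (s ⊕•) = map _⊕• (Lr s)
  Lr (•⊕ s) = map •⊕_ (Lr s)

  Lrapp : RTerm → List RTerm → List RTerm
  Lrapp (rvar i) ts = map (rapp (rvar i)) (LrL ts)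
  Lrapp (rlam s) ts = ∂ 0 s ts
  Lrapp (s ⊕•) ts = (rapp s ts ⊕•) ∷ []
  Lrapp (•⊕ s) ts = (•⊕ rapp s ts) ∷ []
  Lrapp (rapp s ss) ts = if rIsVarHead s
    then concatMap (λ x → map (rapp x) (LrL ts)) (Lrapp s ss)
    else map (λ x → rapp x ts) (Lrapp s ss)

  LrL : List RTerm → List (List RTerm)
  LrL [] = [] ∷ []
  LrL (t ∷ ts) = concatMap (λ x → map (x ∷_) (LrL ts)) (Lr t)

mutual
  -- `Lr` is a composite of reduction steps, possibly none and possibly in several arguments at
  -- once. Intermediate terms occur, so additivity is assumed everywhere and not just at `s`.
  ∑-Lr : ∀ ψ → (∀ t → Inv _⇒_ ψ t) → ∀ s → ψ s ≡ ∑ (Lr s) ψ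
  ∑-Lr ψ inv (rvar i) = sym (ℕ.+-identityʳ _)
  ∑-Lr ψ inv (rlam s) = ∑-underLam ψ inv s
  ∑-Lr ψ inv (rapp s ts) = ∑-Lrapp ψ inv s ts
  ∑-Lr ψ inv (s ⊕•) = trans (∑-Lr (ψ ∘ _⊕•) (λ t → Inv-context ⊕•-context (inv _)) s) (sym (∑-map _⊕• (Lr s) ψ))
  ∑-Lr ψ inv (•⊕ s) = trans (∑-Lr (ψ ∘ •⊕_) (λ t → Inv-context •⊕-context (inv _)) s) (sym (∑-map •⊕_ (Lr s) ψ))

  ∑-underLam : ∀ ψ → (∀ t → Inv _⇒_ ψ t) → ∀ s → ψ (rlam s) ≡ ∑ (underLam s (Lr s)) ψ
  ∑-underLam ψ inv (s ⊕•) = inv _ _ lam⊕•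
  ∑-underLam ψ inv (•⊕ s) = inv _ _ lam•⊕
  ∑-underLam ψ inv s@(rvar _) = trans (∑-Lr (ψ ∘ rlam) (λ t → Inv-context rlam-context (inv _)) s) (sym (∑-map rlam (Lr s) ψ))
  ∑-underLam ψ inv s@(rlam _) = trans (∑-Lr (ψ ∘ rlam) (λ t → Inv-context rlam-context (inv _)) s) (sym (∑-map rlam (Lr s) ψ))
  ∑-underLam ψ inv s@(rapp _ _) = trans (∑-Lr (ψ ∘ rlam) (λ t → Inv-context rlam-context (inv _)) s) (sym (∑-map rlam (Lr s) ψ))

  ∑-Lrapp : ∀ ψ → (∀ t → Inv _⇒_ ψ t) → ∀ s ts → ψ (rapp s ts) ≡ ∑ (Lrapp s ts) ψ
  ∑-Lrapp ψ inv (rvar i) ts = trans (∑-LrL (ψ ∘ rapp (rvar i)) (λ t → Inv-context (arg-context _) (inv _)) ts)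
    (sym (∑-map (rapp (rvar i)) (LrL ts) ψ))
  ∑-Lrapp ψ inv (rlam s) ts = inv _ _ β
  ∑-Lrapp ψ inv (s ⊕•) ts = inv _ _ app⊕•
  ∑-Lrapp ψ inv (•⊕ s) ts = inv _ _ app•⊕
  ∑-Lrapp ψ inv (rapp s ss) ts with rIsVarHead s
  ... | true = trans (∑-Lrapp (λ x → ψ (rapp x ts)) (λ t → Inv-context (fun-context ts) (inv _)) s ss) (trans
    (∑-cong (Lrapp s ss) λ x → ∑-LrL (ψ ∘ rapp x) (λ t → Inv-context (arg-context _) (inv _)) ts)
    (sym (∑-pairs rapp (Lrapp s ss) (LrL ts) ψ)))
  ... | false = trans (∑-Lrapp (λ x → ψ (rapp x ts)) (λ t → Inv-context (fun-context ts) (inv _)) s ss)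
    (sym (∑-map (λ x → rapp x ts) (Lrapp s ss) ψ))

  ∑-LrL : ∀ ψ → (∀ ts → Inv _⇒ᴸ_ ψ ts) → ∀ ts → ψ ts ≡ ∑ (LrL ts) ψ
  ∑-LrL ψ inv [] = sym (ℕ.+-identityʳ _)
  ∑-LrL ψ inv (t ∷ ts) = trans (∑-Lr (λ x → ψ (x ∷ ts)) (λ t → Inv-context (here-context ts) (inv _)) t) (trans
    (∑-cong (Lr t) λ x → ∑-LrL (ψ ∘ (x ∷_)) (λ t → Inv-context (there-context x) (inv _)) ts)
    (sym (∑-pairs _∷_ (Lr t) (LrL ts) ψ)))

∈𝒯-isVarHead : ∀ {s} M → s ∈𝒯 emb M → rIsVarHead s ≡ isVarHead M
∈𝒯-isVarHead (var i) var = refl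
∈𝒯-isVarHead (lam M) (lam p) = refl
∈𝒯-isVarHead (app M N) (app p _) = ∈𝒯-isVarHead M p
∈𝒯-isVarHead (M ⊕ N) (left p) = refl
∈𝒯-isVarHead (M ⊕ N) (right p) = refl

mutual
  Lr-∈𝒯 : ∀ {s} M → s ∈𝒯 emb M → All (_∈𝒯 emb (L M)) (Lr s)
  Lr-∈𝒯 (M ⊕ N) (left p) = All.map⁺ (All.map left (Lr-∈𝒯 M p))
  Lr-∈𝒯 (M ⊕ N) (right p) = All.map⁺ (All.map right (Lr-∈𝒯 N p))
  Lr-∈𝒯 (lam (M ⊕ N)) (lam (left p)) = left (lam p) ∷ []
  Lr-∈𝒯 (lam (M ⊕ N)) (lam (right p)) = right (lam p) ∷ []
  Lr-∈𝒯 (lam (var i)) (lam var) = lam var ∷ []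
  Lr-∈𝒯 (lam (lam M)) (lam p@(lam _)) = All.map⁺ (All.map lam (Lr-∈𝒯 (lam M) p))
  Lr-∈𝒯 (lam (app M N)) (lam p@(app _ _)) = All.map⁺ (All.map lam (Lr-∈𝒯 (app M N) p))
  Lr-∈𝒯 (var i) var = var ∷ []
  Lr-∈𝒯 (app M N) (app p ps) = Lrapp-∈𝒯 M N p ps

  Lrapp-∈𝒯 : ∀ {s ts} M N → s ∈𝒯 emb M → All (_∈𝒯 emb N) ts → All (_∈𝒯 emb (Lapp M N)) (Lrapp s ts)
  Lrapp-∈𝒯 (var i) N var ps = All.map⁺ (All.map (app var) (LrL-∈𝒯 N ps))
  Lrapp-∈𝒯 (lam M) N (lam p) ps = ∂-∈𝒯 M N p ps
  Lrapp-∈𝒯 (M ⊕ M′) N (left p) ps = left (app p ps) ∷ []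
  Lrapp-∈𝒯 (M ⊕ M′) N (right p) ps = right (app p ps) ∷ []
  Lrapp-∈𝒯 {rapp s ss} (app M M′) N (app p qs) ps rewrite ∈𝒯-isVarHead M p with isVarHead M
  ... | true = All-pairs⁺ rapp app (Lrapp-∈𝒯 M M′ p qs) (LrL-∈𝒯 N ps)
  ... | false = All.map⁺ (All.map (λ x → app x ps) (Lrapp-∈𝒯 M M′ p qs))

  LrL-∈𝒯 : ∀ {ts} N → All (_∈𝒯 emb N) ts → All (All (_∈𝒯 emb (L N))) (LrL ts)
  LrL-∈𝒯 N [] = [] ∷ []
  LrL-∈𝒯 N (p ∷ ps) = All-pairs⁺ _∷_ _∷_ (Lr-∈𝒯 N p) (LrL-∈𝒯 N ps)

∑-LrL-picks : ∀ ts (H : RTerm × List RTerm → ℕ) →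
  ∑[ ts′ ← LrL ts ] ∑ (picks ts′) H ≡ ∑ (picks ts) λ (t , ts′) → ∑[ x ← Lr t ] ∑[ xs ← LrL ts′ ] H (x , xs)
∑-LrL-picks [] H = refl
∑-LrL-picks (t ∷ ts) H = begin
  ∑[ ts′ ← LrL (t ∷ ts) ] ∑ (picks ts′) H
    ≡⟨ ∑-pairs _∷_ (Lr t) (LrL ts) _ ⟩
  (∑[ x ← Lr t ] ∑[ xs ← LrL ts ] ∑ (picks (x ∷ xs)) H)
    ≡⟨ trans (∑-cong (Lr t) λ x → trans (∑-cong (LrL ts) λ xs → ∑-picks-∷ x xs H) (∑-+ (LrL ts) _ _)) (∑-+ (Lr t) _ _) ⟩
  (∑[ x ← Lr t ] ∑[ xs ← LrL ts ] H (x , xs)) +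
  (∑[ x ← Lr t ] ∑[ xs ← LrL ts ] ∑ (picks xs) λ (y , ys) → H (y , x ∷ ys))
    ≡⟨ cong ((∑[ x ← Lr t ] ∑[ xs ← LrL ts ] H (x , xs)) +_) (trans
         (∑-cong (Lr t) λ x → ∑-LrL-picks ts (λ (y , ys) → H (y , x ∷ ys)))
         (trans (∑-swap (Lr t) (picks ts) _) (∑-cong (picks ts) λ (t₂ , ts₂) → trans (∑-swap (Lr t) (Lr t₂) _)
           (∑-cong (Lr t₂) λ y → sym (∑-pairs _∷_ (Lr t) (LrL ts₂) (λ zs → H (y , zs))))))) ⟩
  (∑[ x ← Lr t ] ∑[ xs ← LrL ts ] H (x , xs)) +
  (∑ (picks ts) λ (t₂ , ts₂) → ∑[ y ← Lr t₂ ] ∑[ zs ← LrL (t ∷ ts₂) ] H (y , zs))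
    ≡⟨ sym (∑-picks-∷ t ts _) ⟩
  _ ∎

private
  ∑-map-zero : ∀ (h : A → B) xs (f : B → ℕ) → (∀ x → f (h x) ≡ 0) → ∑ (map h xs) f ≡ 0
  ∑-map-zero h xs f z = trans (∑-map h xs f) (trans (∑-cong xs z) (∑-zero xs))

mutual
  -- The term `s₀` is the origin of `e₀`, chosen independently of `s`. Rules that move a choice only
  -- rearrange constructors, β is `unsubst`, and below a variable head the arguments are matched
  -- through `picks`.
  unL : ∀ M {e₀} → e₀ ∈𝒯 emb (L M) → ∃ λ s₀ → s₀ ∈𝒯 emb M ×
    (∀ {s} → s ∈𝒯 emb M → ∑[ e ← Lr s ] matches e e₀ ≡ matches s s₀)
  unL (M ⊕ N) (left {e₀} p) with unL M p
  ... | s₀ , s₀∈ , eq = s₀ ⊕• , left s₀∈ , λ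
    { {s ⊕•} (left s∈) → trans (∑-map _⊕• (Lr s) _) (eq s∈)
    ; {•⊕ s} (right s∈) → ∑-map-zero •⊕_ (Lr s) _ λ _ → refl }
  unL (M ⊕ N) (right {e₀} p) with unL N p
  ... | s₀ , s₀∈ , eq = •⊕ s₀ , right s₀∈ , λ
    { {•⊕ s} (right s∈) → trans (∑-map •⊕_ (Lr s) _) (eq s∈)
    ; {s ⊕•} (left s∈) → ∑-map-zero _⊕• (Lr s) _ λ _ → refl }
  unL (lam (M ⊕ N)) (left (lam {e₀} p)) = rlam (e₀ ⊕•) , lam (left p) , λ
    { (lam (left _)) → ℕ.+-identityʳ _ ; (lam (right _)) → refl }
  unL (lam (M ⊕ N)) (right (lam {e₀} p)) = rlam (•⊕ e₀) , lam (right p) , λ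
    { (lam (right _)) → ℕ.+-identityʳ _ ; (lam (left _)) → refl }
  unL (lam (var i)) (lam var) = rlam (rvar i) , lam var , λ { (lam var) → ℕ.+-identityʳ _ }
  unL (lam (lam M)) (lam p) with unL (lam M) p
  ... | s₀ , s₀∈ , eq = rlam s₀ , lam s₀∈ , λ
    { {rlam s@(rlam _)} (lam s∈) → trans (∑-map rlam (Lr s) _) (eq s∈) }
  unL (lam (app M N)) (lam p) with unL (app M N) p
  ... | s₀ , s₀∈ , eq = rlam s₀ , lam s₀∈ , λ
    { {rlam s@(rapp _ _)} (lam s∈) → trans (∑-map rlam (Lr s) _) (eq s∈) }
  unL (var i) var = rvar i , var , λ { var → ℕ.+-identityʳ _ }
  unL (app M N) p = unLapp M N p

  unLapp : ∀ M N {e₀} → e₀ ∈𝒯 emb (Lapp M N) → ∃ λ s₀ → s₀ ∈𝒯 emb (app M N) ×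
    (∀ {s} → s ∈𝒯 emb (app M N) → ∑[ e ← Lr s ] matches e e₀ ≡ matches s s₀)
  unLapp (var i) N {rapp _ as} (app var ps) with unLL N ps
  ... | ts₀ , ts₀∈ , eq = rapp (rvar i) ts₀ , app var ts₀∈ , λ
    { {rapp (rvar _) ts} (app var ts∈) → trans (∑-map (rapp (rvar i)) (LrL ts) _)
        (trans (∑-*ˡ (LrL ts) (matches (rvar i) (rvar i)) (λ ys → matchesL ys as)) (cong (matches (rvar i) (rvar i) *_) (eq ts∈))) }
  unLapp (lam M) N p with unsubst M N p
  ... | p₀ , q₀ , p₀∈ , q₀∈ , eq = rapp (rlam p₀) q₀ , app (lam p₀∈) q₀∈ , λ { (app (lam s∈) ts∈) → eq s∈ ts∈ }
  unLapp (M ⊕ M′) N {rapp s ts ⊕•} (left (app p ps)) = rapp (s ⊕•) ts , app (left p) ps , λ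
    { (app (left _) _) → ℕ.+-identityʳ _ ; (app (right _) _) → refl }
  unLapp (M ⊕ M′) N {•⊕ rapp s ts} (right (app p ps)) = rapp (•⊕ s) ts , app (right p) ps , λ
    { (app (right _) _) → ℕ.+-identityʳ _ ; (app (left _) _) → refl }
  unLapp (app M M′) N p with isVarHead M in head
  unLapp (app M M′) N {rapp _ as} (app p ps) | true with unLapp M M′ p | unLL N ps
  ... | s₀ , s₀∈ , eq | ts₀ , ts₀∈ , eqs = rapp s₀ ts₀ , app s₀∈ ts₀∈ , count-eq
    where
    count-eq : ∀ {s} → s ∈𝒯 emb (app (app M M′) N) → ∑[ e ← Lr s ] matches e (rapp _ as) ≡ matches s (rapp s₀ ts₀)
    count-eq {rapp (rapp s ss) ts} (app s∈@(app s∈′ _) ts∈) rewrite trans (∈𝒯-isVarHead M s∈′) head =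
      trans (∑-pairs rapp (Lrapp s ss) (LrL ts) _) (trans (∑-product (Lrapp s ss) (LrL ts) _ _) (cong₂ _*_ (eq s∈) (eqs ts∈)))
  unLapp (app M M′) N {rapp _ as} (app p ps) | false with unLapp M M′ p
  ... | s₀ , s₀∈ , eq = rapp s₀ as , app s₀∈ ps , count-eq
    where
    count-eq : ∀ {s} → s ∈𝒯 emb (app (app M M′) N) → ∑[ e ← Lr s ] matches e (rapp _ as) ≡ matches s (rapp s₀ as)
    count-eq {rapp (rapp s ss) ts} (app s∈@(app s∈′ _) ts∈) rewrite trans (∈𝒯-isVarHead M s∈′) head =
      trans (∑-map (λ x → rapp x ts) (Lrapp s ss) _) (trans (∑-*ʳ (Lrapp s ss) _ (matchesL ts as)) (cong (_* matchesL ts as) (eq s∈)))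

  unLL : ∀ N {es₀} → All (_∈𝒯 emb (L N)) es₀ → ∃ λ ts₀ → All (_∈𝒯 emb N) ts₀ ×
    (∀ {ts} → All (_∈𝒯 emb N) ts → ∑[ es ← LrL ts ] matchesL es es₀ ≡ matchesL ts ts₀)
  unLL N [] = [] , [] , λ
    { {[]} _ → refl
    ; {t ∷ ts} _ → trans (∑-pairs _∷_ (Lr t) (LrL ts) _) (trans (∑-cong (Lr t) λ _ → ∑-zero (LrL ts)) (∑-zero (Lr t))) }
  unLL N {a ∷ as} (p ∷ ps) with unL N p | unLL N ps
  ... | s₀ , s₀∈ , eq | ts₀ , ts₀∈ , eqs = s₀ ∷ ts₀ , s₀∈ ∷ ts₀∈ , λ {ts} ts∈ → trans (∑-LrL-picks ts _)
    (∑-congᴬ (All-picks ts∈) λ (t , ts′) (t∈ , ts′∈) → trans (∑-product (Lr t) (LrL ts′) _ _) (cong₂ _*_ (eq t∈) (eqs ts′∈)))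

-- Normal resource terms and termination of `Lr`

mutual
  -- Normal terms by shape. A marker can always leave an abstraction or a function position, so
  -- markers remain only in front of a head normal form, at the root or at the root of an element of
  -- a monomial.
  data Neutral : RTerm → Set where
    var : ∀ {i} → Neutral (rvar i)
    app : ∀ {s ts} → Neutral s → All Nf ts → Neutral (rapp s ts)

  data HeadNf : RTerm → Set where
    neutral : ∀ {s} → Neutral s → HeadNf s
    lam     : ∀ {s} → HeadNf s → HeadNf (rlam s)

  data Nf : RTerm → Set where
    head  : ∀ {s} → HeadNf s → Nf s
    left  : ∀ {s} → Nf s → Nf (s ⊕•)
    right : ∀ {s} → Nf s → Nf (•⊕ s)

Neutral⇒isVarHead : ∀ {s} → Neutral s → rIsVarHead s ≡ true
Neutral⇒isVarHead var = refl
Neutral⇒isVarHead (app n _) = Neutral⇒isVarHead n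

mutual
  Neutral-irreducible : ∀ {s E} → Neutral s → ¬ (s ⇒ E)
  Neutral-irreducible (app () _) β
  Neutral-irreducible (app () _) app⊕•
  Neutral-irreducible (app () _) app•⊕
  Neutral-irreducible (app n _) (fun r) = Neutral-irreducible n r
  Neutral-irreducible (app _ ns) (arg r) = Nfs-irreducible ns r

  HeadNf-irreducible : ∀ {s E} → HeadNf s → ¬ (s ⇒ E)
  HeadNf-irreducible (neutral n) r = Neutral-irreducible n r
  HeadNf-irreducible (lam (neutral ())) lam⊕•
  HeadNf-irreducible (lam (neutral ())) lam•⊕
  HeadNf-irreducible (lam h) (lam r) = HeadNf-irreducible h r

  Nf-irreducible : ∀ {s E} → Nf s → ¬ (s ⇒ E)
  Nf-irreducible (head h) r = HeadNf-irreducible h r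
  Nf-irreducible (left n) (left r) = Nf-irreducible n r
  Nf-irreducible (right n) (right r) = Nf-irreducible n r

  Nfs-irreducible : ∀ {ts Es} → All Nf ts → ¬ (ts ⇒ᴸ Es)
  Nfs-irreducible (n ∷ _) (here r) = Nf-irreducible n r
  Nfs-irreducible (_ ∷ ns) (there r) = Nfs-irreducible ns r

mutual
  Lr-Neutral : ∀ {s} → Neutral s → Lr s ≡ s ∷ []
  Lr-Neutral var = refl
  Lr-Neutral (app {rvar i} var ns) rewrite LrL-Nf ns = refl
  Lr-Neutral (app {rapp s ss} n ns) rewrite Neutral⇒isVarHead n | Lr-Neutral n | LrL-Nf ns = refl

  Lr-HeadNf : ∀ {s} → HeadNf s → Lr s ≡ s ∷ []
  Lr-HeadNf (neutral n) = Lr-Neutral n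
  Lr-HeadNf (lam {rvar _} h) rewrite Lr-HeadNf h = refl
  Lr-HeadNf (lam {rlam _} h) rewrite Lr-HeadNf h = refl
  Lr-HeadNf (lam {rapp _ _} h) rewrite Lr-HeadNf h = refl
  Lr-HeadNf (lam {_ ⊕•} (neutral ()))
  Lr-HeadNf (lam {•⊕ _} (neutral ()))

  Lr-Nf : ∀ {s} → Nf s → Lr s ≡ s ∷ []
  Lr-Nf (head h) = Lr-HeadNf h
  Lr-Nf (left n) rewrite Lr-Nf n = refl
  Lr-Nf (right n) rewrite Lr-Nf n = refl

  LrL-Nf : ∀ {ts} → All Nf ts → LrL ts ≡ ts ∷ []
  LrL-Nf [] = refl
  LrL-Nf (n ∷ ns) rewrite Lr-Nf n | LrL-Nf ns = refl

≪-trans : ∀ {a b c} → a ≪ b → b ≪ c → a ≪ c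
≪-trans (inj₁ p) (inj₁ q) = inj₁ (ℕ.<-trans p q)
≪-trans (inj₁ p) (inj₂ (refl , _)) = inj₁ p
≪-trans (inj₂ (refl , _)) (inj₁ q) = inj₁ q
≪-trans (inj₂ (refl , p)) (inj₂ (refl , q)) = inj₂ (refl , ℕ.<-trans p q)

private
  -- When one component decreases strictly, the other may already be normal and stay fixed, hence
  -- the weak order.
  _≼ᴸ_ : List RTerm → List RTerm → Set
  ss ≼ᴸ ts = ss ≡ ts ⊎ ss ≺ᴸ ts

  LrL-≼ : ∀ {ts} → All Nf ts ⊎ All (_≺ᴸ ts) (LrL ts) → All (_≼ᴸ ts) (LrL ts)
  LrL-≼ (inj₁ ns) rewrite LrL-Nf ns = inj₁ refl ∷ []
  LrL-≼ (inj₂ lts) = All.map inj₂ lts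

  ≺-rapp : ∀ {x s y ts} → x ≺ s → y ≼ᴸ ts → rapp x y ≺ rapp s ts
  ≺-rapp {x} {s} {y} lt (inj₁ refl) = ≺-fun {x} {s} y lt
  ≺-rapp {x} {s} {y} {ts} lt (inj₂ lts) = ≪-trans (≺-fun {x} {s} y lt) (≺-arg {y} {ts} s lts)

  ≺-∷ : ∀ {x s y ts} → x ≺ s → y ≼ᴸ ts → (x ∷ y) ≺ᴸ (s ∷ ts)
  ≺-∷ {x} {s} {y} lt (inj₁ refl) = ≺-here {x} {s} y lt
  ≺-∷ {x} {s} {y} {ts} lt (inj₂ lts) = ≪-trans (≺-here {x} {s} y lt) (≺-there {y} {ts} s lts)

mutual
  -- `Lr` is never idle on a reducible term: it treats the head redex, or, below a variable head,
  -- all arguments. Iterating it therefore reaches the normal form although it performs only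
  -- particular reductions.
  Lr-progress : ∀ s → Nf s ⊎ All (_≺ s) (Lr s)
  Lr-progress (rvar i) = inj₁ (head (neutral var))
  Lr-progress (rlam s) = underLam-progress s
  Lr-progress (rapp s ts) with Lrapp-progress s ts
  ... | inj₁ n = inj₁ (head (neutral n))
  ... | inj₂ lts = inj₂ lts
  Lr-progress (s ⊕•) with Lr-progress s
  ... | inj₁ n = inj₁ (left n)
  ... | inj₂ lts = inj₂ (All.map⁺ (All.map (λ {x} → ≺-⊕• {x} {s}) lts))
  Lr-progress (•⊕ s) with Lr-progress s
  ... | inj₁ n = inj₁ (right n)
  ... | inj₂ lts = inj₂ (All.map⁺ (All.map (λ {x} → ≺-•⊕ {x} {s}) lts))

  underLam-progress : ∀ s → Nf (rlam s) ⊎ All (_≺ rlam s) (underLam s (Lr s))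
  underLam-progress (s ⊕•) = inj₂ (inj₂ (refl , marker-≺-lam (height s)) ∷ [])
  underLam-progress (•⊕ s) = inj₂ (inj₂ (refl , marker-≺-lam (height s)) ∷ [])
  underLam-progress (rvar i) = inj₁ (head (lam (neutral var)))
  underLam-progress s@(rlam _) with Lr-progress s
  ... | inj₁ (head h) = inj₁ (head (lam h))
  ... | inj₂ lts = inj₂ (All.map⁺ (All.map (λ {x} → ≺-rlam {x} {s}) lts))
  underLam-progress s@(rapp _ _) with Lr-progress s
  ... | inj₁ (head h) = inj₁ (head (lam h))
  ... | inj₂ lts = inj₂ (All.map⁺ (All.map (λ {x} → ≺-rlam {x} {s}) lts))

  Lrapp-progress : ∀ s ts → Neutral (rapp s ts) ⊎ All (_≺ rapp s ts) (Lrapp s ts)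
  Lrapp-progress (rvar i) ts with LrL-progress ts
  ... | inj₁ ns = inj₁ (app var ns)
  ... | inj₂ lts = inj₂ (All.map⁺ (All.map (λ {x} → ≺-arg {x} {ts} (rvar i)) lts))
  Lrapp-progress (rlam s) ts = inj₂ (∂-≺ s ts)
  Lrapp-progress (s ⊕•) ts = inj₂ (inj₂ (refl , marker-≺-app (height s) (heightL ts)) ∷ [])
  Lrapp-progress (•⊕ s) ts = inj₂ (inj₂ (refl , marker-≺-app (height s) (heightL ts)) ∷ [])
  Lrapp-progress (rapp s ss) ts with Lrapp-progress s ss
  Lrapp-progress (rapp s ss) ts | inj₂ lts with rIsVarHead s
  ... | true = inj₂ (All-pairs⁺ rapp (λ {x} {y} → ≺-rapp {x} {rapp s ss} {y} {ts}) lts (LrL-≼ (LrL-progress ts)))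
  ... | false = inj₂ (All.map⁺ (All.map (λ {x} → ≺-fun {x} {rapp s ss} ts) lts))
  Lrapp-progress (rapp s ss) ts | inj₁ n rewrite Neutral⇒isVarHead n | Lr-Neutral n with LrL-progress ts
  ... | inj₁ ns = inj₁ (app n ns)
  ... | inj₂ lts = inj₂ (All.++⁺ (All.map⁺ (All.map (λ {x} → ≺-arg {x} {ts} (rapp s ss)) lts)) [])

  LrL-progress : ∀ ts → All Nf ts ⊎ All (_≺ᴸ ts) (LrL ts)
  LrL-progress [] = inj₁ []
  LrL-progress (t ∷ ts) with Lr-progress t | LrL-progress ts
  ... | inj₂ lts | r = inj₂ (All-pairs⁺ _∷_ (λ {x} {y} → ≺-∷ {x} {t} {y} {ts}) lts (LrL-≼ r))
  ... | inj₁ n | inj₁ ns = inj₁ (n ∷ ns)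
  ... | inj₁ n | inj₂ lts rewrite Lr-Nf n = inj₂ (All.++⁺ (All.map⁺ (All.map (λ {x} → ≺-there {x} {ts} t) lts)) [])

-- Elementary Böhm trees

Neutral⇒isVarHeadᵀ : ∀ {s} M → s ∈𝒯 emb M → Neutral s → isVarHead M ≡ true
Neutral⇒isVarHeadᵀ M p n = trans (sym (∈𝒯-isVarHead M p)) (Neutral⇒isVarHead n)

HeadNf⇒isHeadNF : ∀ {s} M → s ∈𝒯 emb M → HeadNf s → isHeadNF M ≡ true
HeadNf⇒isHeadNF (var i) var _ = refl
HeadNf⇒isHeadNF (lam M) (lam p) (lam h) = HeadNf⇒isHeadNF M p h
HeadNf⇒isHeadNF (app M N) (app p _) (neutral (app n _)) = Neutral⇒isVarHeadᵀ M p n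
HeadNf⇒isHeadNF (M ⊕ N) (left _) (neutral ())
HeadNf⇒isHeadNF (M ⊕ N) (right _) (neutral ())

mutual
  Neutral∈eBT : ∀ {s} M → s ∈𝒯 emb M → Neutral s → s ∈𝒯 eBT M
  Neutral∈eBT (var i) var n = var
  Neutral∈eBT (app M N) (app p ps) (app n ns) rewrite Neutral⇒isVarHeadᵀ M p n = app (Neutral∈eBT M p n) (Nfs∈eBT N ps ns)
  Neutral∈eBT (lam M) (lam _) ()
  Neutral∈eBT (M ⊕ N) (left _) ()
  Neutral∈eBT (M ⊕ N) (right _) ()

  HeadNf∈eBT : ∀ {s} M → s ∈𝒯 emb M → HeadNf s → s ∈𝒯 eBT M
  HeadNf∈eBT M p (neutral n) = Neutral∈eBT M p n
  HeadNf∈eBT (lam M) (lam p) (lam h) rewrite HeadNf⇒isHeadNF M p h = lam (HeadNf∈eBT M p h)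

  -- A normal term enters only those parts of `M` that are in head normal form or are sums, and
  -- these are the parts that `eBT` does not replace by ⊥. Parts replaced by ⊥ are skipped by means
  -- of empty monomials.
  Nf∈eBT : ∀ {s} M → s ∈𝒯 emb M → Nf s → s ∈𝒯 eBT M
  Nf∈eBT M p (head h) = HeadNf∈eBT M p h
  Nf∈eBT (M ⊕ N) (left p) (left n) = left (Nf∈eBT M p n)
  Nf∈eBT (M ⊕ N) (right p) (right n) = right (Nf∈eBT N p n)

  Nfs∈eBT : ∀ {ts} M → All (_∈𝒯 emb M) ts → All Nf ts → All (_∈𝒯 eBT M) ts
  Nfs∈eBT M [] [] = []
  Nfs∈eBT M (p ∷ ps) (n ∷ ns) = Nf∈eBT M p n ∷ Nfs∈eBT M ps ns

mutual
  eBT⊆𝒯 : ∀ {s} M → s ∈𝒯 eBT M → s ∈𝒯 emb M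
  eBT⊆𝒯 (var i) var = var
  eBT⊆𝒯 (lam M) p with isHeadNF M
  eBT⊆𝒯 (lam M) (lam p) | true = lam (eBT⊆𝒯 M p)
  eBT⊆𝒯 (app M N) p with isVarHead M
  eBT⊆𝒯 (app M N) (app p ps) | true = app (eBT⊆𝒯 M p) (All-eBT⊆𝒯 N ps)
  eBT⊆𝒯 (M ⊕ N) (left p) = left (eBT⊆𝒯 M p)
  eBT⊆𝒯 (M ⊕ N) (right p) = right (eBT⊆𝒯 N p)

  All-eBT⊆𝒯 : ∀ {ts} M → All (_∈𝒯 eBT M) ts → All (_∈𝒯 emb M) ts
  All-eBT⊆𝒯 M [] = []
  All-eBT⊆𝒯 M (p ∷ ps) = eBT⊆𝒯 M p ∷ All-eBT⊆𝒯 M ps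

mutual
  eBT-Neutral : ∀ {s} M → isVarHead M ≡ true → s ∈𝒯 eBT M → Neutral s
  eBT-Neutral (var i) _ var = var
  eBT-Neutral (app M N) h p rewrite h with p
  ... | app q qs = app (eBT-Neutral M h q) (eBT-Nfs N qs)

  eBT-HeadNf : ∀ {s} M → isHeadNF M ≡ true → s ∈𝒯 eBT M → HeadNf s
  eBT-HeadNf (var i) _ var = neutral var
  eBT-HeadNf (lam M) h p rewrite h with p
  ... | lam q = lam (eBT-HeadNf M h q)
  eBT-HeadNf (app M N) h p rewrite h with p
  ... | app q qs = neutral (app (eBT-Neutral M h q) (eBT-Nfs N qs))

  -- The converse direction: where `M` is not in head normal form, `eBT M` is ⊥ and its support is
  -- empty. Thus every `u` coming from the Böhm tree is fixed by `Lr`.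
  eBT-Nf : ∀ {s} M → s ∈𝒯 eBT M → Nf s
  eBT-Nf (var i) var = head (neutral var)
  eBT-Nf (lam M) p with isHeadNF M in h
  eBT-Nf (lam M) (lam p) | true = head (lam (eBT-HeadNf M h p))
  eBT-Nf (app M N) p with isVarHead M in h
  eBT-Nf (app M N) (app p ps) | true = head (neutral (app (eBT-Neutral M h p) (eBT-Nfs N ps)))
  eBT-Nf (M ⊕ N) (left p) = left (eBT-Nf M p)
  eBT-Nf (M ⊕ N) (right p) = right (eBT-Nf N p)

  eBT-Nfs : ∀ {ts} M → All (_∈𝒯 eBT M) ts → All Nf ts
  eBT-Nfs M [] = []
  eBT-Nfs M (p ∷ ps) = eBT-Nf M p ∷ eBT-Nfs M ps

mutual
  ∈𝒯-mono : ∀ {s M N} → M ≤ₐ N → s ∈𝒯 M → s ∈𝒯 N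
  ∈𝒯-mono ≤-refl p = p
  ∈𝒯-mono (≤-trans le le′) p = ∈𝒯-mono le′ (∈𝒯-mono le p)
  ∈𝒯-mono (lam≤ le) (lam p) = lam (∈𝒯-mono le p)
  ∈𝒯-mono (app≤ le le′) (app p ps) = app (∈𝒯-mono le p) (All-∈𝒯-mono le′ ps)
  ∈𝒯-mono (⊕≤ le le′) (left p) = left (∈𝒯-mono le p)
  ∈𝒯-mono (⊕≤ le le′) (right p) = right (∈𝒯-mono le′ p)

  All-∈𝒯-mono : ∀ {ts M N} → M ≤ₐ N → All (_∈𝒯 M) ts → All (_∈𝒯 N) ts
  All-∈𝒯-mono le [] = []
  All-∈𝒯-mono le (p ∷ ps) = ∈𝒯-mono le p ∷ All-∈𝒯-mono le ps

apps-∷ʳ : ∀ M Ns N → apps M (Ns ++ N ∷ []) ≡ app (apps M Ns) N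
apps-∷ʳ M [] N = refl
apps-∷ʳ M (P ∷ Ns) N = apps-∷ʳ (app M P) Ns N

mutual
  eBT-apps : ∀ M → isVarHead M ≡ true → ∃ λ x → ∃ λ Ns → eBT M ≡ apps (var x) Ns × All 𝒩 Ns
  eBT-apps (var x) _ = x , [] , refl , []
  eBT-apps (app M N) h rewrite h with eBT-apps M h
  ... | x , Ns , eq , ns = x , Ns ++ eBT N ∷ [] ,
    trans (cong (λ P → app P (eBT N)) eq) (sym (apps-∷ʳ (var x) Ns (eBT N))) , All.++⁺ ns (eBT∈𝒩 N ∷ [])

  eBT-lams : ∀ M → isHeadNF M ≡ true → ∃ λ k → ∃ λ x → ∃ λ Ns → eBT M ≡ lams k (apps (var x) Ns) × All 𝒩 Ns
  eBT-lams (var x) _ = 0 , x , [] , refl , []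
  eBT-lams (lam M) h rewrite h with eBT-lams M h
  ... | k , x , Ns , eq , ns = suc k , x , Ns , cong lam eq , ns
  eBT-lams (app M N) h = 0 , eBT-apps (app M N) h

  eBT∈𝒩 : ∀ M → 𝒩 (eBT M)
  eBT∈𝒩 (var x) = head∈𝒩 0 x [] []
  eBT∈𝒩 (lam M) with isHeadNF M in h
  ... | false = ⊥∈𝒩
  ... | true with eBT-lams M h
  ...   | k , x , Ns , eq , ns = ≡.subst 𝒩 (cong lam (sym eq)) (head∈𝒩 (suc k) x Ns ns)
  eBT∈𝒩 (app M N) with isVarHead M in h
  ... | false = ⊥∈𝒩
  ... | true with eBT-apps M h
  ...   | x , Ns , eq , ns = ≡.subst 𝒩 (sym (trans (cong (λ P → app P (eBT N)) eq) (sym (apps-∷ʳ (var x) Ns (eBT N)))))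
          (head∈𝒩 0 x (Ns ++ eBT N ∷ []) (All.++⁺ ns (eBT∈𝒩 N ∷ [])))
  eBT∈𝒩 (M ⊕ N) = ⊕∈𝒩 (eBT∈𝒩 M) (eBT∈𝒩 N)

-- Iterated hereditary head reduction

headSum : ℕ → (RTerm → ℕ) → RTerm → ℕ
headSum zero φ s = φ s
headSum (suc n) φ s = ∑ (Lr s) (headSum n φ)

AllAfter : ℕ → (RTerm → Set) → RTerm → Set
AllAfter zero P s = P s
AllAfter (suc n) P s = All (AllAfter n P) (Lr s)

headSum-inv : ∀ n ψ → (∀ t → Inv _⇒_ ψ t) → ∀ s → ψ s ≡ headSum n ψ s
headSum-inv zero ψ inv s = refl
headSum-inv (suc n) ψ inv s = trans (∑-Lr ψ inv s) (∑-cong (Lr s) (headSum-inv n ψ inv))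

headSum-Nf : ∀ n φ {s} → Nf s → headSum n φ s ≡ φ s
headSum-Nf zero φ n = refl
headSum-Nf (suc k) φ {s} n rewrite Lr-Nf n = trans (ℕ.+-identityʳ _) (headSum-Nf k φ n)

headSum-+ : ∀ m n φ s → headSum (m + n) φ s ≡ headSum m (headSum n φ) s
headSum-+ zero n φ s = refl
headSum-+ (suc m) n φ s = ∑-cong (Lr s) (headSum-+ m n φ)

headSum-cong : ∀ n {P : RTerm → Set} {φ ψ : RTerm → ℕ} → (∀ s → P s → φ s ≡ ψ s) → ∀ {s} → AllAfter n P s →
  headSum n φ s ≡ headSum n ψ s
headSum-cong zero eq p = eq _ p
headSum-cong (suc n) eq ps = ∑-congᴬ ps λ s p → headSum-cong n eq p

AllAfter-zip : ∀ n {P Q : RTerm → Set} {s} → AllAfter n P s → AllAfter n Q s → AllAfter n (λ s → P s × Q s) s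
AllAfter-zip zero p q = p , q
AllAfter-zip (suc n) ps qs = All.map (λ (p , q) → AllAfter-zip n p q) (All.zip (ps , qs))

-- `Lⁿ` adds new steps at the end, whereas `headSum` and `AllAfter` unfold from the first step.
Lⁿ-tail : ∀ n M → Lⁿ (suc n) M ≡ Lⁿ n (L M)
Lⁿ-tail zero M = refl
Lⁿ-tail (suc n) M = cong L (Lⁿ-tail n M)

Lⁿ-+ : ∀ m n M → Lⁿ (m + n) M ≡ Lⁿ n (Lⁿ m M)
Lⁿ-+ zero n M = refl
Lⁿ-+ (suc m) n M = trans (Lⁿ-tail (m + n) M) (trans (Lⁿ-+ m n (L M)) (cong (Lⁿ n) (sym (Lⁿ-tail m M))))

AllAfter-∈𝒯 : ∀ n M {s} → s ∈𝒯 emb M → AllAfter n (_∈𝒯 emb (Lⁿ n M)) s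
AllAfter-∈𝒯 zero M p = p
AllAfter-∈𝒯 (suc n) M p rewrite Lⁿ-tail n M = All.map (AllAfter-∈𝒯 n (L M)) (Lr-∈𝒯 M p)

-- Origins compose: since the origin for one step does not depend on `s`, the equation for the later
-- steps may be applied to all summands of the first step at once.
unLⁿ : ∀ n M {e₀} → e₀ ∈𝒯 emb (Lⁿ n M) → ∃ λ s₀ → s₀ ∈𝒯 emb M ×
  (∀ {s} → s ∈𝒯 emb M → headSum n (λ e → matches e e₀) s ≡ matches s s₀)
unLⁿ zero M {e₀} p = e₀ , p , λ _ → refl
unLⁿ (suc n) M p rewrite Lⁿ-tail n M with unLⁿ n (L M) p
... | s₁ , s₁∈ , eq₁ with unL M s₁∈
... | s₀ , s₀∈ , eq₀ = s₀ , s₀∈ , λ s∈ → trans (∑-congᴬ (Lr-∈𝒯 M s∈) λ _ → eq₁) (eq₀ s∈)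

Nf-∈𝒯-L : ∀ n M {u} → Nf u → u ∈𝒯 emb M → u ∈𝒯 emb (Lⁿ n M)
Nf-∈𝒯-L zero M nu p = p
Nf-∈𝒯-L (suc n) M nu p = All.head (≡.subst (All _) (Lr-Nf nu) (Lr-∈𝒯 (Lⁿ n M) (Nf-∈𝒯-L n M nu p)))

AllAfter-suc : ∀ n {s} → AllAfter n Nf s → AllAfter (suc n) Nf s
AllAfter-suc zero n rewrite Lr-Nf n = n ∷ []
AllAfter-suc (suc n) ps = All.map (AllAfter-suc n) ps

-- Normal terms are fixed by `Lr`, so further steps do no harm. This allows a common bound for
-- several terms.
AllAfter-≤ : ∀ {m n} → m ≤ n → ∀ {s} → AllAfter m Nf s → AllAfter n Nf s
AllAfter-≤ {m} m≤n p with ℕ.m≤n⇒∃[o]m+o≡n m≤n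
... | o , refl = go o p
  where
  go : ∀ o {s} → AllAfter m Nf s → AllAfter (m + o) Nf s
  go zero p rewrite ℕ.+-identityʳ m = p
  go (suc o) p rewrite ℕ.+-suc m o = AllAfter-suc (m + o) (go o p)

Lr-terminates : ∀ s → Acc _≺_ s → ∃ λ n → AllAfter n Nf s
Lr-terminates s (acc rs) with Lr-progress s
... | inj₁ n = 0 , n
... | inj₂ lts with bound (All.map (λ {x} lt → Lr-terminates x (rs lt)) lts)
  where
  bound : ∀ {E} → All (λ x → ∃ λ n → AllAfter n Nf x) E → ∃ λ n → All (AllAfter n Nf) E
  bound [] = 0 , []
  bound ((m , p) ∷ ps) with bound ps
  ... | n , qs = m ⊔ n , AllAfter-≤ (ℕ.m≤m⊔n m n) p ∷ All.map (AllAfter-≤ (ℕ.m≤n⊔m m n)) qs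
...   | n , ps = suc n , ps

headSum-support : ∀ n M {s φ} → s ∈𝒯 emb M → AllAfter n Nf s → headSum n φ s ≢ 0 →
  ∃ λ e → e ∈𝒯 emb (Lⁿ n M) × Nf e × φ e ≢ 0
headSum-support zero M {s} p nf ≢0 = s , p , nf , ≢0
headSum-support (suc n) M {s} {φ} p ps ≢0 rewrite Lⁿ-tail n M = go (All.zip (Lr-∈𝒯 M p , ps)) ≢0
  where
  go : ∀ {E} → All (λ e → e ∈𝒯 emb (L M) × AllAfter n Nf e) E → ∑ E (headSum n φ) ≢ 0 →
    ∃ λ e → e ∈𝒯 emb (Lⁿ n (L M)) × Nf e × φ e ≢ 0
  go [] ≢0 = contradiction refl ≢0
  go {e ∷ E} ((q , r) ∷ qs) ≢0 with headSum n φ e ℕ.≟ 0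
  ... | no e≢0 = headSum-support n (L M) q r e≢0
  ... | yes e≡0 = go qs (λ eq → ≢0 (cong₂ _+_ e≡0 eq))

-- The order on resource terms

flip : Cmp → Cmp
flip LT = GT
flip EQ = EQ
flip GT = LT

cmpℕ-< : ∀ {m n} → m < n → cmpℕ m n ≡ LT
cmpℕ-< m<n rewrite <⇒<ᵇ-true m<n = refl

cmpℕ-> : ∀ {m n} → n < m → cmpℕ m n ≡ GT
cmpℕ-> n<m rewrite ≥⇒<ᵇ-false (ℕ.<⇒≤ n<m) | ≢⇒≡ᵇ-false (ℕ.<⇒≢ n<m ∘ sym) = refl

cmpℕ-refl : ∀ n → cmpℕ n n ≡ EQ
cmpℕ-refl n rewrite ≥⇒<ᵇ-false (ℕ.≤-refl {n}) | ≡ᵇ-refl n = refl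

cmpℕ-flip : ∀ m n → cmpℕ n m ≡ flip (cmpℕ m n)
cmpℕ-flip m n with ℕ.<-cmp m n
... | tri< m<n _ _ rewrite cmpℕ-< m<n = cmpℕ-> m<n
... | tri≈ _ refl _ rewrite cmpℕ-refl m = refl
... | tri> _ _ n<m rewrite cmpℕ-> n<m = cmpℕ-< n<m

cmpℕ-EQ : ∀ m n → cmpℕ m n ≡ EQ → m ≡ n
cmpℕ-EQ m n eq with ℕ.<-cmp m n
... | tri< m<n _ _ with () ← trans (sym eq) (cmpℕ-< m<n)
... | tri≈ _ m≡n _ = m≡n
... | tri> _ _ n<m with () ← trans (sym eq) (cmpℕ-> n<m)

cmpℕ-LT : ∀ m n → cmpℕ m n ≡ LT → m < n
cmpℕ-LT m n eq with ℕ.<-cmp m n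
... | tri< m<n _ _ = m<n
... | tri≈ _ refl _ with () ← trans (sym eq) (cmpℕ-refl m)
... | tri> _ _ n<m with () ← trans (sym eq) (cmpℕ-> n<m)

-- Five diagonal cases and one for the twenty pairs with different root constructors; `diff` stores
-- all that is ever used about those.
data TagView : RTerm → RTerm → Set where
  var   : ∀ {i j} → TagView (rvar i) (rvar j)
  lam   : ∀ {s t} → TagView (rlam s) (rlam t)
  app   : ∀ {s ss t ts} → TagView (rapp s ss) (rapp t ts)
  left  : ∀ {s t} → TagView (s ⊕•) (t ⊕•)
  right : ∀ {s t} → TagView (•⊕ s) (•⊕ t)
  diff  : ∀ {s t} → tag s ≢ tag t → cmp s t ≡ cmpℕ (tag s) (tag t) → matches s t ≡ 0 → TagView s t

tagView : ∀ s t → TagView s t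
tagView (rvar _) (rvar _) = var
tagView (rvar _) (rlam _) = diff (λ ()) refl refl
tagView (rvar _) (rapp _ _) = diff (λ ()) refl refl
tagView (rvar _) (_ ⊕•) = diff (λ ()) refl refl
tagView (rvar _) (•⊕ _) = diff (λ ()) refl refl
tagView (rlam _) (rvar _) = diff (λ ()) refl refl
tagView (rlam _) (rlam _) = lam
tagView (rlam _) (rapp _ _) = diff (λ ()) refl refl
tagView (rlam _) (_ ⊕•) = diff (λ ()) refl refl
tagView (rlam _) (•⊕ _) = diff (λ ()) refl refl
tagView (rapp _ _) (rvar _) = diff (λ ()) refl refl
tagView (rapp _ _) (rlam _) = diff (λ ()) refl refl
tagView (rapp _ _) (rapp _ _) = app
tagView (rapp _ _) (_ ⊕•) = diff (λ ()) refl refl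
tagView (rapp _ _) (•⊕ _) = diff (λ ()) refl refl
tagView (_ ⊕•) (rvar _) = diff (λ ()) refl refl
tagView (_ ⊕•) (rlam _) = diff (λ ()) refl refl
tagView (_ ⊕•) (rapp _ _) = diff (λ ()) refl refl
tagView (_ ⊕•) (_ ⊕•) = left
tagView (_ ⊕•) (•⊕ _) = diff (λ ()) refl refl
tagView (•⊕ _) (rvar _) = diff (λ ()) refl refl
tagView (•⊕ _) (rlam _) = diff (λ ()) refl refl
tagView (•⊕ _) (rapp _ _) = diff (λ ()) refl refl
tagView (•⊕ _) (_ ⊕•) = diff (λ ()) refl refl
tagView (•⊕ _) (•⊕ _) = right

mutual
  cmp-refl : ∀ s → cmp s s ≡ EQ
  cmp-refl (rvar i) = cmpℕ-refl i
  cmp-refl (rlam s) = cmp-refl s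
  cmp-refl (rapp s ts) rewrite cmp-refl s = cmpL-refl ts
  cmp-refl (s ⊕•) = cmp-refl s
  cmp-refl (•⊕ s) = cmp-refl s

  cmpL-refl : ∀ ts → cmpL ts ts ≡ EQ
  cmpL-refl [] = refl
  cmpL-refl (t ∷ ts) rewrite cmp-refl t = cmpL-refl ts

cmp-diff : ∀ s t → tag s ≢ tag t → cmp s t ≡ cmpℕ (tag s) (tag t)
cmp-diff s t ne with tagView s t
... | var = contradiction refl ne
... | lam = contradiction refl ne
... | app = contradiction refl ne
... | left = contradiction refl ne
... | right = contradiction refl ne
... | diff _ eq _ = eq

mutual
  cmp-EQ : ∀ s t → cmp s t ≡ EQ → s ≡ t
  cmp-EQ s t eq with tagView s t
  cmp-EQ (rvar i) (rvar j) eq | var = cong rvar (cmpℕ-EQ i j eq)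
  cmp-EQ (rlam s) (rlam t) eq | lam = cong rlam (cmp-EQ s t eq)
  cmp-EQ (rapp s ss) (rapp t ts) eq | app with cmp s t in e
  ... | EQ = cong₂ rapp (cmp-EQ s t e) (cmpL-EQ ss ts eq)
  cmp-EQ (s ⊕•) (t ⊕•) eq | left = cong _⊕• (cmp-EQ s t eq)
  cmp-EQ (•⊕ s) (•⊕ t) eq | right = cong •⊕_ (cmp-EQ s t eq)
  cmp-EQ s t eq | diff ne e _ = contradiction (cmpℕ-EQ (tag s) (tag t) (trans (sym e) eq)) ne

  cmpL-EQ : ∀ ss ts → cmpL ss ts ≡ EQ → ss ≡ ts
  cmpL-EQ [] [] eq = refl
  cmpL-EQ (s ∷ ss) (t ∷ ts) eq with cmp s t in e
  ... | EQ = cong₂ _∷_ (cmp-EQ s t e) (cmpL-EQ ss ts eq)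

mutual
  cmp-flip : ∀ s t → cmp t s ≡ flip (cmp s t)
  cmp-flip s t with tagView s t
  cmp-flip (rvar i) (rvar j) | var = cmpℕ-flip i j
  cmp-flip (rlam s) (rlam t) | lam = cmp-flip s t
  cmp-flip (rapp s ss) (rapp t ts) | app with cmp s t | cmp t s | cmp-flip s t
  ... | LT | _ | refl = refl
  ... | EQ | _ | refl = cmpL-flip ss ts
  ... | GT | _ | refl = refl
  cmp-flip (s ⊕•) (t ⊕•) | left = cmp-flip s t
  cmp-flip (•⊕ s) (•⊕ t) | right = cmp-flip s t
  cmp-flip s t | diff ne e _ = trans (cmp-diff t s (ne ∘ sym)) (trans (cmpℕ-flip (tag s) (tag t)) (cong flip (sym e)))

  cmpL-flip : ∀ ss ts → cmpL ts ss ≡ flip (cmpL ss ts)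
  cmpL-flip [] [] = refl
  cmpL-flip [] (_ ∷ _) = refl
  cmpL-flip (_ ∷ _) [] = refl
  cmpL-flip (s ∷ ss) (t ∷ ts) with cmp s t | cmp t s | cmp-flip s t
  ... | LT | _ | refl = refl
  ... | EQ | _ | refl = cmpL-flip ss ts
  ... | GT | _ | refl = refl

cmp-tag : ∀ s t → cmp s t ≡ LT → tag s ≤ tag t
cmp-tag s t eq with tagView s t
... | var = ℕ.≤-refl
... | lam = ℕ.≤-refl
... | app = ℕ.≤-refl
... | left = ℕ.≤-refl
... | right = ℕ.≤-refl
... | diff _ e _ = ℕ.<⇒≤ (cmpℕ-LT (tag s) (tag t) (trans (sym e) eq))

tag-cmp : ∀ s t → tag s < tag t → cmp s t ≡ LT
tag-cmp s t lt = trans (cmp-diff s t (ℕ.<⇒≢ lt)) (cmpℕ-< lt)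

private
  lex : Cmp → Cmp → Cmp
  lex EQ d = d
  lex LT _ = LT
  lex GT _ = GT

  cmp-rapp : ∀ s ss t ts → cmp (rapp s ss) (rapp t ts) ≡ lex (cmp s t) (cmpL ss ts)
  cmp-rapp s ss t ts with cmp s t
  ... | LT = refl
  ... | EQ = refl
  ... | GT = refl

  cmpL-∷ : ∀ s ss t ts → cmpL (s ∷ ss) (t ∷ ts) ≡ lex (cmp s t) (cmpL ss ts)
  cmpL-∷ s ss t ts with cmp s t
  ... | LT = refl
  ... | EQ = refl
  ... | GT = refl

  lex-LT : ∀ {c d} → lex c d ≡ LT → c ≡ LT ⊎ (c ≡ EQ × d ≡ LT)
  lex-LT {LT} _ = inj₁ refl
  lex-LT {EQ} eq = inj₂ (refl , eq)

mutual
  cmp-trans : ∀ s t u → cmp s t ≡ LT → cmp t u ≡ LT → cmp s u ≡ LT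
  cmp-trans s t u p q with tagView s t | tagView t u
  ... | diff ne _ _ | _ = tag-cmp s u (ℕ.<-≤-trans (ℕ.≤∧≢⇒< (cmp-tag s t p) ne) (cmp-tag t u q))
  ... | var | diff ne _ _ = tag-cmp s u (ℕ.≤∧≢⇒< (cmp-tag t u q) ne)
  ... | lam | diff ne _ _ = tag-cmp s u (ℕ.≤∧≢⇒< (cmp-tag t u q) ne)
  ... | app | diff ne _ _ = tag-cmp s u (ℕ.≤∧≢⇒< (cmp-tag t u q) ne)
  ... | left | diff ne _ _ = tag-cmp s u (ℕ.≤∧≢⇒< (cmp-tag t u q) ne)
  ... | right | diff ne _ _ = tag-cmp s u (ℕ.≤∧≢⇒< (cmp-tag t u q) ne)
  cmp-trans (rvar i) (rvar j) (rvar k) p q | var | var = cmpℕ-< (ℕ.<-trans (cmpℕ-LT i j p) (cmpℕ-LT j k q))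
  cmp-trans (rlam s) (rlam t) (rlam u) p q | lam | lam = cmp-trans s t u p q
  cmp-trans (rapp s ss) (rapp t ts) (rapp u us) p q | app | app = trans (cmp-rapp s ss u us)
    (lex-trans s t u ss ts us (trans (sym (cmp-rapp s ss t ts)) p) (trans (sym (cmp-rapp t ts u us)) q))
  cmp-trans (s ⊕•) (t ⊕•) (u ⊕•) p q | left | left = cmp-trans s t u p q
  cmp-trans (•⊕ s) (•⊕ t) (•⊕ u) p q | right | right = cmp-trans s t u p q

  lex-trans : ∀ s t u ss ts us → lex (cmp s t) (cmpL ss ts) ≡ LT → lex (cmp t u) (cmpL ts us) ≡ LT →
    lex (cmp s u) (cmpL ss us) ≡ LT
  lex-trans s t u ss ts us p q with lex-LT p | lex-LT q
  ... | inj₁ a | inj₁ b = cong (λ c → lex c _) (cmp-trans s t u a b)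
  ... | inj₁ a | inj₂ (b , _) = cong (λ c → lex c _) (trans (cong (cmp s) (sym (cmp-EQ t u b))) a)
  ... | inj₂ (a , _) | inj₁ b = cong (λ c → lex c _) (trans (cong (λ x → cmp x u) (cmp-EQ s t a)) b)
  ... | inj₂ (a , x) | inj₂ (b , y) = trans (cong (λ c → lex c _) (trans (cong (cmp s) (sym (cmp-EQ t u b))) a))
    (cmpL-trans ss ts us x y)

  cmpL-trans : ∀ ss ts us → cmpL ss ts ≡ LT → cmpL ts us ≡ LT → cmpL ss us ≡ LT
  cmpL-trans [] (_ ∷ _) (_ ∷ _) p q = refl
  cmpL-trans (s ∷ ss) (t ∷ ts) (u ∷ us) p q = trans (cmpL-∷ s ss u us)
    (lex-trans s t u ss ts us (trans (sym (cmpL-∷ s ss t ts)) p) (trans (sym (cmpL-∷ t ts u us)) q))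

-- Sorted lists as multisets

insert-> : ∀ {s t} ts → cmp s t ≡ GT → insert s (t ∷ ts) ≡ t ∷ insert s ts
insert-> ts eq rewrite eq = refl

insert-≤ : ∀ {s t} ts → cmp s t ≢ GT → insert s (t ∷ ts) ≡ s ∷ t ∷ ts
insert-≤ {s} {t} ts ≢GT with cmp s t
... | LT = refl
... | EQ = refl
... | GT = contradiction refl ≢GT

private
  <⇒> : ∀ {a b} → cmp a b ≡ LT → cmp b a ≡ GT
  <⇒> {a} {b} lt = trans (cmp-flip a b) (cong flip lt)

  ≡LT⇒≢GT : ∀ {c} → c ≡ LT → c ≢ GT
  ≡LT⇒≢GT refl ()

  ≡EQ⇒≢GT : ∀ {c} → c ≡ EQ → c ≢ GT
  ≡EQ⇒≢GT refl ()

  <-≤-trans : ∀ {a b c} → cmp a b ≡ LT → cmp b c ≢ GT → cmp a c ≡ LT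
  <-≤-trans {a} {b} {c} lt ≢GT with cmp b c in e
  ... | LT = cmp-trans a b c lt e
  ... | EQ = trans (cong (cmp a) (sym (cmp-EQ b c e))) lt
  ... | GT = contradiction refl ≢GT

  insert-comm-< : ∀ a b l → cmp a b ≡ LT → insert a (insert b l) ≡ insert b (insert a l)
  insert-comm-< a b [] lt = trans (insert-≤ [] (≡LT⇒≢GT lt)) (sym (insert-> [] (<⇒> {a} lt)))
  insert-comm-< a b (c ∷ l) lt with cmp b c in bc
  ... | GT with cmp a c in ac
  ...   | GT rewrite bc = cong (c ∷_) (insert-comm-< a b l lt)
  ...   | LT rewrite <⇒> {a} lt | bc = refl
  ...   | EQ rewrite <⇒> {a} lt | bc = refl
  insert-comm-< a b (c ∷ l) lt | LT
    rewrite lt | cmp-trans a b c lt bc | <⇒> {a} lt | bc = refl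
  insert-comm-< a b (c ∷ l) lt | EQ
    rewrite lt | <-≤-trans {a} {b} {c} lt (≡EQ⇒≢GT bc) | <⇒> {a} lt | bc = refl

-- This is what makes `sort` depend on the multiset alone. It uses that `cmp` is a strict total
-- order whose `EQ` is equality.
insert-comm : ∀ a b l → insert a (insert b l) ≡ insert b (insert a l)
insert-comm a b l with cmp a b in e
... | LT = insert-comm-< a b l e
... | EQ rewrite cmp-EQ a b e = refl
... | GT = sym (insert-comm-< b a l (trans (cmp-flip a b) (cong flip e)))

private
  >⇒≢ : ∀ {a x} → cmp a x ≡ GT → x ≢ a
  >⇒≢ {a} gt refl with () ← trans (sym gt) (cmp-refl a)

-- Cancellation in multisets: once an element has been matched, it can be removed on both sides and
-- the remaining bags are still equal.
insert-injective : ∀ a l l′ → insert a l ≡ insert a l′ → l ≡ l′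
insert-injective a [] [] _ = refl
insert-injective a [] (y ∷ l′) eq with cmp a y
insert-injective a [] (y ∷ []) () | GT
insert-injective a [] (y ∷ z ∷ l′) eq | GT with cmp a z
insert-injective a [] (y ∷ z ∷ l′) () | GT | GT
insert-injective a [] (y ∷ z ∷ l′) () | GT | LT
insert-injective a [] (y ∷ z ∷ l′) () | GT | EQ
insert-injective a (x ∷ l) [] eq with cmp a x
insert-injective a (x ∷ []) [] () | GT
insert-injective a (x ∷ z ∷ l) [] eq | GT with cmp a z
insert-injective a (x ∷ z ∷ l) [] () | GT | GT
insert-injective a (x ∷ z ∷ l) [] () | GT | LT
insert-injective a (x ∷ z ∷ l) [] () | GT | EQ
insert-injective a (x ∷ l) (y ∷ l′) eq with cmp a x in ax | cmp a y in ay
... | GT | GT = cong₂ _∷_ (List.∷-injectiveˡ eq) (insert-injective a l l′ (List.∷-injectiveʳ eq))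
... | GT | LT = contradiction (List.∷-injectiveˡ eq) (>⇒≢ ax)
... | GT | EQ = contradiction (List.∷-injectiveˡ eq) (>⇒≢ ax)
... | LT | GT = contradiction (sym (List.∷-injectiveˡ eq)) (>⇒≢ ay)
... | EQ | GT = contradiction (sym (List.∷-injectiveˡ eq)) (>⇒≢ ay)
... | LT | LT = List.∷-injectiveʳ eq
... | LT | EQ = List.∷-injectiveʳ eq
... | EQ | LT = List.∷-injectiveʳ eq
... | EQ | EQ = List.∷-injectiveʳ eq

-- Multiplicities

infix 4 _∼_ _∼?_
_∼_ : RTerm → RTerm → Set
s ∼ t = canon s ≡ canon t

_∼?_ : ∀ s t → Dec (s ∼ t)
s ∼? t with cmp (canon s) (canon t) in eq
... | EQ = yes (cmp-EQ (canon s) (canon t) eq)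
... | LT = no λ s∼t → contradiction (trans (sym eq) (trans (cong (cmp (canon s)) (sym s∼t)) (cmp-refl (canon s)))) λ ()
... | GT = no λ s∼t → contradiction (trans (sym eq) (trans (cong (cmp (canon s)) (sym s∼t)) (cmp-refl (canon s)))) λ ()

==-true : ∀ s t → s ∼ t → (s == t) ≡ true
==-true s t s∼t rewrite s∼t | cmp-refl (canon t) = refl

==⇒∼ : ∀ s t → (s == t) ≡ true → s ∼ t
==⇒∼ s t eq with cmp (canon s) (canon t) in e
... | EQ = cmp-EQ (canon s) (canon t) e

==-false : ∀ s t → ¬ (s ∼ t) → (s == t) ≡ false
==-false s t s≁t with s == t in eq
... | true = contradiction (==⇒∼ s t eq) s≁t
... | false = refl

==-false⁻ : ∀ s t → (s == t) ≡ false → ¬ (s ∼ t)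
==-false⁻ s t eq s∼t with () ← trans (sym eq) (==-true s t s∼t)

-- The canonical form of a monomial: equality of bags is equality of multisets of resource terms.
bag : List RTerm → List RTerm
bag ts = sort (canonL ts)

∑-insert : ∀ a l (f : RTerm → ℕ) → ∑ (insert a l) f ≡ f a + ∑ l f
∑-insert a [] f = refl
∑-insert a (x ∷ l) f with cmp a x
... | LT = refl
... | EQ = refl
... | GT = begin
  f x + ∑ (insert a l) f ≡⟨ cong (f x +_) (∑-insert a l f) ⟩
  f x + (f a + ∑ l f)   ≡⟨ sym (ℕ.+-assoc (f x) (f a) _) ⟩
  (f x + f a) + ∑ l f   ≡⟨ cong (_+ ∑ l f) (ℕ.+-comm (f x) (f a)) ⟩
  (f a + f x) + ∑ l f   ≡⟨ ℕ.+-assoc (f a) (f x) _ ⟩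
  f a + (f x + ∑ l f)   ∎

∑-bag : ∀ ts (f : RTerm → ℕ) → ∑ (bag ts) f ≡ ∑ ts (f ∘ canon)
∑-bag [] f = refl
∑-bag (t ∷ ts) f = trans (∑-insert (canon t) (bag ts) f) (cong (f (canon t) +_) (∑-bag ts f))

All-picks-bag : ∀ ts → All (λ (t , ts′) → bag ts ≡ insert (canon t) (bag ts′)) (picks ts)
All-picks-bag [] = []
All-picks-bag (x ∷ ts) = refl ∷ All.map⁺ (All.map (λ {(t , ts′)} eq →
  trans (cong (insert (canon x)) eq) (insert-comm (canon x) (canon t) (bag ts′))) (All-picks-bag ts))

δ : RTerm → RTerm → ℕ
δ u t = if u == t then 1 else 0

δ-∼ : ∀ u t → u ∼ t → δ u t ≡ 1
δ-∼ u t u∼t rewrite ==-true u t u∼t = refl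

δ-≁ : ∀ u t → ¬ (u ∼ t) → δ u t ≡ 0
δ-≁ u t u≁t rewrite ==-false u t u≁t = refl

private
  isEQ : Cmp → ℕ
  isEQ EQ = 1
  isEQ _ = 0

  δ-cmp : ∀ u t → δ u t ≡ isEQ (cmp (canon u) (canon t))
  δ-cmp u t with cmp (canon u) (canon t)
  ... | LT = refl
  ... | EQ = refl
  ... | GT = refl

count-∑ : ∀ u ts → count u ts ≡ ∑ ts (δ u)
count-∑ u [] = refl
count-∑ u (t ∷ ts) with u == t
... | true = cong suc (count-∑ u ts)
... | false = count-∑ u ts

-- Both arguments of `count` are replaced by their canonical forms, from which the invariance of
-- `count` can be read off.
count-bag : ∀ u ts → count u ts ≡ ∑[ c ← bag ts ] isEQ (cmp (canon u) c)
count-bag u ts = trans (count-∑ u ts) (trans (∑-cong ts (δ-cmp u)) (sym (∑-bag ts _)))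

count-cong : ∀ {u v} ss ts → u ∼ v → bag ss ≡ bag ts → count u ss ≡ count v ts
count-cong {u} {v} ss ts u∼v eq = trans (count-bag u ss) (trans
  (cong₂ (λ c l → ∑[ x ← l ] isEQ (cmp c x)) u∼v eq) (sym (count-bag v ts)))

count-∷-∼ : ∀ {u t} ts → u ∼ t → count u (t ∷ ts) ≡ suc (count u ts)
count-∷-∼ {u} {t} ts u∼t rewrite ==-true u t u∼t = refl

count-∷-≁ : ∀ {u t} ts → ¬ (u ∼ t) → count u (t ∷ ts) ≡ count u ts
count-∷-≁ {u} {t} ts u≁t rewrite ==-false u t u≁t = refl

∏ : List RTerm → (RTerm → ℕ) → ℕ
∏ ts g = foldr _*_ 1 (map g ts)

∏-congᴬ : ∀ {P : RTerm → Set} {ts g h} → All P ts → (∀ t → P t → g t ≡ h t) → ∏ ts g ≡ ∏ ts h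
∏-congᴬ [] eq = refl
∏-congᴬ (p ∷ ps) eq = cong₂ _*_ (eq _ p) (∏-congᴬ ps eq)

others : RTerm → List RTerm → List RTerm
others t ts = filterᵇ (λ t′ → not (t == t′)) ts

All-others : ∀ t ts → All (λ d → ¬ (t ∼ d)) (others t ts)
All-others t [] = []
All-others t (x ∷ ts) with t == x in eq
... | true = All-others t ts
... | false = ==-false⁻ t x eq ∷ All-others t ts

∏-others : ∀ t ts (g : RTerm → ℕ) → (∀ {d} → t ∼ d → g d ≡ g t) → ∏ ts g ≡ g t ^ count t ts * ∏ (others t ts) g
∏-others t [] g inv = refl
∏-others t (x ∷ ts) g inv with t == x in eq
... | true = trans (cong₂ _*_ (inv (==⇒∼ t x eq)) (∏-others t ts g inv)) (sym (ℕ.*-assoc (g t) _ _))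
... | false = begin
  g x * ∏ ts g                                         ≡⟨ cong (g x *_) (∏-others t ts g inv) ⟩
  g x * (g t ^ count t ts * ∏ (others t ts) g)        ≡⟨ sym (ℕ.*-assoc (g x) (g t ^ count t ts) _) ⟩
  (g x * g t ^ count t ts) * ∏ (others t ts) g        ≡⟨ cong (_* ∏ (others t ts) g) (ℕ.*-comm (g x) (g t ^ count t ts)) ⟩
  (g t ^ count t ts * g x) * ∏ (others t ts) g        ≡⟨ ℕ.*-assoc (g t ^ count t ts) (g x) _ ⟩
  g t ^ count t ts * (g x * ∏ (others t ts) g)        ∎

∑-others : ∀ t ts (g : RTerm → ℕ) → (∀ {d} → t ∼ d → g d ≡ g t) → ∑ ts g ≡ count t ts * g t + ∑ (others t ts) g
∑-others t [] g inv = refl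
∑-others t (x ∷ ts) g inv with t == x in eq
... | true = trans (cong₂ _+_ (inv (==⇒∼ t x eq)) (∑-others t ts g inv)) (sym (ℕ.+-assoc (g t) _ _))
... | false = begin
  g x + ∑ ts g                                         ≡⟨ cong (g x +_) (∑-others t ts g inv) ⟩
  g x + (count t ts * g t + ∑ (others t ts) g)       ≡⟨ sym (ℕ.+-assoc (g x) (count t ts * g t) _) ⟩
  (g x + count t ts * g t) + ∑ (others t ts) g       ≡⟨ cong (_+ ∑ (others t ts) g) (ℕ.+-comm (g x) (count t ts * g t)) ⟩
  (count t ts * g t + g x) + ∑ (others t ts) g       ≡⟨ ℕ.+-assoc (count t ts * g t) (g x) _ ⟩
  count t ts * g t + (g x + ∑ (others t ts) g)       ∎

count-others-∼ : ∀ {u t} ts → u ∼ t → count u (others t ts) ≡ 0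
count-others-∼ {u} {t} ts u∼t = trans (count-∑ u (others t ts)) (trans
  (∑-congᴬ (All-others t ts) λ d t≁d → δ-≁ u d (λ u∼d → t≁d (trans (sym u∼t) u∼d))) (∑-zero (others t ts)))

count-others-≁ : ∀ {u t} ts → ¬ (u ∼ t) → count u (others t ts) ≡ count u ts
count-others-≁ [] u≁t = refl
count-others-≁ {u} {t} (x ∷ ts) u≁t with t == x in eq
... | true = trans (count-others-≁ ts u≁t) (sym (count-∷-≁ ts λ u∼x → u≁t (trans u∼x (sym (==⇒∼ t x eq)))))
... | false with u == x
...   | true = cong suc (count-others-≁ ts u≁t)
...   | false = count-others-≁ ts u≁t

signum : ℕ → ℕ
signum zero = 0
signum (suc _) = 1

count-dedup : ∀ u ts → count u (dedup ts) ≡ signum (count u ts)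
count-dedup u [] = refl
count-dedup u (t ∷ ts) with u ∼? t
... | yes u∼t = trans (count-∷-∼ _ u∼t) (trans (cong suc (count-others-∼ (dedup ts) u∼t)) (cong signum (sym (count-∷-∼ ts u∼t))))
... | no u≁t = trans (count-∷-≁ _ u≁t) (trans (count-others-≁ (dedup ts) u≁t)
  (trans (count-dedup u ts) (cong signum (sym (count-∷-≁ ts u≁t)))))

countFactorials : List RTerm → ℕ
countFactorials ts = ∏ (dedup ts) λ t → count t ts !

-- Only the class of `t` changes: its count rises from c to c + 1, and (c + 1)! = (c + 1) c!.
countFactorials-∷ : ∀ t ts → countFactorials (t ∷ ts) ≡ count t (t ∷ ts) * countFactorials ts
countFactorials-∷ t ts = begin
  count t (t ∷ ts) ! * ∏ F (λ d → count d (t ∷ ts) !)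
    ≡⟨ cong₂ (λ c p → c ! * p) c-eq (∏-congᴬ (All-others t (dedup ts)) λ d t≁d →
         cong _! (count-∷-≁ ts (t≁d ∘ sym))) ⟩
  (suc c * c !) * ∏ F g
    ≡⟨ ℕ.*-assoc (suc c) (c !) _ ⟩
  suc c * (c ! * ∏ F g)
    ≡⟨ cong₂ _*_ (sym c-eq) (trans (cong (_* ∏ F g) (signum-power c)) (sym split)) ⟩
  count t (t ∷ ts) * countFactorials ts ∎
  where
  F = others t (dedup ts)
  c = count t ts
  g : RTerm → ℕ
  g d = count d ts !
  c-eq : count t (t ∷ ts) ≡ suc c
  c-eq = count-∷-∼ {t} ts refl
  -- If `t` does not occur in `ts`, then `dedup ts` has no factor for its class; the missing factor
  -- would be 0! = 1.
  signum-power : ∀ n → n ! ≡ (n !) ^ signum n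
  signum-power zero = refl
  signum-power (suc n) = sym (ℕ.*-identityʳ _)
  split : countFactorials ts ≡ ((c !) ^ signum c) * ∏ F g
  split = trans (∏-others t (dedup ts) g λ t∼d → cong _! (count-cong ts ts (sym t∼d) refl))
    (cong (λ n → (c !) ^ n * ∏ F g) (count-dedup t ts))

∑-count-dedup : ∀ ts → ∑[ d ← dedup ts ] count d ts ≡ length ts
∑-count-dedup [] = refl
∑-count-dedup (t ∷ ts) = begin
  count t (t ∷ ts) + ∑ F (λ d → count d (t ∷ ts))
    ≡⟨ cong₂ _+_ (count-∷-∼ {t} ts refl) (∑-congᴬ (All-others t (dedup ts)) λ d t≁d → count-∷-≁ ts (t≁d ∘ sym)) ⟩
  suc (c + ∑ F (λ d → count d ts))
    ≡⟨ cong (λ n → suc (n + ∑ F (λ d → count d ts))) (signum-* c) ⟩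
  suc (signum c * c + ∑ F (λ d → count d ts))
    ≡⟨ cong suc (sym (trans (∑-others t (dedup ts) (λ d → count d ts) λ t∼d → count-cong ts ts (sym t∼d) refl)
         (cong (λ n → n * c + ∑ F (λ d → count d ts)) (count-dedup t ts)))) ⟩
  suc (∑[ d ← dedup ts ] count d ts)
    ≡⟨ cong suc (∑-count-dedup ts) ⟩
  suc (length ts) ∎
  where
  F = others t (dedup ts)
  c = count t ts
  signum-* : ∀ n → n ≡ signum n * n
  signum-* zero = refl
  signum-* (suc n) = sym (ℕ.+-identityʳ _)

tag-canon : ∀ s → tag (canon s) ≡ tag s
tag-canon (rvar _) = refl
tag-canon (rlam _) = refl
tag-canon (rapp _ _) = refl
tag-canon (_ ⊕•) = refl
tag-canon (•⊕ _) = refl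

∼-tag : ∀ s t → s ∼ t → tag s ≡ tag t
∼-tag s t s∼t = trans (sym (tag-canon s)) (trans (cong tag s∼t) (tag-canon t))

rapp-∼⁻ : ∀ {s ss t ts} → rapp s ss ∼ rapp t ts → s ∼ t × bag ss ≡ bag ts
rapp-∼⁻ eq = fun-eq eq , arg-eq eq
  where
  fun-eq : ∀ {s ss t ts} → rapp s ss ≡ rapp t ts → s ≡ t
  fun-eq refl = refl
  arg-eq : ∀ {s ss t ts} → rapp s ss ≡ rapp t ts → ss ≡ ts
  arg-eq refl = refl

rlam-injective : ∀ {s t} → rlam s ≡ rlam t → s ≡ t
rlam-injective refl = refl

⊕•-injective : ∀ {s t} → s ⊕• ≡ t ⊕• → s ≡ t
⊕•-injective refl = refl

•⊕-injective : ∀ {s t} → •⊕ s ≡ •⊕ t → s ≡ t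
•⊕-injective refl = refl

∑-picks-proj₁ : ∀ (xs : List A) (f : A → ℕ) → ∑ (picks xs) (λ (x , _) → f x) ≡ ∑ xs f
∑-picks-proj₁ [] f = refl
∑-picks-proj₁ (x ∷ xs) f = trans (∑-picks-∷ x xs _) (cong (f x +_) (∑-picks-proj₁ xs f))

mutual
  -- `mult t` is the order of the group of permutations fixing `t`, and the permutations carrying
  -- `s` to `t` form a coset of that group.
  matches-∼ : ∀ s t → s ∼ t → matches s t ≡ mult t
  matches-∼ s t s∼t with tagView s t
  matches-∼ (rvar i) (rvar .i) refl | var = matches-var i
  matches-∼ (rlam s) (rlam t) s∼t | lam = matches-∼ s t (rlam-injective s∼t)
  matches-∼ (rapp s ss) (rapp t ts) s∼t | app with rapp-∼⁻ {s} {ss} {t} {ts} s∼t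
  ... | p , q = trans (cong₂ _*_ (matches-∼ s t p) (matchesL-∼ ss ts q)) (sym (ℕ.*-assoc (mult t) (multL ts) (countFactorials ts)))
  matches-∼ (s ⊕•) (t ⊕•) s∼t | left = matches-∼ s t (⊕•-injective s∼t)
  matches-∼ (•⊕ s) (•⊕ t) s∼t | right = matches-∼ s t (•⊕-injective s∼t)
  matches-∼ s t s∼t | diff ne _ _ = contradiction (∼-tag s t s∼t) ne

  matches-≁ : ∀ s t → ¬ (s ∼ t) → matches s t ≡ 0
  matches-≁ s t s≁t with tagView s t
  matches-≁ (rvar i) (rvar j) s≁t | var rewrite ≢⇒≡ᵇ-false {i} {j} (s≁t ∘ cong rvar) = refl
  matches-≁ (rlam s) (rlam t) s≁t | lam = matches-≁ s t (s≁t ∘ cong rlam)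
  matches-≁ (rapp s ss) (rapp t ts) s≁t | app with s ∼? t
  ... | no p = cong (_* matchesL ss ts) (matches-≁ s t p)
  ... | yes p = trans (cong (matches s t *_) (matchesL-≁ ss ts (s≁t ∘ cong₂ rapp p))) (ℕ.*-zeroʳ (matches s t))
  matches-≁ (s ⊕•) (t ⊕•) s≁t | left = matches-≁ s t (s≁t ∘ cong _⊕•)
  matches-≁ (•⊕ s) (•⊕ t) s≁t | right = matches-≁ s t (s≁t ∘ cong •⊕_)
  matches-≁ s t s≁t | diff _ _ eq = eq

  -- The elements of `ss` that can be sent to `t` are those of its class, `count t (t ∷ ts)` in
  -- number, and whichever is taken, the rest has the bag of `ts` by cancellation. This is the
  -- recursion of `countFactorials-∷`.
  matchesL-∼ : ∀ ss ts → bag ss ≡ bag ts → matchesL ss ts ≡ multL ts * countFactorials ts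
  matchesL-∼ [] [] eq = refl
  matchesL-∼ (s ∷ ss) [] eq with () ← trans (sym (count-∷-∼ {s} {s} ss refl)) (count-cong {s} {s} (s ∷ ss) [] refl eq)
  matchesL-∼ ss (t ∷ ts) eq = begin
    (∑ (picks ss) λ (s , ss′) → matches s t * matchesL ss′ ts)
      ≡⟨ ∑-congᴬ (All-picks-bag ss) (λ (s , ss′) → pick s ss′) ⟩
    (∑ (picks ss) λ (s , _) → δ t s * (mult t * (multL ts * countFactorials ts)))
      ≡⟨ trans (∑-picks-proj₁ ss _) (∑-*ʳ ss (δ t) _) ⟩
    ∑ ss (δ t) * (mult t * (multL ts * countFactorials ts))
      ≡⟨ cong₂ _*_ (trans (sym (count-∑ t ss)) (count-cong {t} ss (t ∷ ts) refl eq)) (sym (ℕ.*-assoc (mult t) (multL ts) _)) ⟩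
    count t (t ∷ ts) * (multL (t ∷ ts) * countFactorials ts)
      ≡⟨ trans (sym (ℕ.*-assoc (count t (t ∷ ts)) (multL (t ∷ ts)) _)) (trans
           (cong (_* countFactorials ts) (ℕ.*-comm (count t (t ∷ ts)) (multL (t ∷ ts))))
           (ℕ.*-assoc (multL (t ∷ ts)) (count t (t ∷ ts)) _)) ⟩
    multL (t ∷ ts) * (count t (t ∷ ts) * countFactorials ts)
      ≡⟨ cong (multL (t ∷ ts) *_) (sym (countFactorials-∷ t ts)) ⟩
    multL (t ∷ ts) * countFactorials (t ∷ ts) ∎
    where
    pick : ∀ s ss′ → bag ss ≡ insert (canon s) (bag ss′) →
      matches s t * matchesL ss′ ts ≡ δ t s * (mult t * (multL ts * countFactorials ts))
    pick s ss′ eq′ with s ∼? t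
    ... | no s≁t rewrite matches-≁ s t s≁t | δ-≁ t s (s≁t ∘ sym) = refl
    ... | yes s∼t rewrite δ-∼ t s (sym s∼t) = trans (cong₂ _*_ (matches-∼ s t s∼t) (matchesL-∼ ss′ ts
        (insert-injective (canon t) (bag ss′) (bag ts)
          (trans (cong (λ c → insert c (bag ss′)) (sym s∼t)) (trans (sym eq′) eq))))) (sym (ℕ.*-identityˡ _))

  matchesL-≁ : ∀ ss ts → bag ss ≢ bag ts → matchesL ss ts ≡ 0
  matchesL-≁ [] [] ne = contradiction refl ne
  matchesL-≁ (_ ∷ _) [] ne = refl
  matchesL-≁ ss (t ∷ ts) ne = trans (∑-congᴬ (All-picks-bag ss) λ (s , ss′) → pick s ss′) (∑-zero (picks ss))
    where
    pick : ∀ s ss′ → bag ss ≡ insert (canon s) (bag ss′) → matches s t * matchesL ss′ ts ≡ 0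
    pick s ss′ eq′ with s ∼? t
    ... | no s≁t = cong (_* matchesL ss′ ts) (matches-≁ s t s≁t)
    ... | yes s∼t = trans (cong (matches s t *_) (matchesL-≁ ss′ ts
        (λ eq → ne (trans eq′ (cong₂ insert s∼t eq))))) (ℕ.*-zeroʳ (matches s t))

-- `matchesL` is defined by expanding the permanent along its first target; this expands it along
-- its first source, which is what symmetry requires.
matchesL-∷ˡ : ∀ s ss ts → matchesL (s ∷ ss) ts ≡ (∑ (picks ts) λ (t , ts′) → matches s t * matchesL ss ts′)
matchesL-∷ˡ s ss [] = refl
matchesL-∷ˡ s ss (t ∷ ts) = begin
  matchesL (s ∷ ss) (t ∷ ts)
    ≡⟨ ∑-picks-∷ s ss _ ⟩
  matches s t * matchesL ss ts + (∑ (picks ss) λ (s₂ , ss₂) → matches s₂ t * matchesL (s ∷ ss₂) ts)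
    ≡⟨ cong (matches s t * matchesL ss ts +_) (∑-cong (picks ss) λ (s₂ , ss₂) →
         trans (cong (matches s₂ t *_) (matchesL-∷ˡ s ss₂ ts)) (sym (∑-*ˡ (picks ts) (matches s₂ t) _))) ⟩
  matches s t * matchesL ss ts + (∑ (picks ss) λ (s₂ , ss₂) → ∑ (picks ts) λ (t₂ , ts₂) →
    matches s₂ t * (matches s t₂ * matchesL ss₂ ts₂))
    ≡⟨ cong (matches s t * matchesL ss ts +_) (trans (∑-swap (picks ss) (picks ts) _) (∑-cong (picks ts) λ (t₂ , ts₂) →
         trans (∑-cong (picks ss) λ (s₂ , ss₂) → trans (sym (ℕ.*-assoc (matches s₂ t) (matches s t₂) _))
           (trans (cong (_* matchesL ss₂ ts₂) (ℕ.*-comm (matches s₂ t) (matches s t₂)))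
             (ℕ.*-assoc (matches s t₂) (matches s₂ t) _)))
           (∑-*ˡ (picks ss) (matches s t₂) _))) ⟩
  matches s t * matchesL ss ts + (∑ (picks ts) λ (t₂ , ts₂) → matches s t₂ * matchesL ss (t ∷ ts₂))
    ≡⟨ sym (∑-picks-∷ t ts _) ⟩
  _ ∎

mutual
  matches-sym : ∀ s t → matches s t ≡ matches t s
  matches-sym s t with tagView s t
  matches-sym (rvar i) (rvar j) | var with i ℕ.≟ j
  ... | yes refl = refl
  ... | no i≢j rewrite ≢⇒≡ᵇ-false i≢j | ≢⇒≡ᵇ-false (i≢j ∘ sym) = refl
  matches-sym (rlam s) (rlam t) | lam = matches-sym s t
  matches-sym (rapp s ss) (rapp t ts) | app = cong₂ _*_ (matches-sym s t) (matchesL-sym ss ts)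
  matches-sym (s ⊕•) (t ⊕•) | left = matches-sym s t
  matches-sym (•⊕ s) (•⊕ t) | right = matches-sym s t
  matches-sym s t | diff ne _ eq = trans eq (sym (matches-≁ t s (ne ∘ sym ∘ ∼-tag t s)))

  matchesL-sym : ∀ ss ts → matchesL ss ts ≡ matchesL ts ss
  matchesL-sym [] [] = refl
  matchesL-sym (_ ∷ _) [] = refl
  matchesL-sym ss (t ∷ ts) = trans
    (∑-cong (picks ss) λ (s , ss′) → cong₂ _*_ (matches-sym s t) (matchesL-sym ss′ ts))
    (sym (matchesL-∷ˡ t ts ss))

-- By `matches-∼`, each multiplicity is a number of matches, the two differing only in direction;
-- permutations can be inverted, so symmetry replaces a separate analysis of `mult` on permuted
-- lists.
mult-∼ : ∀ s t → s ∼ t → mult s ≡ mult t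
mult-∼ s t s∼t = trans (sym (matches-∼ t s (sym s∼t))) (trans (matches-sym t s) (matches-∼ s t s∼t))

matches-δ : ∀ e u → matches e u ≡ δ u e * mult u
matches-δ e u with e ∼? u
... | yes e∼u rewrite δ-∼ u e (sym e∼u) = trans (matches-∼ e u e∼u) (sym (ℕ.+-identityʳ _))
... | no e≁u rewrite δ-≁ u e (e≁u ∘ sym) = matches-≁ e u e≁u

matches-∼ʳ : ∀ e {u v} → u ∼ v → matches e u ≡ matches e v
matches-∼ʳ e {u} {v} u∼v with e ∼? u
... | yes e∼u = trans (matches-∼ e u e∼u) (trans (mult-∼ u v u∼v) (sym (matches-∼ e v (trans e∼u u∼v))))
... | no e≁u = trans (matches-≁ e u e≁u) (sym (matches-≁ e v (λ e∼v → e≁u (trans e∼v (sym u∼v)))))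

matches-≢0 : ∀ e u → matches e u ≢ 0 → e ∼ u
matches-≢0 e u ≢0 with e ∼? u
... | yes e∼u = e∼u
... | no e≁u = contradiction (matches-≁ e u e≁u) ≢0

countFactorials-positive : ∀ ts → 1 ≤ countFactorials ts
countFactorials-positive [] = ℕ.≤-refl
countFactorials-positive (t ∷ ts) = ≡.subst (1 ≤_) (sym (countFactorials-∷ t ts))
  (ℕ.*-mono-≤ (≡.subst (1 ≤_) (sym (count-∷-∼ {t} ts refl)) (s≤s z≤n)) (countFactorials-positive ts))

mutual
  mult-positive : ∀ s → 1 ≤ mult s
  mult-positive (rvar _) = ℕ.≤-refl
  mult-positive (rlam s) = mult-positive s
  mult-positive (rapp s ts) = ℕ.*-mono-≤ (ℕ.*-mono-≤ (mult-positive s) (multL-positive ts)) (countFactorials-positive ts)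
  mult-positive (s ⊕•) = mult-positive s
  mult-positive (•⊕ s) = mult-positive s

  multL-positive : ∀ ts → 1 ≤ multL ts
  multL-positive [] = ℕ.≤-refl
  multL-positive (t ∷ ts) = ℕ.*-mono-≤ (mult-positive t) (multL-positive ts)

All-insert⁺ : ∀ {P : RTerm → Set} a l → P a → All P l → All P (insert a l)
All-insert⁺ a [] p [] = p ∷ []
All-insert⁺ a (x ∷ l) p (q ∷ qs) with cmp a x
... | LT = p ∷ q ∷ qs
... | EQ = p ∷ q ∷ qs
... | GT = q ∷ All-insert⁺ a l p qs

All-insert⁻ : ∀ {P : RTerm → Set} a l → All P (insert a l) → P a × All P l
All-insert⁻ a [] (p ∷ []) = p , []
All-insert⁻ a (x ∷ l) ps with cmp a x
All-insert⁻ a (x ∷ l) (p ∷ ps) | LT = p , ps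
All-insert⁻ a (x ∷ l) (p ∷ ps) | EQ = p , ps
All-insert⁻ a (x ∷ l) (p ∷ ps) | GT with All-insert⁻ a l ps
... | q , qs = q , p ∷ qs

mutual
  ∈𝒯-canon⁺ : ∀ {s N} → s ∈𝒯 N → canon s ∈𝒯 N
  ∈𝒯-canon⁺ var = var
  ∈𝒯-canon⁺ (lam p) = lam (∈𝒯-canon⁺ p)
  ∈𝒯-canon⁺ (app p ps) = app (∈𝒯-canon⁺ p) (All-bag⁺ ps)
  ∈𝒯-canon⁺ (left p) = left (∈𝒯-canon⁺ p)
  ∈𝒯-canon⁺ (right p) = right (∈𝒯-canon⁺ p)

  All-bag⁺ : ∀ {ts N} → All (_∈𝒯 N) ts → All (_∈𝒯 N) (bag ts)
  All-bag⁺ [] = []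
  All-bag⁺ (p ∷ ps) = All-insert⁺ _ _ (∈𝒯-canon⁺ p) (All-bag⁺ ps)

mutual
  ∈𝒯-canon⁻ : ∀ s {N} → canon s ∈𝒯 N → s ∈𝒯 N
  ∈𝒯-canon⁻ (rvar i) var = var
  ∈𝒯-canon⁻ (rlam s) (lam p) = lam (∈𝒯-canon⁻ s p)
  ∈𝒯-canon⁻ (rapp s ts) (app p ps) = app (∈𝒯-canon⁻ s p) (All-bag⁻ ts ps)
  ∈𝒯-canon⁻ (s ⊕•) (left p) = left (∈𝒯-canon⁻ s p)
  ∈𝒯-canon⁻ (•⊕ s) (right p) = right (∈𝒯-canon⁻ s p)

  All-bag⁻ : ∀ ts {N} → All (_∈𝒯 N) (bag ts) → All (_∈𝒯 N) ts
  All-bag⁻ [] _ = []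
  All-bag⁻ (t ∷ ts) ps with All-insert⁻ (canon t) (bag ts) ps
  ... | q , qs = ∈𝒯-canon⁻ t q ∷ All-bag⁻ ts qs

∈𝒯-∼ : ∀ {s t N} → s ∼ t → s ∈𝒯 N → t ∈𝒯 N
∈𝒯-∼ {t = t} {N} s∼t p = ∈𝒯-canon⁻ t (≡.subst (_∈𝒯 N) s∼t (∈𝒯-canon⁺ p))

-- Taylor coefficients

fromℚᵘ-* : ∀ p q → fromℚᵘ p *ℚ fromℚᵘ q ≡ fromℚᵘ (p ℚᵘ.* q)
fromℚᵘ-* p q = ℚ.toℚᵘ-injective (ℚᵘ.≃-trans (ℚ.toℚᵘ-homo-* (fromℚᵘ p) (fromℚᵘ q))
  (ℚᵘ.≃-trans (ℚᵘ.*-cong (ℚ.toℚᵘ-fromℚᵘ p) (ℚ.toℚᵘ-fromℚᵘ q)) (ℚᵘ.≃-sym (ℚ.toℚᵘ-fromℚᵘ (p ℚᵘ.* q)))))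

fromℚᵘ-+ : ∀ p q → fromℚᵘ p +ℚ fromℚᵘ q ≡ fromℚᵘ (p ℚᵘ.+ q)
fromℚᵘ-+ p q = ℚ.toℚᵘ-injective (ℚᵘ.≃-trans (ℚ.toℚᵘ-homo-+ (fromℚᵘ p) (fromℚᵘ q))
  (ℚᵘ.≃-trans (ℚᵘ.+-cong (ℚ.toℚᵘ-fromℚᵘ p) (ℚ.toℚᵘ-fromℚᵘ q)) (ℚᵘ.≃-sym (ℚ.toℚᵘ-fromℚᵘ (p ℚᵘ.+ q)))))

fromℕ-* : ∀ m n → fromℕ (m * n) ≡ fromℕ m *ℚ fromℕ n
fromℕ-* m n = sym (trans (fromℚᵘ-* (mkℚᵘ (pos m) 0) (mkℚᵘ (pos n) 0))
  (cong (λ k → fromℚᵘ (mkℚᵘ k 0)) (sym (ℤ.pos-* m n))))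

fromℕ-+ : ∀ m n → fromℕ (m + n) ≡ fromℕ m +ℚ fromℕ n
fromℕ-+ m n = sym (trans (fromℚᵘ-+ (mkℚᵘ (pos m) 0) (mkℚᵘ (pos n) 0))
  (cong (λ k → fromℚᵘ (mkℚᵘ k 0)) (trans
    (cong₂ ℤ._+_ (ℤ.*-identityʳ (pos m)) (ℤ.*-identityʳ (pos n))) (sym (ℤ.pos-+ m n)))))

fromℕ-inv : ∀ {n} → 1 ≤ n → fromℕ n *ℚ inv n ≡ 1ℚ
fromℕ-inv {suc k} _ = trans (fromℚᵘ-* (mkℚᵘ (pos (suc k)) 0) (mkℚᵘ (pos 1) k))
  (ℚ.fromℚᵘ-cong {mkℚᵘ (pos (suc k)) 0 ℚᵘ.* mkℚᵘ (pos 1) k} {mkℚᵘ (pos 1) 0} (*≡* (trans (ℤ.*-identityʳ _)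
    (trans (ℤ.*-identityʳ (pos (suc k))) (trans (cong (λ n → pos (suc n)) (sym (ℕ.+-identityʳ k))) (sym (ℤ.*-identityˡ _)))))))

-- Coefficients are identified with `inv n` by multiplying out, so divisions never have to be
-- manipulated.
inv-unique : ∀ {n q} → 1 ≤ n → fromℕ n *ℚ q ≡ 1ℚ → q ≡ inv n
inv-unique {n} {q} 1≤n eq = begin
  q                       ≡⟨ sym (ℚ.*-identityˡ q) ⟩
  1ℚ *ℚ q                  ≡⟨ cong (_*ℚ q) (sym (trans (ℚ.*-comm (inv n) (fromℕ n)) (fromℕ-inv 1≤n))) ⟩
  (inv n *ℚ fromℕ n) *ℚ q   ≡⟨ ℚ.*-assoc (inv n) (fromℕ n) q ⟩
  inv n *ℚ (fromℕ n *ℚ q)   ≡⟨ cong (inv n *ℚ_) eq ⟩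
  inv n *ℚ 1ℚ              ≡⟨ ℚ.*-identityʳ (inv n) ⟩
  inv n                   ∎

inv-≥0 : ∀ n → 0ℚ ≤ℚ inv n
inv-≥0 zero = ℚ.≤-refl
inv-≥0 (suc k) = ℚ.nonNegative⁻¹ (inv (suc k)) {{ℚ.normalize-nonNeg 1 (suc k)}}

inv≢0 : ∀ {n} → 1 ≤ n → inv n ≢ 0ℚ
inv≢0 {n} 1≤n eq with () ← trans (sym (fromℕ-inv 1≤n)) (trans (cong (fromℕ n *ℚ_) eq) (ℚ.*-zeroʳ (fromℕ n)))

*ℚ-interchange : ∀ a b c d → (a *ℚ b) *ℚ (c *ℚ d) ≡ (a *ℚ c) *ℚ (b *ℚ d)
*ℚ-interchange a b c d = begin
  (a *ℚ b) *ℚ (c *ℚ d) ≡⟨ ℚ.*-assoc a b _ ⟩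
  a *ℚ (b *ℚ (c *ℚ d)) ≡⟨ cong (a *ℚ_) (trans (sym (ℚ.*-assoc b c d)) (trans (cong (_*ℚ d) (ℚ.*-comm b c)) (ℚ.*-assoc c b d))) ⟩
  a *ℚ (c *ℚ (b *ℚ d)) ≡⟨ sym (ℚ.*-assoc a c _) ⟩
  (a *ℚ c) *ℚ (b *ℚ d) ∎

inv-* : ∀ {m n} → 1 ≤ m → 1 ≤ n → inv m *ℚ inv n ≡ inv (m * n)
inv-* {m} {n} 1≤m 1≤n = inv-unique (ℕ.*-mono-≤ 1≤m 1≤n) (trans (cong (_*ℚ (inv m *ℚ inv n)) (fromℕ-* m n))
  (trans (*ℚ-interchange (fromℕ m) (fromℕ n) (inv m) (inv n))
    (cong₂ _*ℚ_ (fromℕ-inv 1≤m) (fromℕ-inv 1≤n))))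

sumℚ-congᴬ : ∀ {P : RTerm → Set} {xs} {f g : RTerm → ℚ} → All P xs → (∀ x → P x → f x ≡ g x) →
  sumℚ (map f xs) ≡ sumℚ (map g xs)
sumℚ-congᴬ [] eq = refl
sumℚ-congᴬ (p ∷ ps) eq = cong₂ _+ℚ_ (eq _ p) (sumℚ-congᴬ ps eq)

sumℚ-*ˡ : ∀ c xs (f : RTerm → ℚ) → c *ℚ sumℚ (map f xs) ≡ sumℚ (map (λ x → c *ℚ f x) xs)
sumℚ-*ˡ c [] f = ℚ.*-zeroʳ c
sumℚ-*ˡ c (x ∷ xs) f = trans (ℚ.*-distribˡ-+ c (f x) _) (cong (c *ℚ f x +ℚ_) (sumℚ-*ˡ c xs f))

sumℚ-fromℕ : ∀ xs (f : RTerm → ℕ) c → sumℚ (map (λ x → fromℕ (f x) *ℚ c) xs) ≡ fromℕ (∑ xs f) *ℚ c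
sumℚ-fromℕ [] f c = sym (ℚ.*-zeroˡ c)
sumℚ-fromℕ (x ∷ xs) f c = trans (cong (fromℕ (f x) *ℚ c +ℚ_) (sumℚ-fromℕ xs f c))
  (trans (sym (ℚ.*-distribʳ-+ c (fromℕ (f x)) _)) (cong (_*ℚ c) (sym (fromℕ-+ (f x) _))))

sumℚ-zero : ∀ (xs : List RTerm) → sumℚ (map (λ _ → 0ℚ) xs) ≡ 0ℚ
sumℚ-zero [] = refl
sumℚ-zero (x ∷ xs) = trans (ℚ.+-identityˡ _) (sumℚ-zero xs)

bagMult : List RTerm → ℕ
bagMult ts = multL ts * countFactorials ts

bagMult-positive : ∀ ts → 1 ≤ bagMult ts
bagMult-positive ts = ℕ.*-mono-≤ (multL-positive ts) (countFactorials-positive ts)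

bagMult-∷ : ∀ t ts → bagMult (t ∷ ts) ≡ count t (t ∷ ts) * (mult t * bagMult ts)
bagMult-∷ t ts = begin
  (mult t * multL ts) * countFactorials (t ∷ ts)
    ≡⟨ cong ((mult t * multL ts) *_) (countFactorials-∷ t ts) ⟩
  (mult t * multL ts) * (count t (t ∷ ts) * countFactorials ts)
    ≡⟨ sym (ℕ.*-assoc (mult t * multL ts) (count t (t ∷ ts)) _) ⟩
  ((mult t * multL ts) * count t (t ∷ ts)) * countFactorials ts
    ≡⟨ cong (_* countFactorials ts) (ℕ.*-comm (mult t * multL ts) (count t (t ∷ ts))) ⟩
  (count t (t ∷ ts) * (mult t * multL ts)) * countFactorials ts
    ≡⟨ ℕ.*-assoc (count t (t ∷ ts)) (mult t * multL ts) _ ⟩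
  count t (t ∷ ts) * ((mult t * multL ts) * countFactorials ts)
    ≡⟨ cong (count t (t ∷ ts) *_) (ℕ.*-assoc (mult t) (multL ts) _) ⟩
  count t (t ∷ ts) * (mult t * bagMult ts) ∎

-- mult-∼ for the applications of a variable to ss and ts.
bagMult-bag : ∀ ss ts → bag ss ≡ bag ts → bagMult ss ≡ bagMult ts
bagMult-bag ss ts eq = trans (1*-assoc ss) (trans (mult-∼ (rapp (rvar 0) ss) (rapp (rvar 0) ts) (cong (rapp (rvar 0)) eq)) (sym (1*-assoc ts)))
  where
  1*-assoc : ∀ ts → bagMult ts ≡ mult (rapp (rvar 0) ts)
  1*-assoc ts = cong (_* countFactorials ts) (sym (ℕ.*-identityˡ (multL ts)))

bag-removeOne : ∀ u ts → count u ts ≢ 0 → bag ts ≡ bag (u ∷ removeOne u ts)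
bag-removeOne u [] ≢0 = contradiction refl ≢0
bag-removeOne u (t ∷ ts) ≢0 with u == t in eq
... | true = cong (λ c → insert c (bag ts)) (sym (==⇒∼ u t eq))
... | false = trans (cong (insert (canon t)) (bag-removeOne u ts ≢0)) (insert-comm (canon t) (canon u) (bag (removeOne u ts)))

length-removeOne : ∀ u ts → count u ts ≢ 0 → length ts ≡ suc (length (removeOne u ts))
length-removeOne u [] ≢0 = contradiction refl ≢0
length-removeOne u (t ∷ ts) ≢0 with u == t
... | true = refl
... | false = cong suc (length-removeOne u ts ≢0)

All-removeOne⁺ : ∀ {P : RTerm → Set} u {ts} → All P ts → All P (removeOne u ts)
All-removeOne⁺ u [] = []
All-removeOne⁺ u {t ∷ ts} (p ∷ ps) with u == t
... | true = ps
... | false = p ∷ All-removeOne⁺ u ps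

All-removeOne⁻ : ∀ {P : RTerm → Set} → (∀ {s t} → s ∼ t → P s → P t) → ∀ u ts → P u → All P (removeOne u ts) → All P ts
All-removeOne⁻ P-∼ u [] p ps = []
All-removeOne⁻ P-∼ u (t ∷ ts) p ps with u == t in eq
All-removeOne⁻ P-∼ u (t ∷ ts) p ps | true = P-∼ (==⇒∼ u t eq) p ∷ ps
All-removeOne⁻ P-∼ u (t ∷ ts) p (q ∷ ps) | false = q ∷ All-removeOne⁻ P-∼ u ts p ps

All-others⁺ : ∀ {P : RTerm → Set} t {ts} → All P ts → All P (others t ts)
All-others⁺ t [] = []
All-others⁺ t {x ∷ ts} (p ∷ ps) with t == x
... | true = All-others⁺ t ps
... | false = p ∷ All-others⁺ t ps

All-dedup : ∀ {P : RTerm → Set} {ts} → All P ts → All P (dedup ts)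
All-dedup [] = []
All-dedup {ts = t ∷ ts} (p ∷ ps) = p ∷ All-others⁺ t (All-dedup ps)

suc≢0 : ∀ {m n} → m ≡ suc n → m ≢ 0
suc≢0 refl ()

count-∷-≢0 : ∀ u t ts → count u ts ≢ 0 → count u (t ∷ ts) ≢ 0
count-∷-≢0 u t ts ≢0 with u == t
... | true = λ ()
... | false = ≢0

count-dedup-≢0 : ∀ ts → All (λ d → count d ts ≢ 0) (dedup ts)
count-dedup-≢0 [] = []
count-dedup-≢0 (t ∷ ts) = suc≢0 (count-∷-∼ {t} ts refl) ∷
  All-others⁺ t (All.map (λ {d} → count-∷-≢0 d t ts) (count-dedup-≢0 ts))

-- To be used with `S = T Q` and `P` its support. Both stay abstract so that monomials can be
-- treated before `T`, whose own induction then supplies `S-∈` for the argument `Q` of an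
-- application.
module _ {P : RTerm → Set} (S : RTerm → ℚ) (S-∈ : ∀ {s} → P s → S s ≡ inv (mult s)) where

  -- The coefficient is n!/m(ts), stated without division. With `u` as first component, m(ts) is the
  -- count of `u` times m(u) m(rest), so the class of `u` contributes its count times (n - 1)!; the
  -- counts of all classes add up to n.
  powCoef-∈ : ∀ n ts → length ts ≡ n → All P ts → fromℕ (bagMult ts) *ℚ powCoef n S ts ≡ fromℕ (n !)
  powCoef-∈ zero [] eq ps = refl
  powCoef-∈ (suc n) ts eq ps = begin
    fromℕ (bagMult ts) *ℚ powCoef (suc n) S ts
      ≡⟨ sumℚ-*ˡ (fromℕ (bagMult ts)) (dedup ts) _ ⟩
    sumℚ (map (λ u → fromℕ (bagMult ts) *ℚ (S u *ℚ powCoef n S (removeOne u ts))) (dedup ts))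
      ≡⟨ sumℚ-congᴬ (All.zip (All-dedup ps , count-dedup-≢0 ts)) (λ u (p , ≢0) → term u p ≢0) ⟩
    sumℚ (map (λ u → fromℕ (count u ts) *ℚ fromℕ (n !)) (dedup ts))
      ≡⟨ sumℚ-fromℕ (dedup ts) (λ u → count u ts) (fromℕ (n !)) ⟩
    fromℕ (∑[ u ← dedup ts ] count u ts) *ℚ fromℕ (n !)
      ≡⟨ cong (λ k → fromℕ k *ℚ fromℕ (n !)) (trans (∑-count-dedup ts) eq) ⟩
    fromℕ (suc n) *ℚ fromℕ (n !)
      ≡⟨ sym (fromℕ-* (suc n) (n !)) ⟩
    fromℕ (suc n !) ∎
    where
    term : ∀ u → P u → count u ts ≢ 0 →
      fromℕ (bagMult ts) *ℚ (S u *ℚ powCoef n S (removeOne u ts)) ≡ fromℕ (count u ts) *ℚ fromℕ (n !)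
    term u p ≢0 = begin
      fromℕ (bagMult ts) *ℚ (S u *ℚ pow)
        ≡⟨ cong (_*ℚ (S u *ℚ pow)) (trans (cong fromℕ (trans (bagMult-bag ts (u ∷ rest) bag-eq) (bagMult-∷ u rest)))
             (trans (fromℕ-* (count u (u ∷ rest)) _) (cong₂ _*ℚ_
               (cong fromℕ (count-cong {u} (u ∷ rest) ts refl (sym bag-eq))) (fromℕ-* (mult u) (bagMult rest))))) ⟩
      (fromℕ (count u ts) *ℚ (fromℕ (mult u) *ℚ fromℕ (bagMult rest))) *ℚ (S u *ℚ pow)
        ≡⟨ ℚ.*-assoc (fromℕ (count u ts)) _ _ ⟩
      fromℕ (count u ts) *ℚ ((fromℕ (mult u) *ℚ fromℕ (bagMult rest)) *ℚ (S u *ℚ pow))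
        ≡⟨ cong (fromℕ (count u ts) *ℚ_) (*ℚ-interchange (fromℕ (mult u)) _ (S u) pow) ⟩
      fromℕ (count u ts) *ℚ ((fromℕ (mult u) *ℚ S u) *ℚ (fromℕ (bagMult rest) *ℚ pow))
        ≡⟨ cong (fromℕ (count u ts) *ℚ_) (cong₂ _*ℚ_
             (trans (cong (fromℕ (mult u) *ℚ_) (S-∈ p)) (fromℕ-inv (mult-positive u)))
             (powCoef-∈ n rest (ℕ.suc-injective (trans (sym (length-removeOne u ts ≢0)) eq)) (All-removeOne⁺ u ps))) ⟩
      fromℕ (count u ts) *ℚ (1ℚ *ℚ fromℕ (n !))
        ≡⟨ cong (fromℕ (count u ts) *ℚ_) (ℚ.*-identityˡ _) ⟩
      fromℕ (count u ts) *ℚ fromℕ (n !) ∎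
      where
      rest = removeOne u ts
      pow = powCoef n S rest
      bag-eq = bag-removeOne u ts ≢0

  bangCoef-∈ : ∀ ts → All P ts → bangCoef S ts ≡ inv (bagMult ts)
  bangCoef-∈ ts ps = inv-unique (bagMult-positive ts) (begin
    fromℕ (bagMult ts) *ℚ (inv (n !) *ℚ powCoef n S ts)
      ≡⟨ trans (sym (ℚ.*-assoc (fromℕ (bagMult ts)) (inv (n !)) _)) (trans
           (cong (_*ℚ powCoef n S ts) (ℚ.*-comm (fromℕ (bagMult ts)) (inv (n !))))
           (ℚ.*-assoc (inv (n !)) (fromℕ (bagMult ts)) _)) ⟩
    inv (n !) *ℚ (fromℕ (bagMult ts) *ℚ powCoef n S ts)
      ≡⟨ cong (inv (n !) *ℚ_) (powCoef-∈ n ts refl ps) ⟩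
    inv (n !) *ℚ fromℕ (n !)
      ≡⟨ trans (ℚ.*-comm (inv (n !)) (fromℕ (n !))) (fromℕ-inv (ℕ.1≤n! n)) ⟩
    1ℚ ∎)
    where
    n = length ts

  module _ (P-∼ : ∀ {s t} → s ∼ t → P s → P t) (P? : ∀ s → P s ⊎ S s ≡ 0ℚ) where

    powCoef-∉ : ∀ n ts → ¬ All P ts → powCoef n S ts ≡ 0ℚ
    powCoef-∉ zero [] ¬ps = contradiction [] ¬ps
    powCoef-∉ zero (_ ∷ _) ¬ps = refl
    powCoef-∉ (suc n) ts ¬ps = trans (sumℚ-congᴬ (All.universal (λ _ → refl {x = 0}) (dedup ts)) λ u _ → term u) (sumℚ-zero (dedup ts))
      where
      term : ∀ u → S u *ℚ powCoef n S (removeOne u ts) ≡ 0ℚ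
      term u with P? u
      ... | inj₂ S≡0 = trans (cong (_*ℚ powCoef n S (removeOne u ts)) S≡0) (ℚ.*-zeroˡ (powCoef n S (removeOne u ts)))
      ... | inj₁ p = trans (cong (S u *ℚ_) (powCoef-∉ n (removeOne u ts) (¬ps ∘ All-removeOne⁻ P-∼ u ts p))) (ℚ.*-zeroʳ (S u))

    bangCoef-∉ : ∀ ts → ¬ All P ts → bangCoef S ts ≡ 0ℚ
    bangCoef-∉ ts ¬ps = trans (cong (inv (length ts !) *ℚ_) (powCoef-∉ (length ts) ts ¬ps)) (ℚ.*-zeroʳ (inv (length ts !)))

T-∈ : ∀ {s N} → s ∈𝒯 N → T N s ≡ inv (mult s)
T-∈ (var {i}) rewrite ≡ᵇ-refl i = refl
T-∈ (lam p) = T-∈ p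
T-∈ (left p) = T-∈ p
T-∈ (right p) = T-∈ p
T-∈ (app {s} {ts} {P} {Q} p ps) = trans (cong₂ _*ℚ_ (T-∈ p) (bangCoef-∈ (T Q) T-∈ ts ps))
  (trans (inv-* (mult-positive s) (bagMult-positive ts)) (cong inv (sym (ℕ.*-assoc (mult s) (multL ts) (countFactorials ts)))))

-- Decides membership and also records the vanishing coefficient. Non-membership in a monomial does
-- not say which element fails, so `bangCoef-∉` needs the dichotomy for every element.
data Membership (s : RTerm) (N : Approx) : Set where
  inside  : s ∈𝒯 N → Membership s N
  outside : ¬ (s ∈𝒯 N) → T N s ≡ 0ℚ → Membership s N

private
  rvar-∉ : ∀ {i j} → i ≢ j → ¬ (rvar j ∈𝒯 var i)
  rvar-∉ i≢j var = i≢j refl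

membership : ∀ s N → Membership s N
membership (rvar j) (var i) with i ℕ.≟ j
... | yes refl = inside var
... | no i≢j = outside (rvar-∉ i≢j) (cong (λ b → if b then 1ℚ else 0ℚ) (≢⇒≡ᵇ-false i≢j))
membership (rlam s) (lam N) with membership s N
... | inside p = inside (lam p)
... | outside ¬p eq = outside (λ { (lam p) → ¬p p }) eq
membership (s ⊕•) (P ⊕ Q) with membership s P
... | inside p = inside (left p)
... | outside ¬p eq = outside (λ { (left p) → ¬p p }) eq
membership (•⊕ s) (P ⊕ Q) with membership s Q
... | inside p = inside (right p)
... | outside ¬p eq = outside (λ { (right p) → ¬p p }) eq
membership (rapp s ts) (app P Q) with membership s P | all-inside ts
  where
  all-inside : ∀ ts → Dec (All (_∈𝒯 Q) ts)
  all-inside = All.all? λ t → decide (membership t Q)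
    where
    decide : ∀ {t} → Membership t Q → Dec (t ∈𝒯 Q)
    decide (inside p) = yes p
    decide (outside ¬p _) = no ¬p
... | outside ¬p eq | _ = outside (λ { (app p _) → ¬p p }) (trans (cong (_*ℚ bangCoef (T Q) ts) eq) (ℚ.*-zeroˡ (bangCoef (T Q) ts)))
... | inside p | yes ps = inside (app p ps)
... | inside p | no ¬ps = outside (λ { (app _ ps) → ¬ps ps }) (trans
  (cong (T P s *ℚ_) (bangCoef-∉ (T Q) T-∈ ∈𝒯-∼ (λ t → dichotomy (membership t Q)) ts ¬ps)) (ℚ.*-zeroʳ (T P s)))
  where
  dichotomy : ∀ {t} → Membership t Q → t ∈𝒯 Q ⊎ T Q t ≡ 0ℚ
  dichotomy (inside p) = inj₁ p
  dichotomy (outside _ eq) = inj₂ eq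
membership (rvar _) ⊥ₐ = outside (λ ()) refl
membership (rvar _) (lam _) = outside (λ ()) refl
membership (rvar _) (app _ _) = outside (λ ()) refl
membership (rvar _) (_ ⊕ _) = outside (λ ()) refl
membership (rlam _) ⊥ₐ = outside (λ ()) refl
membership (rlam _) (var _) = outside (λ ()) refl
membership (rlam _) (app _ _) = outside (λ ()) refl
membership (rlam _) (_ ⊕ _) = outside (λ ()) refl
membership (rapp _ _) ⊥ₐ = outside (λ ()) refl
membership (rapp _ _) (var _) = outside (λ ()) refl
membership (rapp _ _) (lam _) = outside (λ ()) refl
membership (rapp _ _) (_ ⊕ _) = outside (λ ()) refl
membership (_ ⊕•) ⊥ₐ = outside (λ ()) refl
membership (_ ⊕•) (var _) = outside (λ ()) refl
membership (_ ⊕•) (lam _) = outside (λ ()) refl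
membership (_ ⊕•) (app _ _) = outside (λ ()) refl
membership (•⊕ _) ⊥ₐ = outside (λ ()) refl
membership (•⊕ _) (var _) = outside (λ ()) refl
membership (•⊕ _) (lam _) = outside (λ ()) refl
membership (•⊕ _) (app _ _) = outside (λ ()) refl

-- The normal form of the Taylor expansion

-- The normal term `u` survives the `k` steps and must be its own origin: for the origin `s₀` given
-- by `unLⁿ`, `matches u s₀` equals `matches u u`, which is `mult u` and not 0.
headSum-stable : ∀ k N {u e} → Nf u → u ∈𝒯 emb N → e ∈𝒯 emb N → headSum k (λ e → matches e u) e ≡ matches e u
headSum-stable k N {u} {e} nu u∈ e∈ with unLⁿ k N (Nf-∈𝒯-L k N nu u∈)
... | s₀ , _ , eq = trans (eq e∈) (sym (matches-∼ʳ e (matches-≢0 u s₀ λ ≡0 → 1≰0 (≡.subst (1 ≤_) (chain ≡0) (mult-positive u)))))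
  where
  1≰0 : ¬ (1 ≤ 0)
  1≰0 ()
  chain : matches u s₀ ≡ 0 → mult u ≡ 0
  chain ≡0 = trans (sym (matches-∼ u u refl)) (trans (sym (headSum-Nf k _ nu)) (trans (eq u∈) ≡0))

sumℚ-map-zero : ∀ {xs} {f : RTerm → ℚ} → All (λ x → f x ≡ 0ℚ) xs → sumℚ (map f xs) ≡ 0ℚ
sumℚ-map-zero {xs} ps = trans (sumℚ-congᴬ ps λ _ eq → eq) (sumℚ-zero xs)

minus-positive-< : ∀ q {e} → 0ℚ <ℚ e → (q -ℚ e) <ℚ q
minus-positive-< q {e} 0<e = ≡.subst ((q -ℚ e) <ℚ_) (ℚ.+-identityʳ q) (ℚ.+-monoʳ-< q (ℚ.neg-antimono-< 0<e))

HasSum-zero : ∀ {f} → (∀ s → f s ≡ 0ℚ) → HasSum f 0ℚ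
HasSum-zero {f} f≡0 = (λ l _ → ℚ.≤-reflexive (sumℚ-map-zero (All.universal f≡0 l))) , λ e 0<e → [] , [] , minus-positive-< 0ℚ 0<e

-- A list of pairwise distinct terms meets the class of `s₀` at most once, and the singleton list
-- already attains the sum.
HasSum-single : ∀ {f q} s₀ → 0ℚ ≤ℚ q → f s₀ ≡ q → (∀ s → s ∼ s₀ → f s ≤ℚ q) → (∀ s → ¬ (s ∼ s₀) → f s ≡ 0ℚ) → HasSum f q
HasSum-single {f} {q} s₀ 0≤q f≡q f≤q f≡0 = upper , λ e 0<e →
    s₀ ∷ [] , [] ∷ [] , ≡.subst ((q -ℚ e) <ℚ_) (sym (trans (ℚ.+-identityʳ (f s₀)) f≡q)) (minus-positive-< q 0<e)
  where
  upper : ∀ l → Distinct l → sumℚ (map f l) ≤ℚ q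
  upper [] _ = 0≤q
  upper (s ∷ l) (s≠ ∷ d) with s ∼? s₀
  ... | yes s∼s₀ = ≡.subst (_≤ℚ q) (sym (trans (cong (f s +ℚ_) (sumℚ-map-zero
      (All.map (λ {t} s≠t → f≡0 t (λ t∼s₀ → ==-false⁻ s t s≠t (trans s∼s₀ (sym t∼s₀)))) s≠))) (ℚ.+-identityʳ (f s)))) (f≤q s s∼s₀)
  ... | no s≁s₀ = ≡.subst (_≤ℚ q) (sym (trans (cong (_+ℚ sumℚ (map f l)) (f≡0 s s≁s₀)) (ℚ.+-identityˡ (sumℚ (map f l))))) (upper l d)

T≢0⇒∈𝒯 : ∀ {s N} → T N s ≢ 0ℚ → s ∈𝒯 N
T≢0⇒∈𝒯 {s} {N} T≢0 with membership s N
... | inside p = p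
... | outside _ eq = contradiction eq T≢0

∈𝒯⇒T≢0 : ∀ {s N} → s ∈𝒯 N → T N s ≢ 0ℚ
∈𝒯⇒T≢0 {s} p eq = inv≢0 (mult-positive s) (trans (sym (T-∈ p)) eq)

module Expansion (M : Term) {nf : RTerm → List RTerm} (isNF : IsNF nf) (u : RTerm) where
  open Normalization isNF

  -- The coefficient of `u` in NF(s) multiplied by m(u), the form in which it can be traced back
  -- through substitution.
  coefficient : RTerm → ℕ
  coefficient = normalSum (λ e → matches e u)

  coefficient-count : ∀ s → coefficient s ≡ count u (nf s) * mult u
  coefficient-count s = trans (∑-cong (nf s) λ e → matches-δ e u) (trans (∑-*ʳ (nf s) (δ u) (mult u))
    (cong (_* mult u) (sym (count-∑ u (nf s)))))

  -- The reduction behind `nf` is unknown; by additivity the iteration of `Lr` may take its place.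
  coefficient-headSum : ∀ m {s} → AllAfter m Nf s → coefficient s ≡ headSum m (λ e → matches e u) s
  coefficient-headSum m {s} nfs = trans (headSum-inv m coefficient (normalSum-invariant _) s)
    (headSum-cong m (λ e ne → normalSum-irreducible _ (Nf-irreducible ne)) nfs)

  -- The unique term of 𝒯 M, up to ∼, whose normal form contains u.
  coefficient-∈𝒯BT : u ∈𝒯BT M → ∃ λ s₀ → s₀ ∈𝒯 emb M × (∀ {s} → s ∈𝒯 emb M → coefficient s ≡ matches s s₀)
  coefficient-∈𝒯BT (B , (_ , n , B≤) , T≢0) with unLⁿ n M (eBT⊆𝒯 (Lⁿ n M) (∈𝒯-mono B≤ (T≢0⇒∈𝒯 T≢0)))
  ... | s₀ , s₀∈ , eq = s₀ , s₀∈ , λ {s} s∈ → let m , nfs = Lr-terminates s (≺-wellFounded s) in begin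
      coefficient s
        -- Since `s` is normal after `m` steps, it is so after `n + m`. Cutting this number at `n`,
        -- where `u` is already present, leaves `m` steps that do not change the count of `u`.
        ≡⟨ coefficient-headSum (n + m) (AllAfter-≤ (ℕ.m≤n+m m n) nfs) ⟩
      headSum (n + m) (λ e → matches e u) s
        ≡⟨ headSum-+ n m _ s ⟩
      headSum n (headSum m (λ e → matches e u)) s
        ≡⟨ headSum-cong n (λ e e∈ → headSum-stable m (Lⁿ n M) (eBT-Nf (Lⁿ n M) u∈eBT) (eBT⊆𝒯 (Lⁿ n M) u∈eBT) e∈) (AllAfter-∈𝒯 n M s∈) ⟩
      headSum n (λ e → matches e u) s
        ≡⟨ eq s∈ ⟩
      matches s s₀ ∎
    where
    u∈eBT : u ∈𝒯 eBT (Lⁿ n M)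
    u∈eBT = ∈𝒯-mono B≤ (T≢0⇒∈𝒯 T≢0)

  -- If `u` occurs in NF(s), then after `m` steps it occurs, up to `_∼_`, as a normal element of the
  -- support of `Lⁿ m M`. The whole of `eBT (Lⁿ m M)` is then a suitable element of the Böhm tree.
  coefficient-≢0 : ∀ {s} → s ∈𝒯 emb M → coefficient s ≢ 0 → u ∈𝒯BT M
  coefficient-≢0 {s} s∈ ≢0 with Lr-terminates s (≺-wellFounded s)
  ... | m , nfs with headSum-support m M s∈ nfs (≢0 ∘ trans (coefficient-headSum m nfs))
  ... | e , e∈ , ne , e≢0 = eBT (Lⁿ m M) , (eBT∈𝒩 (Lⁿ m M) , m , ≤-refl) ,
    ∈𝒯⇒T≢0 (∈𝒯-∼ (matches-≢0 e u e≢0) (Nf∈eBT (Lⁿ m M) e∈ ne))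

  term-zero : ∀ s → (s ∈𝒯 emb M → coefficient s ≡ 0) → NFfamily nf M u s ≡ 0ℚ
  term-zero s z with membership s (emb M)
  ... | outside _ eq = trans (cong (_*ℚ fromℕ (count u (nf s))) eq) (ℚ.*-zeroˡ (fromℕ (count u (nf s))))
  ... | inside s∈ with ℕ.m*n≡0⇒m≡0∨n≡0 (count u (nf s)) (trans (sym (coefficient-count s)) (z s∈))
  ...   | inj₁ c≡0 = trans (cong (λ c → T (emb M) s *ℚ fromℕ c) c≡0) (ℚ.*-zeroʳ (T (emb M) s))
  ...   | inj₂ m≡0 with () ← ≡.subst (1 ≤_) m≡0 (mult-positive u)

  -- With c the coefficient of `u` in NF(s), c m(u) = m(s), so the factor 1/m(s) of the Taylor
  -- expansion leaves 1/m(u).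
  term-inv : ∀ {s} → s ∈𝒯 emb M → coefficient s ≡ mult s → NFfamily nf M u s ≡ inv (mult u)
  term-inv {s} s∈ eq = inv-unique (mult-positive u) (begin
    fromℕ (mult u) *ℚ (T (emb M) s *ℚ fromℕ c)     ≡⟨ cong (λ q → fromℕ (mult u) *ℚ (q *ℚ fromℕ c)) (T-∈ s∈) ⟩
    fromℕ (mult u) *ℚ (inv (mult s) *ℚ fromℕ c)    ≡⟨ ℚ.*-comm (fromℕ (mult u)) _ ⟩
    (inv (mult s) *ℚ fromℕ c) *ℚ fromℕ (mult u)    ≡⟨ ℚ.*-assoc (inv (mult s)) (fromℕ c) _ ⟩
    inv (mult s) *ℚ (fromℕ c *ℚ fromℕ (mult u))    ≡⟨ cong (inv (mult s) *ℚ_) (trans (sym (fromℕ-* c (mult u)))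
                                                      (cong fromℕ (trans (sym (coefficient-count s)) eq))) ⟩
    inv (mult s) *ℚ fromℕ (mult s)                ≡⟨ trans (ℚ.*-comm (inv (mult s)) _) (fromℕ-inv (mult-positive s)) ⟩
    1ℚ                                           ∎)
    where
    c = count u (nf s)

  sum-∈𝒯BT : u ∈𝒯BT M → HasSum (NFfamily nf M u) (inv (mult u))
  sum-∈𝒯BT u∈ with coefficient-∈𝒯BT u∈
  ... | s₀ , s₀∈ , eq = HasSum-single s₀ (inv-≥0 (mult u)) (term-inv s₀∈ (trans (eq s₀∈) (matches-∼ s₀ s₀ refl)))
    (λ s s∼s₀ → let s∈ = ∈𝒯-∼ (sym s∼s₀) s₀∈ in
      ℚ.≤-reflexive (term-inv s∈ (trans (eq s∈) (trans (matches-∼ s s₀ s∼s₀) (sym (mult-∼ s s₀ s∼s₀))))))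
    (λ s s≁s₀ → term-zero s λ s∈ → trans (eq s∈) (matches-≁ s s₀ s≁s₀))

  -- A nonzero coefficient would put `u` in the Böhm tree. Equality with 0 in ℕ is decidable, so
  -- refuting this is enough, without deciding membership in the Böhm tree.
  sum-∉𝒯BT : ¬ (u ∈𝒯BT M) → HasSum (NFfamily nf M u) 0ℚ
  sum-∉𝒯BT u∉ = HasSum-zero λ s → term-zero s λ s∈ → decidable-stable (coefficient s ℕ.≟ 0) (u∉ ∘ coefficient-≢0 s∈)

theorem6p10 : (M : Term) (nf : RTerm → List RTerm) → IsNF nf → (u : RTerm) →
    (u ∈𝒯BT M → HasSum (NFfamily nf M u) (inv (mult u))) ×
    (¬ (u ∈𝒯BT M) → HasSum (NFfamily nf M u) 0ℚ)
theorem6p10 M nf isNF u = sum-∈𝒯BT , sum-∉𝒯BT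
  where open Expansion M isNF u
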